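{- For $L$ and $M$ non-negative integers, we have \begin{equation*} \sum_{\substack{i,m\geq 0,\\ i+m\equiv 0\text{ (mod 2)}}} q^{\frac{m^2+3i^2}{2}} {L+M-i\brack L}_{q^3}{3(L-i)\brack m}_{q}{2(L-i)+\frac{i-m}{2}\brack 2(L-i)}_{q^3}=\sum_{j=-\infty}^\infty q^{3j^2+j}\, \mathcal{S}\left(L,M;\,2j,\,j;\,q^3\right). \end{equation*}
   Context: Here $|q|<1$, $(a;q)_n=(1-a)(1-aq)\cdots(1-aq^{n-1})$, and ${m+n \brack m}_q = \frac{(q;q)_{m+n}}{(q;q)_m(q;q)_n}$ for $m,n\geq 0$ and $0$ otherwise. The refined $q$-trinomial coefficient (Warnaar) is \[\mathcal{S}(L,M;\,a,b;\,q) := \sum_{n\geq0} q^{n(n+a)} {M+L-a-2n\brack M}_q {M-a+b \brack n}_q {M+a-b \brack n+a}_q.\] -}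

module Defs where

open import Algebra.Bundles using (CommutativeRing)
open import Data.Nat as ℕ using (ℕ; zero; suc; _%_; _/_)
open import Data.Integer as ℤ using (ℤ; +_; -[1+_]; ∣_∣)
open import Data.Bool using (if_then_else_)
open import Relation.Nullary.Decidable using (⌊_⌋)

module _ {c ℓ} (R : CommutativeRing c ℓ) where
  open CommutativeRing R

  pow : Carrier → ℕ → Carrier
  pow x zero = 1#
  pow x (suc n) = x * pow x n

  ∑< : ℕ → (ℕ → Carrier) → Carrier
  ∑< zero f = 0#
  ∑< (suc N) f = ∑< N f + f N

  ∑ℤ : ℕ → (ℤ → Carrier) → Carrier
  ∑ℤ N f = ∑< (suc (N ℕ.+ N)) (λ k → f (+ k ℤ.- + N))

  qbin : Carrier → ℕ → ℕ → Carrier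
  qbin q zero zero = 1#
  qbin q zero (suc k) = 0#
  qbin q (suc n) zero = 1#
  qbin q (suc n) (suc k) = qbin q n k + pow q (suc k) * qbin q n (suc k)

  -- [A brack B]_q for integers A, B: equals (q;q)_A / ((q;q)_B (q;q)_{A-B})
  -- when B ≥ 0 and A - B ≥ 0, and 0 otherwise.
  qbinZ : Carrier → ℤ → ℤ → Carrier
  qbinZ q A B with B | A ℤ.- B
  ... | + b | + d = qbin q (b ℕ.+ d) b
  ... | _   | _   = 0#

  -- Warnaar's refined q-trinomial coefficient S(L, M; a, b; q).
  -- The n-sum is cut at n ≤ M + L + |a| + |b|: beyond that
  -- n > M - a + b, so the factor [M-a+b brack n] vanishes.
  -- q^{n(n+a)} is taken as q^{|n(n+a)|}; whenever n(n+a) < 0 we have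
  -- n + a < 0 and the factor [M+a-b brack n+a] vanishes.
  S : Carrier → ℕ → ℕ → ℤ → ℤ → Carrier
  S q L M a b =
    ∑< (suc (M ℕ.+ L ℕ.+ ∣ a ∣ ℕ.+ ∣ b ∣)) λ n →
      pow q ∣ + n ℤ.* (+ n ℤ.+ a) ∣
      * qbinZ q (+ M ℤ.+ + L ℤ.- a ℤ.- + 2 ℤ.* + n) (+ M)
      * qbinZ q (+ M ℤ.- a ℤ.+ b) (+ n)
      * qbinZ q (+ M ℤ.+ a ℤ.- b) (+ n ℤ.+ a)

  -- left-hand side of Theorem 6.1; i, m range over 0..L+M (terms with
  -- i > L or m > i vanish), restricted to i + m even.
  -- (i - m)/2 is computed as (i + m)/2 - m, exact since i + m is even.
  LHS : Carrier → ℕ → ℕ → Carrier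
  LHS q L M =
    ∑< (suc (L ℕ.+ M)) λ i → ∑< (suc (L ℕ.+ M)) λ m →
      if ⌊ (i ℕ.+ m) % 2 ℕ.≟ 0 ⌋
      then pow q ((m ℕ.* m ℕ.+ 3 ℕ.* (i ℕ.* i)) / 2)
           * qbinZ (pow q 3) (+ L ℤ.+ + M ℤ.- + i) (+ L)
           * qbinZ q (+ 3 ℤ.* (+ L ℤ.- + i)) (+ m)
           * qbinZ (pow q 3)
               (+ 2 ℤ.* (+ L ℤ.- + i) ℤ.+ (+ ((i ℕ.+ m) / 2) ℤ.- + m))
               (+ 2 ℤ.* (+ L ℤ.- + i))
      else 0#

  -- right-hand side; j ranges over -(L+M) .. L+M (terms with |j| > M vanish),
  -- and 3j²+j ≥ 0 for every integer j.
  RHS : Carrier → ℕ → ℕ → Carrier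
  RHS q L M =
    ∑ℤ (L ℕ.+ M) λ j →
      pow q ∣ + 3 ℤ.* j ℤ.* j ℤ.+ j ∣ * S (pow q 3) L M (+ 2 ℤ.* j) j

{-# OPTIONS --safe #-}
-- Put Q = q³. Both sides H(L, M) of the identity turn out to have the same generating functions
-- K_M(y) = Σ_L H(L, M) y^L, because both families satisfy
--   (1 - Q^(M+2) y) K_(M+2) = (1 + Q + (q² + q⁴) Q^(2M+2) y²) K_(M+1)
--                             + (-Q - Q^(M+2) y + Q^(2M+2) y² + Q^(3M+3) y³) K_M
-- with the same K_0 and K_1.
--
-- On the left, the sum over m is, up to a power of q, the coefficient of xⁱ in
-- f_l(x) = (-xq; q)_(3l) / (x²q; Q)_(2l+1) with l = L - i, and these series satisfy
--   (1 - q²x) (1 - qx²) f_(l+1)(x) = (1 + qx) (1 + q³x) f_l(Qx).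
-- Extracting the coefficient of xⁱ, passing from (l, i) to (L, i), and multiplying the generating
-- function in i by 1/(t; Q)_(L+1), which produces the factor [L+M-i brack L]_Q, gives the recurrence.
--
-- On the right, with k = n + j the exponents add up to 3k² - k + (k + j), so that K_M(y) is
-- 1/(y; Q)_(M+1) times Σ_k q^(3k²-k) y^(2k) b_k, where b_k is the coefficient of u^(2k) in
-- g_N(u) = 1/((u; Q)_(N+1) (uq; Q)_(N+1)) with N = M - k. The relations between g_N, g_(N+1) and
-- g_(N+2) combine into a three-term one involving only even powers of u, whence the recurrence.
module Submission where

open import Defs
open import Algebra.Bundles using (CommutativeRing)
open import Algebra.Solver.Ring.AlmostCommutativeRing
  using (fromCommutativeRing; _-Raw-AlmostCommutative⟶_)
open import Data.Bool using (true; false; if_then_else_)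
open import Data.Empty using (⊥-elim)
open import Data.Integer as ℤ using (ℤ; +_; -[1+_]; ∣_∣)
open import Data.Nat as ℕ using (ℕ; zero; suc; _∸_; _%_; _/_)
open import Data.Product as Product using (∃; _,_; proj₁)
open import Data.Sum using (_⊎_; inj₁; inj₂)
open import Relation.Binary.PropositionalEquality as ≡ using (_≡_)
open import Relation.Nullary.Decidable using (⌊_⌋; dec⇒maybe)
import Algebra.Construct.Pointwise as Pointwise
import Algebra.Properties.Semiring.Exp as Exp
import Algebra.Solver.Ring as RingSolver
import Data.Integer.Properties as ℤ
import Data.Integer.Solver as ℤ-Solver
import Data.Maybe.Base as Maybe
import Data.Nat.DivMod as ℕ
import Data.Nat.Properties as ℕ
import Data.Nat.Solver as ℕ-Solver
import Relation.Binary.Reasoning.Setoid as SetoidReasoning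

-- An arbitrary commutative ring offers no division, so no q-binomial is handled as a quotient.
-- Reciprocals of q-products are series with q-binomial coefficients, known through equations f = h
-- + aXf; such an equation has one solution, which is how factors 1 - aX get cancelled. The relation
-- for f_l is short because the denominator factor 1 - q⁴x² meets the numerator factor 1 + q²x. In
-- passing from (l, i) to (L, i), every term gets as many shifts of L as substitutions of Qx for x;
-- stripping the first k factors of 1/(t; Q)_(L+1) has the same effect on that product, so the
-- relation survives the multiplication. On the right, with c = Q^(N+1), the combination works
-- because (1 + Qcu)(1 + qQcu) + Q(1 - cu)(1 - qcu) has no linear term in u. The left recurrence is
-- found for series in t indexed by L, the right one for series in y indexed by M; the left one has
-- to be transposed before the two can be compared.

-- A ring solver with integer coefficients.

module IntegerCoefficientSolver {c ℓ} (R : CommutativeRing c ℓ) where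
  open CommutativeRing R
  open SetoidReasoning setoid
  open import Algebra.Properties.Ring ring
  open import Algebra.Properties.AbelianGroup +-abelianGroup using (⁻¹-∙-comm)
  open import Algebra.Properties.CommutativeSemigroup +-commutativeSemigroup using (interchange)
  open import Algebra.Properties.Semiring.Mult.TCOptimised semiring

  -- Coefficients come from ℤ because the solver has to decide their equality, which is impossible
  -- in an arbitrary `R`.
  fromℤ : ℤ → Carrier
  fromℤ (+ n) = n × 1#
  fromℤ -[1+ n ] = - (suc n × 1#)

  fromℤ-⊖ : ∀ m n → fromℤ (m ℤ.⊖ n) ≈ m × 1# - n × 1#
  fromℤ-⊖ m zero = sym (trans (+-congˡ -0#≈0#) (+-identityʳ _))
  fromℤ-⊖ zero (suc n) = sym (+-identityˡ _)
  fromℤ-⊖ (suc m) (suc n) = begin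
    fromℤ (suc m ℤ.⊖ suc n)              ≡⟨ ≡.cong fromℤ (ℤ.[1+m]⊖[1+n]≡m⊖n m n) ⟩
    fromℤ (m ℤ.⊖ n)                      ≈⟨ fromℤ-⊖ m n ⟩
    m × 1# - n × 1#                      ≈⟨ +-identityˡ _ ⟨
    0# + (m × 1# - n × 1#)               ≈⟨ +-congʳ (-‿inverseʳ 1#) ⟨
    (1# - 1#) + (m × 1# - n × 1#)        ≈⟨ interchange _ _ _ _ ⟩
    (1# + m × 1#) + (- 1# - n × 1#)      ≈⟨ +-congˡ (⁻¹-∙-comm _ _) ⟩
    (1# + m × 1#) - (1# + n × 1#)        ≈⟨ +-cong (1+× m 1#) (-‿cong (1+× n 1#)) ⟨
    suc m × 1# - suc n × 1#              ∎

  fromℤ-neg : ∀ i → fromℤ (ℤ.- i) ≈ - fromℤ i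
  fromℤ-neg (+ zero) = sym -0#≈0#
  fromℤ-neg (+ suc n) = refl
  fromℤ-neg -[1+ n ] = sym (-‿involutive _)

  fromℤ-+ : ∀ i j → fromℤ (i ℤ.+ j) ≈ fromℤ i + fromℤ j
  fromℤ-+ (+ m) (+ n) = ×-homo-+ 1# m n
  fromℤ-+ (+ m) -[1+ n ] = fromℤ-⊖ m (suc n)
  fromℤ-+ -[1+ m ] (+ n) = trans (fromℤ-⊖ n (suc m)) (+-comm _ _)
  fromℤ-+ -[1+ m ] -[1+ n ] = begin
    - (suc (suc (m ℕ.+ n)) × 1#)           ≡⟨ ≡.cong (λ k → - (k × 1#)) (ℕ-suc m n) ⟨
    - ((suc m ℕ.+ suc n) × 1#)             ≈⟨ -‿cong (×-homo-+ 1# (suc m) (suc n)) ⟩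
    - (suc m × 1# + suc n × 1#)            ≈⟨ ⁻¹-∙-comm _ _ ⟨
    - (suc m × 1#) - suc n × 1#            ∎
    where
    ℕ-suc : ∀ m n → suc m ℕ.+ suc n ≡ suc (suc (m ℕ.+ n))
    ℕ-suc m n = ≡.cong suc (ℕ.+-suc m n)

  fromℤ-+* : ∀ m j → fromℤ (+ m ℤ.* j) ≈ m × 1# * fromℤ j
  fromℤ-+* m (+ n) = trans (reflexive (≡.cong fromℤ (≡.sym (ℤ.pos-* m n)))) (×1-homo-* m n)
  fromℤ-+* m -[1+ n ] = begin
    fromℤ (+ m ℤ.* -[1+ n ])       ≡⟨ ≡.cong fromℤ (ℤ.neg-distribʳ-* (+ m) (+ suc n)) ⟨
    fromℤ (ℤ.- (+ m ℤ.* + suc n))  ≈⟨ fromℤ-neg (+ m ℤ.* + suc n) ⟩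
    - fromℤ (+ m ℤ.* + suc n)      ≈⟨ -‿cong (fromℤ-+* m (+ suc n)) ⟩
    - (m × 1# * (suc n × 1#))      ≈⟨ -‿distribʳ-* _ _ ⟩
    m × 1# * - (suc n × 1#)        ∎

  fromℤ-* : ∀ i j → fromℤ (i ℤ.* j) ≈ fromℤ i * fromℤ j
  fromℤ-* (+ m) j = fromℤ-+* m j
  fromℤ-* -[1+ m ] j = begin
    fromℤ (-[1+ m ] ℤ.* j)         ≡⟨ ≡.cong fromℤ (ℤ.neg-distribˡ-* (+ suc m) j) ⟨
    fromℤ (ℤ.- (+ suc m ℤ.* j))    ≈⟨ fromℤ-neg (+ suc m ℤ.* j) ⟩
    - fromℤ (+ suc m ℤ.* j)        ≈⟨ -‿cong (fromℤ-+* (suc m) j) ⟩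
    - (suc m × 1# * fromℤ j)       ≈⟨ -‿distribˡ-* _ _ ⟩
    - (suc m × 1#) * fromℤ j       ∎

  morphism : ℤ.+-*-rawRing -Raw-AlmostCommutative⟶ fromCommutativeRing R
  morphism = record
    { ⟦_⟧ = fromℤ
    ; +-homo = fromℤ-+
    ; *-homo = fromℤ-*
    ; -‿homo = fromℤ-neg
    ; 0-homo = refl
    ; 1-homo = refl
    }

  open RingSolver ℤ.+-*-rawRing (fromCommutativeRing R) morphism
    (λ i j → Maybe.map (λ i≡j → reflexive (≡.cong fromℤ i≡j)) (dec⇒maybe (i ℤ.≟ j))) public
    using (Polynomial; solve; _:=_; _:+_; _:*_; _:-_; :-_; _:^_; con)

-- Polynomial identities behind the recurrences, later applied in the ring of power series.

module Elimination {c ℓ} (A : CommutativeRing c ℓ) where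
  open CommutativeRing A
  open import Algebra.Properties.Group +-group using (∙-cancelʳ)

  -- Deduces s ≈ t from s - t = r (a - b), with the subtractions moved across.
  eliminate : ∀ {a b} → a ≈ b → ∀ r {s t} → s + r * b ≈ t + r * a → s ≈ t
  eliminate {a} a≈b r {s} {t} eq =
    ∙-cancelʳ (r * a) s t (trans (+-congˡ (*-congˡ a≈b)) eq)

module Identities {c ℓ} (A : CommutativeRing c ℓ) where
  open CommutativeRing A
  open Exp semiring using (_^_)
  open Elimination A
  open IntegerCoefficientSolver A

  private
    𝟏 : ∀ {n} → Polynomial n
    𝟏 = con (+ 1)

  -- The conclusion is (1 - q²x)(1 - qx²)eh = (1 + qx)(1 + q³x)EH, expanded. The factor 1 - q⁴x² =
  -- (1 - q²x)(1 + q²x) between `u` and `H` cancels the middle factor of `e`.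
  product-recurrence : ∀ q x e E h u H →
    e ≈ (1# + q * x) * ((1# + q ^ 2 * x) * ((1# + q ^ 3 * x) * E)) →
    h ≈ u + q * (x * (x * h)) →
    u ≈ H + q ^ 4 * (x * (x * u)) →
    e * h ≈ E * H + q * (x * (E * H)) + q ^ 3 * (x * (E * H)) + q ^ 4 * (x * (x * (E * H)))
      + (q ^ 2 * (x * (e * h)) + q * (x * (x * (e * h))) - q ^ 3 * (x * (x * (x * (e * h)))))
  product-recurrence q x e E h u H e≈ h≈ u≈ =
    eliminate e≈ ((1# - q ^ 2 * x) * u) (
    eliminate h≈ ((1# - q ^ 2 * x) * e) (
    eliminate u≈ ((1# + q * x) * ((1# + q ^ 3 * x) * E)) (
    solve 7 (λ q x e E h u H →
      e :* h
        :+ (𝟏 :- q :^ 2 :* x) :* u :* ((𝟏 :+ q :* x) :* ((𝟏 :+ q :^ 2 :* x) :* ((𝟏 :+ q :^ 3 :* x) :* E)))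
        :+ (𝟏 :- q :^ 2 :* x) :* e :* (u :+ q :* (x :* (x :* h)))
        :+ (𝟏 :+ q :* x) :* ((𝟏 :+ q :^ 3 :* x) :* E) :* (H :+ q :^ 4 :* (x :* (x :* u)))
      := (E :* H :+ q :* (x :* (E :* H)) :+ q :^ 3 :* (x :* (E :* H)) :+ q :^ 4 :* (x :* (x :* (E :* H)))
        :+ (q :^ 2 :* (x :* (e :* h)) :+ q :* (x :* (x :* (e :* h))) :- q :^ 3 :* (x :* (x :* (x :* (e :* h))))))
        :+ (𝟏 :- q :^ 2 :* x) :* u :* e
        :+ (𝟏 :- q :^ 2 :* x) :* e :* h
        :+ (𝟏 :+ q :* x) :* ((𝟏 :+ q :^ 3 :* x) :* E) :* u)
      refl q x e E h u H)))

  collect-4 : ∀ q y → q ^ 3 * (q * y) ≈ q ^ 4 * y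
  collect-4 = solve 2 (λ q y → q :^ 3 :* (q :* y) := q :^ 4 :* y) refl

  dilated-product : ∀ q x E →
    (1# + q * x) * ((1# + q * (q * x)) * ((1# + q * (q * (q * x))) * E))
    ≈ (1# + q * x) * ((1# + q ^ 2 * x) * ((1# + q ^ 3 * x) * E))
  dilated-product = solve 3 (λ q x E →
    (𝟏 :+ q :* x) :* ((𝟏 :+ q :* (q :* x)) :* ((𝟏 :+ q :* (q :* (q :* x))) :* E))
    := (𝟏 :+ q :* x) :* ((𝟏 :+ q :^ 2 :* x) :* ((𝟏 :+ q :^ 3 :* x) :* E))) refl

  product-initial : ∀ q x e h →
    e ≈ 1# → h ≈ 1# + q * (x * (x * h)) →
    e * h ≈ 1# - q ^ 2 * x
      + (q ^ 2 * (x * (e * h)) + q * (x * (x * (e * h))) - q ^ 3 * (x * (x * (x * (e * h)))))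
  product-initial q x e h e≈ h≈ =
    eliminate e≈ ((1# - q ^ 2 * x) * (1# - q * (x * x)) * h) (
    eliminate h≈ (1# - q ^ 2 * x) (
    solve 4 (λ q x e h →
      e :* h :+ (𝟏 :- q :^ 2 :* x) :* (𝟏 :- q :* (x :* x)) :* h :* 𝟏
        :+ (𝟏 :- q :^ 2 :* x) :* (𝟏 :+ q :* (x :* (x :* h)))
      := (𝟏 :- q :^ 2 :* x
        :+ (q :^ 2 :* (x :* (e :* h)) :+ q :* (x :* (x :* (e :* h))) :- q :^ 3 :* (x :* (x :* (x :* (e :* h))))))
        :+ (𝟏 :- q :^ 2 :* x) :* (𝟏 :- q :* (x :* x)) :* h :* e
        :+ (𝟏 :- q :^ 2 :* x) :* h)
      refl q x e h))

  difference : ∀ f g → f ≈ f - g + g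
  difference = solve 2 (λ f g → f := f :- g :+ g) refl

  move : ∀ {f g h} → f ≈ g + h → f - h ≈ g
  move {f} {g} {h} f≈ = trans (+-congʳ f≈) (solve 2 (λ g h → g :+ h :- h := g) refl g h)

  difference-step : ∀ {a x f g} → f ≈ g + a * (x * f) → f - x * f ≈ g - x * g + a * (x * (f - x * f))
  difference-step {a} {x} {f} {g} f≈ = eliminate f≈ (1# - x)
    (solve 4 (λ a x f g → f :- x :* f :+ (𝟏 :- x) :* (g :+ a :* (x :* f))
      := g :- x :* g :+ a :* (x :* (f :- x :* f)) :+ (𝟏 :- x) :* f) refl a x f g)

  weights-X² : ∀ q x f → q * (x * (q * (q ^ 3 * (x * f)))) ≈ q ^ 5 * (x * (x * f))
  weights-X² = solve 3 (λ q x f →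
    q :* (x :* (q :* (q :^ 3 :* (x :* f)))) := q :^ 5 :* (x :* (x :* f))) refl

  weights-X³ : ∀ q x f →
    q * (x * (q ^ 5 * (q ^ 3 * (x * (q ^ 3 * (x * f)))))) ≈ q ^ 12 * (x * (x * (x * f)))
  weights-X³ = solve 3 (λ q x f →
    q :* (x :* (q :^ 5 :* (q :^ 3 :* (x :* (q :^ 3 :* (x :* f)))))) := q :^ 12 :* (x :* (x :* (x :* f)))) refl

  collect-2-1 : ∀ q x f → q ^ 2 * (q * (x * f)) ≈ q ^ 3 * (x * f)
  collect-2-1 = solve 3 (λ q x f → q :^ 2 :* (q :* (x :* f)) := q :^ 3 :* (x :* f)) refl

  collect-1-1 : ∀ q x f → q * (q * (x * f)) ≈ q ^ 2 * (x * f)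
  collect-1-1 = solve 3 (λ q x f → q :* (q :* (x :* f)) := q :^ 2 :* (x :* f)) refl

  collect-3-1 : ∀ q x f → q ^ 3 * (q * (x * f)) ≈ q ^ 4 * (x * f)
  collect-3-1 = solve 3 (λ q x f → q :^ 3 :* (q :* (x :* f)) := q :^ 4 :* (x :* f)) refl

  collect-1-5 : ∀ q y → q * (q ^ 5 * y) ≈ q ^ 6 * y
  collect-1-5 = solve 2 (λ q y → q :* (q :^ 5 :* y) := q :^ 6 :* y) refl

  collect-4-5 : ∀ q y → q ^ 4 * (q ^ 5 * y) ≈ q ^ 9 * y
  collect-4-5 = solve 2 (λ q y → q :^ 4 :* (q :^ 5 :* y) := q :^ 9 :* y) refl

  collect-3-12 : ∀ q y → q ^ 3 * (q ^ 12 * y) ≈ q ^ 15 * y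
  collect-3-12 = solve 2 (λ q y → q :^ 3 :* (q :^ 12 :* y) := q :^ 15 :* y) refl

  vanishing-inhomogeneous : ∀ q x →
    0# + q ^ 2 * (x * 0#) + q ^ 4 * (x * 0#) + q ^ 9 * (x * (x * 0#)) ≈ 0#
  vanishing-inhomogeneous = solve 2 (λ q x →
    con (+ 0) :+ q :^ 2 :* (x :* con (+ 0)) :+ q :^ 4 :* (x :* con (+ 0)) :+ q :^ 9 :* (x :* (x :* con (+ 0)))
    := con (+ 0)) refl

  vanishing-source : ∀ q x → 0# - q ^ 3 * (x * 0#) ≈ 0#
  vanishing-source = solve 2 (λ q x → con (+ 0) :- q :^ 3 :* (x :* con (+ 0)) := con (+ 0)) refl

  -- The equation for `ψ` is multiplied by (1 - x)(1 - q³x)p, which turns `b₁` and `b₂` into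
  -- multiples of `c₁` and `c₂`. For `b₃` the third factor 1 - q⁶x is already present, since its two
  -- terms combine to q⁹x²(1 - q⁶x).
  theta-recurrence : ∀ q x p ψ b₁ b₂ b₃ c₁ c₂ c₃ u v →
    ψ ≈ b₁ + q ^ 2 * (x * b₂) + q ^ 4 * (x * b₂) + q ^ 9 * (x * (x * b₃))
      + (u - q ^ 3 * (x * v))
      + (q ^ 3 * (x * b₁) + q ^ 6 * (x * (x * b₂)) - q ^ 15 * (x * (x * (x * b₃)))) →
    (1# - x) * (p * b₁) ≈ c₁ →
    (1# - q ^ 3 * x) * ((1# - x) * (p * b₂)) ≈ c₂ →
    (1# - q ^ 6 * x) * ((1# - q ^ 3 * x) * ((1# - x) * (p * b₃))) ≈ c₃ →
    (1# - x) * (p * u) ≈ u →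
    (1# - q ^ 3 * x) * ((1# - x) * (p * v)) ≈ v →
    p * ψ + q ^ 3 * (x * (x * (p * ψ))) + q ^ 6 * (x * (x * c₁))
    ≈ x * (p * ψ) + q ^ 3 * (x * (p * ψ)) + c₁
      + (q ^ 2 * (x * c₂) + q ^ 4 * (x * c₂) + q ^ 6 * (x * (x * c₂))) + q ^ 9 * (x * (x * c₃))
      + (u - q ^ 3 * (x * u) - q ^ 3 * (x * v))
  theta-recurrence q x p ψ b₁ b₂ b₃ c₁ c₂ c₃ u v hψ h₁ h₂ h₃ hu hv =
    eliminate hψ ((1# - x) * (1# - q ^ 3 * x) * p) (
    eliminate h₁ ((1# - q ^ 3 * x) * (1# + q ^ 3 * x)) (
    eliminate h₂ (q ^ 2 * x + q ^ 4 * x + q ^ 6 * x * x) (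
    eliminate h₃ (q ^ 9 * x * x) (
    eliminate hu (1# - q ^ 3 * x) (
    eliminate hv (- (q ^ 3 * x)) (
    solve 12 (λ q x p ψ b₁ b₂ b₃ c₁ c₂ c₃ u v →
      p :* ψ :+ q :^ 3 :* (x :* (x :* (p :* ψ))) :+ q :^ 6 :* (x :* (x :* c₁))
        :+ (𝟏 :- x) :* (𝟏 :- q :^ 3 :* x) :* p :*
          (b₁ :+ q :^ 2 :* (x :* b₂) :+ q :^ 4 :* (x :* b₂) :+ q :^ 9 :* (x :* (x :* b₃))
          :+ (u :- q :^ 3 :* (x :* v))
          :+ (q :^ 3 :* (x :* b₁) :+ q :^ 6 :* (x :* (x :* b₂)) :- q :^ 15 :* (x :* (x :* (x :* b₃)))))
        :+ (𝟏 :- q :^ 3 :* x) :* (𝟏 :+ q :^ 3 :* x) :* c₁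
        :+ (q :^ 2 :* x :+ q :^ 4 :* x :+ q :^ 6 :* x :* x) :* c₂
        :+ q :^ 9 :* x :* x :* c₃
        :+ (𝟏 :- q :^ 3 :* x) :* u
        :+ (:- (q :^ 3 :* x)) :* v
      := x :* (p :* ψ) :+ q :^ 3 :* (x :* (p :* ψ)) :+ c₁
        :+ (q :^ 2 :* (x :* c₂) :+ q :^ 4 :* (x :* c₂) :+ q :^ 6 :* (x :* (x :* c₂))) :+ q :^ 9 :* (x :* (x :* c₃))
        :+ (u :- q :^ 3 :* (x :* u) :- q :^ 3 :* (x :* v))
        :+ (𝟏 :- x) :* (𝟏 :- q :^ 3 :* x) :* p :* ψ
        :+ (𝟏 :- q :^ 3 :* x) :* (𝟏 :+ q :^ 3 :* x) :* ((𝟏 :- x) :* (p :* b₁))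
        :+ (q :^ 2 :* x :+ q :^ 4 :* x :+ q :^ 6 :* x :* x) :* ((𝟏 :- q :^ 3 :* x) :* ((𝟏 :- x) :* (p :* b₂)))
        :+ q :^ 9 :* x :* x :* ((𝟏 :- q :^ 6 :* x) :* ((𝟏 :- q :^ 3 :* x) :* ((𝟏 :- x) :* (p :* b₃))))
        :+ (𝟏 :- q :^ 3 :* x) :* ((𝟏 :- x) :* (p :* u))
        :+ (:- (q :^ 3 :* x)) :* ((𝟏 :- q :^ 3 :* x) :* ((𝟏 :- x) :* (p :* v))))
      refl q x p ψ b₁ b₂ b₃ c₁ c₂ c₃ u v))))))

  telescope : ∀ {a p p′ b c} → a * p ≈ p′ → p′ * b ≈ c → a * (p * b) ≈ c
  telescope h h′ = trans (sym (*-assoc _ _ _)) (trans (*-congʳ h) h′)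

  factor-move : ∀ {x f g} → f ≈ g + x * f → (1# - x) * f ≈ g
  factor-move {x} {f} {g} f≈ = eliminate f≈ 1# (
    solve 3 (λ x f g → (𝟏 :- x) :* f :+ 𝟏 :* (g :+ x :* f) := g :+ 𝟏 :* f) refl x f g)

  collect-3-3 : ∀ q x f → q ^ 3 * (q ^ 3 * (x * f)) ≈ q ^ 6 * x * f
  collect-3-3 = solve 3 (λ q x f → q :^ 3 :* (q :^ 3 :* (x :* f)) := q :^ 6 :* x :* f) refl

  -- The row lemmas discard what vanishes because a power of X exceeds the row index; the zeros
  -- stand exactly where the row of the recurrence delivers them.
  row-0-rearrange : ∀ {k z} → k + 0# + 0# ≈ 0# + 0# + z + (0# + 0# + 0#) + 0# + (1# - 0# - 0#) →
    k ≈ 1# + z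
  row-0-rearrange {k} {z} h = eliminate h 1# (solve 2 (λ k z →
    k :+ 𝟏 :* (con (+ 0) :+ con (+ 0) :+ z :+ (con (+ 0) :+ con (+ 0) :+ con (+ 0)) :+ con (+ 0) :+ (𝟏 :- con (+ 0) :- con (+ 0)))
    := 𝟏 :+ z :+ 𝟏 :* (k :+ con (+ 0) :+ con (+ 0))) refl k z)

  row-1-rearrange : ∀ {k a b z d e s t} →
    k + 0# + 0# ≈ a + b + z + (d + e + 0#) + 0# + (0# - s - t) →
    k ≈ a + b + d + e - s - t + z
  row-1-rearrange {k} {a} {b} {z} {d} {e} {s} {t} h = eliminate h 1# (solve 8 (λ k a b z d e s t →
    k :+ 𝟏 :* (a :+ b :+ z :+ (d :+ e :+ con (+ 0)) :+ con (+ 0) :+ (con (+ 0) :- s :- t))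
    := a :+ b :+ d :+ e :- s :- t :+ z :+ 𝟏 :* (k :+ con (+ 0) :+ con (+ 0))) refl k a b z d e s t)

  row-2-rearrange : ∀ {k m n a b z d f} →
    k + m + n ≈ a + b + z + d + f + (0# - 0# - 0#) →
    k ≈ a + b + d + f - m - n + z
  row-2-rearrange {k} {m} {n} {a} {b} {z} {d} {f} h = eliminate h 1# (solve 8 (λ k m n a b z d f →
    k :+ 𝟏 :* (a :+ b :+ z :+ d :+ f :+ (con (+ 0) :- con (+ 0) :- con (+ 0)))
    := a :+ b :+ d :+ f :- m :- n :+ z :+ 𝟏 :* (k :+ m :+ n)) refl k m n a b z d f)

  product-step : ∀ {q x a p p′ d d′} → p ≈ p′ + a * (x * p) → d ≈ d′ + a * (q * (x * d)) →
    p′ * d′ ≈ (1# - a * x) * (1# - q * (a * x)) * (p * d)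
  product-step {q} {x} {a} {p} {p′} {d} {d′} hp hd =
    eliminate hp (- d′) (
    eliminate hd (- ((1# - a * x) * p)) (
    solve 7 (λ q x a p p′ d d′ →
      p′ :* d′ :+ (:- d′) :* (p′ :+ a :* (x :* p)) :+ (:- ((𝟏 :- a :* x) :* p)) :* (d′ :+ a :* (q :* (x :* d)))
      := (𝟏 :- a :* x) :* (𝟏 :- q :* (a :* x)) :* (p :* d) :+ (:- d′) :* p :+ (:- ((𝟏 :- a :* x) :* p)) :* d)
      refl q x a p p′ d d′))

  -- Multiplying the second equation by (1 + q³cx)(1 + q⁴cx) makes the factor of `g₂` even in x;
  -- adding q³ times the first one cancels the linear terms in the factor of `g₁`.
  even-recurrence : ∀ {q x c g₀ g₁ g₂} →
    g₀ ≈ (1# - c * x) * (1# - q * (c * x)) * g₁ →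
    g₁ ≈ (1# - q ^ 3 * c * x) * (1# - q * (q ^ 3 * c * x)) * g₂ →
    g₂ ≈ g₁ + q ^ 3 * g₁ - q ^ 3 * g₀
      + (q ^ 3 * c) * (q ^ 3 * c) * (x * (x * g₂)) + q ^ 2 * ((q ^ 3 * c) * (q ^ 3 * c) * (x * (x * g₂)))
      - q ^ 2 * ((q ^ 3 * c) * (q ^ 3 * c) * ((q ^ 3 * c) * (q ^ 3 * c) * (x * (x * (x * (x * g₂))))))
      + q ^ 4 * (c * c * (x * (x * g₁))) + q ^ 7 * (c * c * (x * (x * g₁)))
  even-recurrence {q} {x} {c} {g₀} {g₁} {g₂} h₀ h₁ =
    eliminate h₀ (q ^ 3) (
    eliminate h₁ (- ((1# + q ^ 3 * c * x) * (1# + q * (q ^ 3 * c * x)))) (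
    solve 6 (λ q x c g₀ g₁ g₂ →
      g₂ :+ q :^ 3 :* ((𝟏 :- c :* x) :* (𝟏 :- q :* (c :* x)) :* g₁)
        :+ (:- ((𝟏 :+ q :^ 3 :* c :* x) :* (𝟏 :+ q :* (q :^ 3 :* c :* x))))
          :* ((𝟏 :- q :^ 3 :* c :* x) :* (𝟏 :- q :* (q :^ 3 :* c :* x)) :* g₂)
      := g₁ :+ q :^ 3 :* g₁ :- q :^ 3 :* g₀
        :+ (q :^ 3 :* c) :* (q :^ 3 :* c) :* (x :* (x :* g₂)) :+ q :^ 2 :* ((q :^ 3 :* c) :* (q :^ 3 :* c) :* (x :* (x :* g₂)))
        :- q :^ 2 :* ((q :^ 3 :* c) :* (q :^ 3 :* c) :* ((q :^ 3 :* c) :* (q :^ 3 :* c) :* (x :* (x :* (x :* (x :* g₂))))))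
        :+ q :^ 4 :* (c :* c :* (x :* (x :* g₁))) :+ q :^ 7 :* (c :* c :* (x :* (x :* g₁)))
        :+ q :^ 3 :* g₀
        :+ (:- ((𝟏 :+ q :^ 3 :* c :* x) :* (𝟏 :+ q :* (q :^ 3 :* c :* x)))) :* g₁)
      refl q x c g₀ g₁ g₂))

  -- Multiplication by (1 + x)(1 + qx) makes the factor of `g` even; the odd terms x + qx on the
  -- other side disappear when only even coefficients are kept.
  even-initial : ∀ {q x g} → 1# ≈ (1# - 1# * x) * (1# - q * (1# * x)) * g →
    g ≈ 1# + x + q * x + q * (x * (x * 1#))
      + (1# * (x * (x * g)) + q ^ 2 * (1# * (x * (x * g))) - q ^ 2 * (1# * (1# * (x * (x * (x * (x * g)))))))
  even-initial {q} {x} {g} h = eliminate h (- ((1# + x) * (1# + q * x))) (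
    solve 3 (λ q x g →
      g :+ (:- ((𝟏 :+ x) :* (𝟏 :+ q :* x))) :* ((𝟏 :- 𝟏 :* x) :* (𝟏 :- q :* (𝟏 :* x)) :* g)
      := 𝟏 :+ x :+ q :* x :+ q :* (x :* (x :* 𝟏))
        :+ (𝟏 :* (x :* (x :* g)) :+ q :^ 2 :* (𝟏 :* (x :* (x :* g))) :- q :^ 2 :* (𝟏 :* (𝟏 :* (x :* (x :* (x :* (x :* g)))))))
        :+ (:- ((𝟏 :+ x) :* (𝟏 :+ q :* x))) :* 𝟏)
      refl q x g)

  convolved-recurrence-1 : ∀ {q x c p₀ p₁ e₀ e₁} →
    p₀ ≈ 1# + x * p₀ →
    p₁ ≈ p₀ + c * (x * p₁) →
    e₁ ≈ e₀ + q ^ 3 * e₀ + q ^ 2 * (x * (x * e₀)) + q ^ 4 * (x * (x * e₀)) + q ^ 3 * (x * (x * 1#)) - q ^ 3 * 1# →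
    p₁ * e₁ ≈ p₀ * e₀ + q ^ 3 * (p₀ * e₀) + q ^ 2 * (x * (x * (p₀ * e₀))) + q ^ 4 * (x * (x * (p₀ * e₀)))
      - q ^ 3 * 1# - q ^ 3 * (x * 1#) + c * (x * (p₁ * e₁))
  convolved-recurrence-1 {q} {x} {c} {p₀} {p₁} {e₀} {e₁} h₀ h₁ he =
    -- Because (1 - x)p₀ = 1, the terms q³(x² - 1)p₀ amount to -q³(1 + x).
    eliminate h₀ (- (q ^ 3 * (1# + x))) (
    eliminate h₁ e₁ (
    eliminate he p₀ (
    solve 7 (λ q x c p₀ p₁ e₀ e₁ →
      p₁ :* e₁ :+ (:- (q :^ 3 :* (𝟏 :+ x))) :* (𝟏 :+ x :* p₀) :+ e₁ :* (p₀ :+ c :* (x :* p₁))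
        :+ p₀ :* (e₀ :+ q :^ 3 :* e₀ :+ q :^ 2 :* (x :* (x :* e₀)) :+ q :^ 4 :* (x :* (x :* e₀)) :+ q :^ 3 :* (x :* (x :* 𝟏)) :- q :^ 3 :* 𝟏)
      := p₀ :* e₀ :+ q :^ 3 :* (p₀ :* e₀) :+ q :^ 2 :* (x :* (x :* (p₀ :* e₀))) :+ q :^ 4 :* (x :* (x :* (p₀ :* e₀)))
        :- q :^ 3 :* 𝟏 :- q :^ 3 :* (x :* 𝟏) :+ c :* (x :* (p₁ :* e₁))
        :+ (:- (q :^ 3 :* (𝟏 :+ x))) :* p₀ :+ e₁ :* p₁ :+ p₀ :* e₁)
      refl q x c p₀ p₁ e₀ e₁)))

  convolved-recurrence-2 : ∀ {q x k p₀ p₁ p₂ e₀ e₁ e₂} →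
    p₁ ≈ p₀ + q ^ 3 * k * (x * p₁) →
    p₂ ≈ p₁ + q ^ 3 * (q ^ 3 * k) * (x * p₂) →
    e₂ ≈ e₁ + q ^ 3 * e₁ - q ^ 3 * e₀
      + q ^ 2 * (x * (x * ((q ^ 3 * k) * (q ^ 3 * k) * e₁))) + q ^ 4 * (x * (x * ((q ^ 3 * k) * (q ^ 3 * k) * e₁)))
      - q ^ 6 * (x * (x * ((q ^ 3 * k) * (q ^ 3 * k) * (x * (x * (k * k * e₀))))))
      + q ^ 6 * (x * (x * (k * k * e₀))) + q ^ 9 * (x * (x * (k * k * e₀))) →
    p₂ * e₂ ≈ p₁ * e₁ + q ^ 3 * (p₁ * e₁)
      + (q ^ 2 * (x * (x * ((q ^ 3 * k) * ((q ^ 3 * k) * (p₁ * e₁)))))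
        + q ^ 4 * (x * (x * ((q ^ 3 * k) * ((q ^ 3 * k) * (p₁ * e₁)))))
        + q ^ 6 * (x * (x * (k * (k * (p₀ * e₀))))))
      + q ^ 9 * (x * (x * (x * (k * (k * (k * (p₀ * e₀)))))))
      - q ^ 3 * (p₀ * e₀) - q ^ 6 * (x * (k * (p₀ * e₀)))
      + q ^ 3 * (q ^ 3 * k) * (x * (p₂ * e₂))
  convolved-recurrence-2 {q} {x} {k} {p₀} {p₁} {p₂} {e₀} {e₁} {e₂} h₁ h₂ he =
    -- The cubic is -q³(1 - q³k²x²)(1 - q⁶k²x²) divided by 1 - q³kx: the numerator is the
    -- coefficient of p₁e₀, and (1 - q³kx)p₁ = p₀.
    eliminate h₁ ((- (q ^ 3) - q ^ 6 * k * x + q ^ 6 * k * k * x * x + q ^ 9 * k * k * k * x * x * x) * e₀) (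
    eliminate h₂ e₂ (
    eliminate he p₁ (
    solve 9 (λ q x k p₀ p₁ p₂ e₀ e₁ e₂ →
      p₂ :* e₂
        :+ (:- (q :^ 3) :- q :^ 6 :* k :* x :+ q :^ 6 :* k :* k :* x :* x :+ q :^ 9 :* k :* k :* k :* x :* x :* x) :* e₀
          :* (p₀ :+ q :^ 3 :* k :* (x :* p₁))
        :+ e₂ :* (p₁ :+ q :^ 3 :* (q :^ 3 :* k) :* (x :* p₂))
        :+ p₁ :* (e₁ :+ q :^ 3 :* e₁ :- q :^ 3 :* e₀
          :+ q :^ 2 :* (x :* (x :* ((q :^ 3 :* k) :* (q :^ 3 :* k) :* e₁))) :+ q :^ 4 :* (x :* (x :* ((q :^ 3 :* k) :* (q :^ 3 :* k) :* e₁)))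
          :- q :^ 6 :* (x :* (x :* ((q :^ 3 :* k) :* (q :^ 3 :* k) :* (x :* (x :* (k :* k :* e₀))))))
          :+ q :^ 6 :* (x :* (x :* (k :* k :* e₀))) :+ q :^ 9 :* (x :* (x :* (k :* k :* e₀))))
      := p₁ :* e₁ :+ q :^ 3 :* (p₁ :* e₁)
        :+ (q :^ 2 :* (x :* (x :* ((q :^ 3 :* k) :* ((q :^ 3 :* k) :* (p₁ :* e₁)))))
          :+ q :^ 4 :* (x :* (x :* ((q :^ 3 :* k) :* ((q :^ 3 :* k) :* (p₁ :* e₁)))))
          :+ q :^ 6 :* (x :* (x :* (k :* (k :* (p₀ :* e₀))))))
        :+ q :^ 9 :* (x :* (x :* (x :* (k :* (k :* (k :* (p₀ :* e₀)))))))
        :- q :^ 3 :* (p₀ :* e₀) :- q :^ 6 :* (x :* (k :* (p₀ :* e₀)))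
        :+ q :^ 3 :* (q :^ 3 :* k) :* (x :* (p₂ :* e₂))
        :+ (:- (q :^ 3) :- q :^ 6 :* k :* x :+ q :^ 6 :* k :* k :* x :* x :+ q :^ 9 :* k :* k :* k :* x :* x :* x) :* e₀ :* p₁
        :+ e₂ :* p₂
        :+ p₁ :* e₂)
      refl q x k p₀ p₁ p₂ e₀ e₁ e₂)))

  -- The pad lemmas bring the cases of the recurrence for even coefficients into one shape valid at
  -- every index, with boundary terms evaluated; the unpad lemmas undo this after the diagonal has
  -- been taken.
  pad-0 : ∀ {q x s y a b d} → s ≈ 1# + 0# + q * 0# + y + (a + b - d) →
    s ≈ 0# + q ^ 3 * 0# - q ^ 3 * 0# + a + b - d + q ^ 6 * (x * 0#) + q ^ 9 * (x * 0#) + (1# + y - q ^ 3 * 0#)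
  pad-0 {q} {x} {s} {y} {a} {b} {d} h = trans h (solve 6 (λ q x y a b d →
    𝟏 :+ con (+ 0) :+ q :* con (+ 0) :+ y :+ (a :+ b :- d)
    := con (+ 0) :+ q :^ 3 :* con (+ 0) :- q :^ 3 :* con (+ 0) :+ a :+ b :- d
      :+ q :^ 6 :* (x :* con (+ 0)) :+ q :^ 9 :* (x :* con (+ 0)) :+ (𝟏 :+ y :- q :^ 3 :* con (+ 0)))
    refl q x y a b d)

  pad-1 : ∀ {q x s r t u a b d e f} → s ≈ r + t - u + a + b - d + e + f →
    s ≈ r + t - q ^ 3 * 0# + a + b - d + e + f + (0# + q ^ 3 * (x * 0#) - u)
  pad-1 {q} {x} {s} {r} {t} {u} {a} {b} {d} {e} {f} h = trans h (solve 10 (λ q x r t u a b d e f →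
    r :+ t :- u :+ a :+ b :- d :+ e :+ f
    := r :+ t :- q :^ 3 :* con (+ 0) :+ a :+ b :- d :+ e :+ f :+ (con (+ 0) :+ q :^ 3 :* (x :* con (+ 0)) :- u))
    refl q x r t u a b d e f)

  pad-2 : ∀ {q x s r t u a b d e f} → s ≈ r + t - u + a + b - d + e + f →
    s ≈ r + t - u + a + b - d + e + f + (0# + q ^ 3 * (x * 0#) - q ^ 3 * 0#)
  pad-2 {q} {x} {s} {r} {t} {u} {a} {b} {d} {e} {f} h = trans h (solve 10 (λ q x r t u a b d e f →
    r :+ t :- u :+ a :+ b :- d :+ e :+ f
    := r :+ t :- u :+ a :+ b :- d :+ e :+ f :+ (con (+ 0) :+ q :^ 3 :* (x :* con (+ 0)) :- q :^ 3 :* con (+ 0)))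
    refl q x r t u a b d e f)

  unpad-0 : ∀ {q x s} → s ≈ 0# + q ^ 3 * 0# - q ^ 3 * 0# + q ^ 2 * (x * 0#) + q ^ 4 * (x * 0#) - q ^ 6 * (x * 0#)
      + q ^ 6 * (x * 0#) + q ^ 9 * (x * 0#) + (1# + q ^ 3 * (x * 0#) - q ^ 3 * 0#) →
    s ≈ 1#
  unpad-0 {q} {x} h = trans h (solve 2 (λ q x →
    con (+ 0) :+ q :^ 3 :* con (+ 0) :- q :^ 3 :* con (+ 0) :+ q :^ 2 :* (x :* con (+ 0)) :+ q :^ 4 :* (x :* con (+ 0))
      :- q :^ 6 :* (x :* con (+ 0)) :+ q :^ 6 :* (x :* con (+ 0)) :+ q :^ 9 :* (x :* con (+ 0))
      :+ (𝟏 :+ q :^ 3 :* (x :* con (+ 0)) :- q :^ 3 :* con (+ 0))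
    := 𝟏) refl q x)

  unpad-1 : ∀ {q x s e f g} → s ≈ e + q ^ 3 * e - q ^ 3 * 0# + q ^ 2 * (x * f) + q ^ 4 * (x * f) - q ^ 6 * (x * (g * (x * 0#)))
      + q ^ 6 * (x * 0#) + q ^ 9 * (x * 0#) + (0# + q ^ 3 * (x * 1#) - q ^ 3 * 1#) →
    s ≈ e + q ^ 3 * e + q ^ 2 * (x * f) + q ^ 4 * (x * f) + q ^ 3 * (x * 1#) - q ^ 3 * 1#
  unpad-1 {q} {x} {s} {e} {f} {g} h = trans h (solve 5 (λ q x e f g →
    e :+ q :^ 3 :* e :- q :^ 3 :* con (+ 0) :+ q :^ 2 :* (x :* f) :+ q :^ 4 :* (x :* f)
      :- q :^ 6 :* (x :* (g :* (x :* con (+ 0))))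
      :+ q :^ 6 :* (x :* con (+ 0)) :+ q :^ 9 :* (x :* con (+ 0)) :+ (con (+ 0) :+ q :^ 3 :* (x :* 𝟏) :- q :^ 3 :* 𝟏)
    := e :+ q :^ 3 :* e :+ q :^ 2 :* (x :* f) :+ q :^ 4 :* (x :* f) :+ q :^ 3 :* (x :* 𝟏) :- q :^ 3 :* 𝟏) refl q x e f g)

  unpad-2 : ∀ {q x s t} → s ≈ t + (0# + q ^ 3 * (x * 0#) - q ^ 3 * 0#) → s ≈ t
  unpad-2 {q} {x} {s} {t} h = trans h (solve 3 (λ q x t →
    t :+ (con (+ 0) :+ q :^ 3 :* (x :* con (+ 0)) :- q :^ 3 :* con (+ 0)) := t) refl q x t)

  collect-2-2 : ∀ q y → q ^ 2 * (q ^ 2 * y) ≈ q ^ 4 * y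
  collect-2-2 = solve 2 (λ q y → q :^ 2 :* (q :^ 2 :* y) := q :^ 4 :* y) refl

  collect-4-2 : ∀ q y → q ^ 4 * (q ^ 2 * y) ≈ q ^ 6 * y
  collect-4-2 = solve 2 (λ q y → q :^ 4 :* (q :^ 2 :* y) := q :^ 6 :* y) refl

  collect-7-2 : ∀ q y → q ^ 7 * (q ^ 2 * y) ≈ q ^ 9 * y
  collect-7-2 = solve 2 (λ q y → q :^ 7 :* (q :^ 2 :* y) := q :^ 9 :* y) refl

  collect-1-2 : ∀ q y → q * (q ^ 2 * y) ≈ q ^ 3 * y
  collect-1-2 = solve 2 (λ q y → q :* (q :^ 2 :* y) := q :^ 3 :* y) refl

  collect-2-2-2 : ∀ q x w y → q ^ 2 * (q ^ 2 * (x * (w * (q ^ 2 * y)))) ≈ q ^ 6 * (x * (w * y))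
  collect-2-2-2 = solve 4 (λ q x w y → q :^ 2 :* (q :^ 2 :* (x :* (w :* (q :^ 2 :* y)))) := q :^ 6 :* (x :* (w :* y))) refl

  move-inside : ∀ a x w y → w * (a * (x * y)) ≈ a * (x * (w * y))
  move-inside = solve 4 (λ a x w y → w :* (a :* (x :* y)) := a :* (x :* (w :* y))) refl

-- Formal power series as a commutative ring.

module PowerSeries {c ℓ} (R : CommutativeRing c ℓ) where
  open CommutativeRing R
  open SetoidReasoning setoid
  open import Algebra.Properties.CommutativeSemigroup +-commutativeSemigroup
    using () renaming (interchange to +-interchange; x∙yz≈y∙xz to x+[y+z]≈y+[x+z])
  open import Algebra.Properties.CommutativeSemigroup *-commutativeSemigroup
    using () renaming (x∙yz≈y∙xz to x*[y*z]≈y*[x*z])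

  Series : Set c
  Series = ℕ → Carrier

  infix 4 _≋_
  _≋_ : Series → Series → Set ℓ
  f ≋ g = ∀ n → f n ≈ g n

  tail : Series → Series
  tail f n = f (suc n)

  infixl 6 _⊕_
  _⊕_ : Series → Series → Series
  (f ⊕ g) n = f n + g n

  infixl 7 _⊛_
  _⊛_ : Series → Series → Series
  (f ⊛ g) zero = f 0 * g 0
  (f ⊛ g) (suc n) = f 0 * g (suc n) + (tail f ⊛ g) n

  const : Carrier → Series
  const a zero = a
  const a (suc n) = 0#

  ⊛-cong : ∀ {f f′ g g′} → f ≋ f′ → g ≋ g′ → (f ⊛ g) ≋ (f′ ⊛ g′)
  ⊛-cong p r zero = *-cong (p 0) (r 0)
  ⊛-cong p r (suc n) =
    +-cong (*-cong (p 0) (r (suc n))) (⊛-cong (λ i → p (suc i)) r n)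

  ⊛-zeroˡ : ∀ f → ((λ _ → 0#) ⊛ f) ≋ (λ _ → 0#)
  ⊛-zeroˡ f zero = zeroˡ (f 0)
  ⊛-zeroˡ f (suc n) = trans (+-cong (zeroˡ _) (⊛-zeroˡ f n)) (+-identityˡ 0#)

  const-⊛ : ∀ a f n → (const a ⊛ f) n ≈ a * f n
  const-⊛ a f zero = refl
  const-⊛ a f (suc n) = trans (+-congˡ (⊛-zeroˡ f n)) (+-identityʳ _)

  ⊛-scaleˡ : ∀ a f g n → ((λ i → a * f i) ⊛ g) n ≈ a * (f ⊛ g) n
  ⊛-scaleˡ a f g zero = *-assoc a (f 0) (g 0)
  ⊛-scaleˡ a f g (suc n) = begin
    a * f 0 * g (suc n) + ((λ i → a * f (suc i)) ⊛ g) n ≈⟨ +-cong (*-assoc a (f 0) (g (suc n))) (⊛-scaleˡ a (tail f) g n) ⟩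
    a * (f 0 * g (suc n)) + a * (tail f ⊛ g) n          ≈⟨ distribˡ a _ _ ⟨
    a * (f 0 * g (suc n) + (tail f ⊛ g) n)              ∎

  ⊛-distribʳ : ∀ h f g → ((f ⊕ g) ⊛ h) ≋ (f ⊛ h) ⊕ (g ⊛ h)
  ⊛-distribʳ h f g zero = distribʳ (h 0) (f 0) (g 0)
  ⊛-distribʳ h f g (suc n) = trans
    (+-cong (distribʳ (h (suc n)) (f 0) (g 0)) (⊛-distribʳ h (tail f) (tail g) n))
    (+-interchange _ _ _ _)

  -- The recursion of `⊛` with the right factor peeled instead of the left; commutativity follows
  -- from the two forms by induction.
  ⊛-suc : ∀ f g n → (f ⊛ g) (suc n) ≈ g 0 * f (suc n) + (f ⊛ tail g) n
  ⊛-suc f g zero = trans (+-comm _ _) (+-congʳ (*-comm _ _))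
  ⊛-suc f g (suc n) = begin
    f 0 * g (suc (suc n)) + (tail f ⊛ g) (suc n)                                ≈⟨ +-congˡ (⊛-suc (tail f) g n) ⟩
    f 0 * g (suc (suc n)) + (g 0 * f (suc (suc n)) + (tail f ⊛ tail g) n)        ≈⟨ x+[y+z]≈y+[x+z] _ _ _ ⟩
    g 0 * f (suc (suc n)) + (f 0 * g (suc (suc n)) + (tail f ⊛ tail g) n)        ∎

  ⊛-comm : ∀ f g → (f ⊛ g) ≋ (g ⊛ f)
  ⊛-comm f g zero = *-comm (f 0) (g 0)
  ⊛-comm f g (suc n) = trans (⊛-suc f g n) (+-congˡ (⊛-comm f (tail g) n))

  ⊛-assoc : ∀ f g h → (f ⊛ g ⊛ h) ≋ (f ⊛ (g ⊛ h))
  ⊛-assoc f g h zero = *-assoc (f 0) (g 0) (h 0)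
  ⊛-assoc f g h (suc n) = begin
    f 0 * g 0 * h (suc n) + (((λ i → f 0 * g (suc i)) ⊕ (tail f ⊛ g)) ⊛ h) n
      ≈⟨ +-cong (*-assoc _ _ _) (⊛-distribʳ h (λ i → f 0 * g (suc i)) (tail f ⊛ g) n) ⟩
    f 0 * (g 0 * h (suc n)) + (((λ i → f 0 * g (suc i)) ⊛ h) n + (tail f ⊛ g ⊛ h) n)
      ≈⟨ +-congˡ (+-cong (⊛-scaleˡ (f 0) (tail g) h n) (⊛-assoc (tail f) g h n)) ⟩
    f 0 * (g 0 * h (suc n)) + (f 0 * (tail g ⊛ h) n + (tail f ⊛ (g ⊛ h)) n)
      ≈⟨ +-assoc _ _ _ ⟨
    f 0 * (g 0 * h (suc n)) + f 0 * (tail g ⊛ h) n + (tail f ⊛ (g ⊛ h)) n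
      ≈⟨ +-congʳ (distribˡ _ _ _) ⟨
    f 0 * (g ⊛ h) (suc n) + (tail f ⊛ (g ⊛ h)) n
      ∎

  ⊛-identityˡ : ∀ f → (const 1# ⊛ f) ≋ f
  ⊛-identityˡ f n = trans (const-⊛ 1# f n) (*-identityˡ (f n))

  commutativeRing : CommutativeRing c ℓ
  commutativeRing = record
    { Carrier = Series
    ; _≈_ = _≋_
    ; _+_ = _⊕_
    ; _*_ = _⊛_
    ; -_ = λ f n → - f n
    ; 0# = λ _ → 0#
    ; 1# = const 1#
    ; isCommutativeRing = record
      { isRing = record
        { +-isAbelianGroup = Pointwise.isAbelianGroup ℕ +-isAbelianGroup
        ; *-cong = ⊛-cong
        ; *-assoc = ⊛-assoc
        ; *-identity = ⊛-identityˡ , λ f n → trans (⊛-comm f (const 1#) n) (⊛-identityˡ f n)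
        ; distrib = (λ f g h n → trans (⊛-comm f (g ⊕ h) n)
                      (trans (⊛-distribʳ f g h n) (+-cong (⊛-comm g f n) (⊛-comm h f n))))
                  , ⊛-distribʳ
        }
      ; *-comm = ⊛-comm
      }
    }

  X : Series
  X zero = 0#
  X (suc n) = const 1# n

  X-⊛-zero : ∀ f → (X ⊛ f) 0 ≈ 0#
  X-⊛-zero f = zeroˡ (f 0)

  X-⊛-suc : ∀ f n → (X ⊛ f) (suc n) ≈ f n
  X-⊛-suc f n = trans (+-cong (zeroˡ _) (⊛-identityˡ f n)) (+-identityˡ (f n))

-- Operators on series: dilation, squaring of the variable, quadratic weights, diagonals.

tri : ℕ → ℕ
tri zero = 0
tri (suc n) = n ℕ.+ tri n

tri-square : ∀ n → n ℕ.* n ≡ tri n ℕ.* 2 ℕ.+ n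
tri-square zero = ≡.refl
tri-square (suc n) = ≡.trans (solve 1 (λ n → (con 1 :+ n) :* (con 1 :+ n) := n :* n :+ (n :+ (n :+ con 1))) ≡.refl n)
  (≡.trans (≡.cong (ℕ._+ (n ℕ.+ (n ℕ.+ 1))) (tri-square n))
  (solve 2 (λ n t → t :* con 2 :+ n :+ (n :+ (n :+ con 1)) := (n :+ t) :* con 2 :+ (con 1 :+ n)) ≡.refl n (tri n)))
  where open ℕ-Solver.+-*-Solver

module Operators {c ℓ} (R : CommutativeRing c ℓ) where
  open CommutativeRing R
  open PowerSeries R
  private module P = CommutativeRing commutativeRing
  open SetoidReasoning setoid
  open import Algebra.Properties.CommutativeSemigroup *-commutativeSemigroup
    using (interchange; x∙yz≈y∙xz)
  open import Algebra.Properties.Ring ring using (-‿distribʳ-*; -0#≈0#)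

  𝟘 : Series
  𝟘 _ = 0#

  const-cong : ∀ {a b} → a ≈ b → const a ≋ const b
  const-cong a≈b zero = a≈b
  const-cong a≈b (suc n) = refl

  const-* : ∀ a b → const (a * b) ≋ const a ⊛ const b
  const-* a b zero = refl
  const-* a b (suc n) = sym (trans (const-⊛ a (const b) (suc n)) (zeroʳ a))

  -- Cancels the unit 1 - a X.
  geometric-unique : ∀ a {h f g} →
    f ≋ h ⊕ const a ⊛ (X ⊛ f) → g ≋ h ⊕ const a ⊛ (X ⊛ g) → f ≋ g
  geometric-unique a {h} {f} {g} pf pg zero = begin
    f 0                               ≈⟨ pf 0 ⟩
    h 0 + (const a ⊛ (X ⊛ f)) 0       ≈⟨ +-congˡ (*-congˡ (trans (X-⊛-zero f) (sym (X-⊛-zero g)))) ⟩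
    h 0 + (const a ⊛ (X ⊛ g)) 0       ≈⟨ pg 0 ⟨
    g 0                               ∎
  geometric-unique a {h} {f} {g} pf pg (suc n) = begin
    f (suc n)                                 ≈⟨ pf (suc n) ⟩
    h (suc n) + (const a ⊛ (X ⊛ f)) (suc n)   ≈⟨ +-congˡ (const-⊛ a (X ⊛ f) (suc n)) ⟩
    h (suc n) + a * (X ⊛ f) (suc n)           ≈⟨ +-congˡ (*-congˡ (X-⊛-suc f n)) ⟩
    h (suc n) + a * f n                       ≈⟨ +-congˡ (*-congˡ (geometric-unique a pf pg n)) ⟩
    h (suc n) + a * g n                       ≈⟨ +-congˡ (*-congˡ (X-⊛-suc g n)) ⟨
    h (suc n) + a * (X ⊛ g) (suc n)           ≈⟨ +-congˡ (const-⊛ a (X ⊛ g) (suc n)) ⟨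
    h (suc n) + (const a ⊛ (X ⊛ g)) (suc n)   ≈⟨ pg (suc n) ⟨
    g (suc n)                                 ∎

  pow-cong : ∀ {a b} n → a ≈ b → pow R a n ≈ pow R b n
  pow-cong zero a≈b = refl
  pow-cong (suc n) a≈b = *-cong a≈b (pow-cong n a≈b)

  pow-* : ∀ a b n → pow R (a * b) n ≈ pow R a n * pow R b n
  pow-* a b zero = sym (*-identityˡ 1#)
  pow-* a b (suc n) = trans (*-congˡ (pow-* a b n)) (interchange a b _ _)

  pow-+ : ∀ a m n → pow R a (m ℕ.+ n) ≈ pow R a m * pow R a n
  pow-+ a zero n = sym (*-identityˡ _)
  pow-+ a (suc m) n = trans (*-congˡ (pow-+ a m n)) (sym (*-assoc _ _ _))

  pow-pow : ∀ a m n → pow R (pow R a m) n ≈ pow R a (m ℕ.* n)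
  pow-pow a m zero = reflexive (≡.cong (pow R a) (≡.sym (ℕ.*-zeroʳ m)))
  pow-pow a m (suc n) = trans (*-congˡ (pow-pow a m n))
    (trans (sym (pow-+ a m (m ℕ.* n))) (reflexive (≡.cong (pow R a) (≡.sym (ℕ.*-suc m n)))))

  -- Substitutes aX for X, hence a ring endomorphism, which `twist` below is not.
  dil : Carrier → Series → Series
  dil a f n = pow R a n * f n

  dil-cong : ∀ a {f g} → f ≋ g → dil a f ≋ dil a g
  dil-cong a f≋g n = *-congˡ (f≋g n)

  dil-⊕ : ∀ a f g → dil a (f ⊕ g) ≋ dil a f ⊕ dil a g
  dil-⊕ a f g n = distribˡ _ _ _

  dil-const : ∀ a b → dil a (const b) ≋ const b
  dil-const a b zero = *-identityˡ b
  dil-const a b (suc n) = zeroʳ _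

  dil-⊛ : ∀ a f g → dil a (f ⊛ g) ≋ dil a f ⊛ dil a g
  dil-⊛ a f g zero = trans (*-congʳ (sym (*-identityˡ 1#))) (interchange _ _ _ _)
  dil-⊛ a f g (suc n) = begin
    pow R a (suc n) * (f 0 * g (suc n) + (tail f ⊛ g) n)
      ≈⟨ distribˡ _ _ _ ⟩
    pow R a (suc n) * (f 0 * g (suc n)) + pow R a (suc n) * (tail f ⊛ g) n
      ≈⟨ +-cong (trans (x∙yz≈y∙xz _ _ _) (*-congʳ (sym (*-identityˡ (f 0))))) (*-assoc _ _ _) ⟩
    dil a f 0 * dil a g (suc n) + a * dil a (tail f ⊛ g) n
      ≈⟨ +-congˡ (*-congˡ (dil-⊛ a (tail f) g n)) ⟩
    dil a f 0 * dil a g (suc n) + a * (dil a (tail f) ⊛ dil a g) n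
      ≈⟨ +-congˡ (⊛-scaleˡ a (dil a (tail f)) (dil a g) n) ⟨
    dil a f 0 * dil a g (suc n) + ((λ i → a * dil a (tail f) i) ⊛ dil a g) n
      ≈⟨ +-congˡ (⊛-cong (λ i → *-assoc _ _ _) (λ i → refl) n) ⟨
    dil a f 0 * dil a g (suc n) + (tail (dil a f) ⊛ dil a g) n
      ∎

  dil-X : ∀ a → dil a X ≋ const a ⊛ X
  dil-X a zero = trans (zeroʳ _) (sym (zeroʳ a))
  dil-X a (suc zero) = trans (*-identityʳ _) (trans (*-congˡ refl) (sym (const-⊛ a X 1)))
  dil-X a (suc (suc n)) = trans (zeroʳ _) (sym (trans (const-⊛ a X (suc (suc n))) (zeroʳ a)))

  dil-dil : ∀ a b f → dil a (dil b f) ≋ dil (a * b) f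
  dil-dil a b f n = trans (sym (*-assoc _ _ _)) (*-congʳ (sym (pow-* a b n)))

  dil-base : ∀ {a b} → a ≈ b → ∀ f → dil a f ≋ dil b f
  dil-base a≈b f n = *-congʳ (pow-cong n a≈b)

  -- spread f is f(X²).
  spread : Series → Series
  spread f zero = f 0
  spread f (suc zero) = 0#
  spread f (suc (suc n)) = spread (tail f) n

  spread-cong : ∀ {f g} → f ≋ g → spread f ≋ spread g
  spread-cong f≋g zero = f≋g 0
  spread-cong f≋g (suc zero) = refl
  spread-cong f≋g (suc (suc n)) = spread-cong (λ i → f≋g (suc i)) n

  spread-⊕ : ∀ f g → spread (f ⊕ g) ≋ spread f ⊕ spread g
  spread-⊕ f g zero = refl
  spread-⊕ f g (suc zero) = sym (+-identityˡ 0#)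
  spread-⊕ f g (suc (suc n)) = spread-⊕ (tail f) (tail g) n

  spread-neg : ∀ f → spread (P.- f) ≋ P.- spread f
  spread-neg f zero = refl
  spread-neg f (suc zero) = sym -0#≈0#
  spread-neg f (suc (suc n)) = spread-neg (tail f) n

  spread-scale : ∀ a f → spread (λ i → a * f i) ≋ (λ i → a * spread f i)
  spread-scale a f zero = refl
  spread-scale a f (suc zero) = sym (zeroʳ a)
  spread-scale a f (suc (suc n)) = spread-scale a (tail f) n

  spread-𝟘 : spread 𝟘 ≋ 𝟘
  spread-𝟘 zero = refl
  spread-𝟘 (suc zero) = refl
  spread-𝟘 (suc (suc n)) = spread-𝟘 n

  spread-const : ∀ a → spread (const a) ≋ const a
  spread-const a zero = refl
  spread-const a (suc zero) = refl
  spread-const a (suc (suc n)) = spread-𝟘 n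

  spread-⊛ : ∀ f g → spread (f ⊛ g) ≋ spread f ⊛ spread g
  spread-⊛ f g zero = refl
  spread-⊛ f g (suc zero) = sym (trans (+-cong (zeroʳ _) (zeroˡ _)) (+-identityˡ 0#))
  spread-⊛ f g (suc (suc n)) = begin
    spread ((λ i → f 0 * g (suc i)) ⊕ (tail f ⊛ g)) n
      ≈⟨ spread-⊕ _ (tail f ⊛ g) n ⟩
    spread (λ i → f 0 * tail g i) n + spread (tail f ⊛ g) n
      ≈⟨ +-cong (spread-scale (f 0) (tail g) n) (spread-⊛ (tail f) g n) ⟩
    f 0 * spread (tail g) n + (spread (tail f) ⊛ spread g) n
      ≈⟨ +-congˡ (trans (+-congʳ (zeroˡ _)) (+-identityˡ _)) ⟨
    f 0 * spread (tail g) n + (0# * spread g (suc n) + (spread (tail f) ⊛ spread g) n)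
      ∎

  spread-X : spread X ≋ X ⊛ X
  spread-X zero = sym (zeroˡ _)
  spread-X (suc zero) = sym (X-⊛-suc X 0)
  spread-X (suc (suc n)) = trans (spread-const 1# n) (sym (X-⊛-suc X (suc n)))

  spread-dil : ∀ a f → spread (dil (a * a) f) ≋ dil a (spread f)
  spread-dil a f zero = refl
  spread-dil a f (suc zero) = sym (zeroʳ _)
  spread-dil a f (suc (suc n)) = begin
    spread (λ i → a * a * pow R (a * a) i * f (suc i)) n  ≈⟨ spread-cong (λ i → *-assoc _ _ _) n ⟩
    spread (λ i → a * a * dil (a * a) (tail f) i) n       ≈⟨ spread-scale (a * a) (dil (a * a) (tail f)) n ⟩
    a * a * spread (dil (a * a) (tail f)) n               ≈⟨ *-congˡ (spread-dil a (tail f) n) ⟩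
    a * a * (pow R a n * spread (tail f) n)               ≈⟨ *-assoc _ _ _ ⟨
    a * a * pow R a n * spread (tail f) n                 ≈⟨ *-congʳ (*-assoc _ _ _) ⟩
    a * (a * pow R a n) * spread (tail f) n               ∎

  spread-even : ∀ f r → spread f (r ℕ.* 2) ≈ f r
  spread-even f zero = refl
  spread-even f (suc r) = spread-even (tail f) r

  spread-odd : ∀ f r → spread f (suc (r ℕ.* 2)) ≈ 0#
  spread-odd f zero = refl
  spread-odd f (suc r) = spread-odd (tail f) r

  -- The solution of w 0 = 1, w (i + 1) = a bⁱ w i, that is, w i = aⁱ b^(i(i-1)/2).
  weight : Carrier → Carrier → ℕ → Carrier
  weight a b zero = 1#
  weight a b (suc i) = a * (pow R b i * weight a b i)

  weight-pow : ∀ c {a b} x y → a ≈ pow R c x → b ≈ pow R c y →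
    ∀ i → weight a b i ≈ pow R c (x ℕ.* i ℕ.+ y ℕ.* tri i)
  weight-pow c x y a≈ b≈ zero = reflexive (≡.cong (pow R c) (≡.sym (≡.cong₂ ℕ._+_ (ℕ.*-zeroʳ x) (ℕ.*-zeroʳ y))))
  weight-pow c {a} {b} x y a≈ b≈ (suc i) = begin
    a * (pow R b i * weight a b i)
      ≈⟨ *-cong a≈ (*-cong (trans (pow-cong i b≈) (pow-pow c y i)) (weight-pow c x y a≈ b≈ i)) ⟩
    pow R c x * (pow R c (y ℕ.* i) * pow R c (x ℕ.* i ℕ.+ y ℕ.* tri i))
      ≈⟨ *-congˡ (pow-+ c (y ℕ.* i) _) ⟨
    pow R c x * pow R c (y ℕ.* i ℕ.+ (x ℕ.* i ℕ.+ y ℕ.* tri i))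
      ≈⟨ pow-+ c x _ ⟨
    pow R c (x ℕ.+ (y ℕ.* i ℕ.+ (x ℕ.* i ℕ.+ y ℕ.* tri i)))
      ≡⟨ ≡.cong (pow R c) (solve 4 (λ x y i t →
           x :+ (y :* i :+ (x :* i :+ y :* t)) := x :* (con 1 :+ i) :+ y :* (i :+ t)) ≡.refl x y i (tri i)) ⟩
    pow R c (x ℕ.* suc i ℕ.+ y ℕ.* tri (suc i))
      ∎
    where open ℕ-Solver.+-*-Solver

  twist : Carrier → Carrier → Series → Series
  twist a b f i = weight a b i * f i

  twist-cong : ∀ a b {f g} → f ≋ g → twist a b f ≋ twist a b g
  twist-cong a b f≋g i = *-congˡ (f≋g i)

  twist-⊕ : ∀ a b f g → twist a b (f ⊕ g) ≋ twist a b f ⊕ twist a b g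
  twist-⊕ a b f g i = distribˡ _ _ _

  twist-neg : ∀ a b f → twist a b (P.- f) ≋ P.- twist a b f
  twist-neg a b f i = sym (-‿distribʳ-* _ _)

  twist-const : ∀ a b c → twist a b (const c) ≋ const c
  twist-const a b c zero = *-identityˡ c
  twist-const a b c (suc i) = zeroʳ _

  twist-const-⊛ : ∀ a b c f → twist a b (const c ⊛ f) ≋ const c ⊛ twist a b f
  twist-const-⊛ a b c f i = begin
    weight a b i * (const c ⊛ f) i  ≈⟨ *-congˡ (const-⊛ c f i) ⟩
    weight a b i * (c * f i)        ≈⟨ x∙yz≈y∙xz _ _ _ ⟩
    c * (weight a b i * f i)        ≈⟨ const-⊛ c (twist a b f) i ⟨
    (const c ⊛ twist a b f) i       ∎

  -- Consecutive weights differ by the factor abⁱ, and bⁱ is a dilation: every X taken out of a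
  -- `twist` leaves one `dil b` behind.
  twist-X-⊛ : ∀ a b f → twist a b (X ⊛ f) ≋ const a ⊛ (X ⊛ dil b (twist a b f))
  twist-X-⊛ a b f zero = trans (*-identityˡ _)
    (trans (X-⊛-zero f) (sym (trans (*-congˡ (X-⊛-zero (dil b (twist a b f)))) (zeroʳ a))))
  twist-X-⊛ a b f (suc i) = begin
    a * (pow R b i * weight a b i) * (X ⊛ f) (suc i)  ≈⟨ *-congˡ (X-⊛-suc f i) ⟩
    a * (pow R b i * weight a b i) * f i              ≈⟨ trans (*-assoc _ _ _) (*-congˡ (*-assoc _ _ _)) ⟩
    a * dil b (twist a b f) i                         ≈⟨ *-congˡ (X-⊛-suc (dil b (twist a b f)) i) ⟨
    a * (X ⊛ dil b (twist a b f)) (suc i)             ≈⟨ const-⊛ a (X ⊛ dil b (twist a b f)) (suc i) ⟨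
    (const a ⊛ (X ⊛ dil b (twist a b f))) (suc i)     ∎

  dil-const-⊛ : ∀ a b f → dil a (const b ⊛ f) ≋ const b ⊛ dil a f
  dil-const-⊛ a b f = P.trans (dil-⊛ a (const b) f) (P.*-congʳ (dil-const a b))

  dil-X-⊛ : ∀ a f → dil a (X ⊛ f) ≋ const a ⊛ (X ⊛ dil a f)
  dil-X-⊛ a f = P.trans (dil-⊛ a X f) (P.trans (P.*-congʳ (dil-X a)) (P.*-assoc _ _ _))

  twist-XX-⊛ : ∀ a b f → twist a b (X ⊛ (X ⊛ f)) ≋
    const a ⊛ (X ⊛ (const a ⊛ (const b ⊛ (X ⊛ dil b (dil b (twist a b f))))))
  twist-XX-⊛ a b f = P.trans (twist-X-⊛ a b (X ⊛ f))
    (P.*-congˡ (P.*-congˡ (P.trans (dil-cong b (twist-X-⊛ a b f))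
      (P.trans (dil-const-⊛ b a _) (P.*-congˡ (dil-X-⊛ b _))))))

  twist-dil : ∀ a b c f → twist a b (dil c f) ≋ dil c (twist a b f)
  twist-dil a b c f i = x∙yz≈y∙xz _ _ _

  Sequence : Set c
  Sequence = ℕ → Series

  infix 4 _≣_
  _≣_ : Sequence → Sequence → Set ℓ
  f ≣ g = ∀ L → f L ≋ g L

  -- Multiplication by y of the generating function of the sequence.
  prev : Sequence → Sequence
  prev g zero = 𝟘
  prev g (suc n) = g n

  prev-cong : ∀ {f g} → f ≣ g → prev f ≣ prev g
  prev-cong f≣g zero i = refl
  prev-cong f≣g (suc n) = f≣g n

  antidiagonal : (ℕ → Carrier) → ℕ → ℕ → Carrier
  antidiagonal a L zero = a L
  antidiagonal a zero (suc i) = 0#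
  antidiagonal a (suc L) (suc i) = antidiagonal a L i

  -- The coefficient of Xⁱ in diag g L is that of g (L - i), and 0 when i > L:
  -- on generating functions in y, this substitutes X y for X.
  diag : Sequence → Sequence
  diag g L i = antidiagonal (λ n → g n i) L i

  antidiagonal-cong : ∀ {a b} → (∀ n → a n ≈ b n) → ∀ L i → antidiagonal a L i ≈ antidiagonal b L i
  antidiagonal-cong a≈b L zero = a≈b L
  antidiagonal-cong a≈b zero (suc i) = refl
  antidiagonal-cong a≈b (suc L) (suc i) = antidiagonal-cong a≈b L i

  antidiagonal-+ : ∀ a b L i →
    antidiagonal (λ n → a n + b n) L i ≈ antidiagonal a L i + antidiagonal b L i
  antidiagonal-+ a b L zero = refl
  antidiagonal-+ a b zero (suc i) = sym (+-identityˡ 0#)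
  antidiagonal-+ a b (suc L) (suc i) = antidiagonal-+ a b L i

  antidiagonal-neg : ∀ a L i → antidiagonal (λ n → - a n) L i ≈ - antidiagonal a L i
  antidiagonal-neg a L zero = refl
  antidiagonal-neg a zero (suc i) = sym -0#≈0#
  antidiagonal-neg a (suc L) (suc i) = antidiagonal-neg a L i

  antidiagonal-* : ∀ b a L i → antidiagonal (λ n → b * a n) L i ≈ b * antidiagonal a L i
  antidiagonal-* b a L zero = refl
  antidiagonal-* b a zero (suc i) = sym (zeroʳ b)
  antidiagonal-* b a (suc L) (suc i) = antidiagonal-* b a L i

  antidiagonal-0# : ∀ L i → antidiagonal (λ _ → 0#) L i ≈ 0#
  antidiagonal-0# L zero = refl
  antidiagonal-0# zero (suc i) = refl
  antidiagonal-0# (suc L) (suc i) = antidiagonal-0# L i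

  -- On the antidiagonal n + i = L, so cⁱcⁿ is the constant c^L.
  antidiagonal-pow : ∀ c a L i →
    pow R c i * antidiagonal (λ n → pow R c n * a n) L i ≈ pow R c L * antidiagonal a L i
  antidiagonal-pow c a L zero = *-identityˡ _
  antidiagonal-pow c a zero (suc i) = trans (zeroʳ _) (sym (zeroʳ _))
  antidiagonal-pow c a (suc L) (suc i) =
    trans (*-assoc _ _ _) (trans (*-congˡ (antidiagonal-pow c a L i)) (sym (*-assoc _ _ _)))

  antidiagonal-beyond : ∀ a L d → antidiagonal a L (suc (L ℕ.+ d)) ≈ 0#
  antidiagonal-beyond a zero d = refl
  antidiagonal-beyond a (suc L) d = antidiagonal-beyond a L d

  antidiagonal-within : ∀ a i l → antidiagonal a (i ℕ.+ l) i ≈ a l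
  antidiagonal-within a zero l = refl
  antidiagonal-within a (suc i) l = antidiagonal-within a i l

  diag-cong : ∀ {f g} → f ≣ g → diag f ≣ diag g
  diag-cong f≣g L i = antidiagonal-cong (λ n → f≣g n i) L i

  diag-⊕ : ∀ f g → diag (λ n → f n ⊕ g n) ≣ (λ L → diag f L ⊕ diag g L)
  diag-⊕ f g L i = antidiagonal-+ (λ n → f n i) (λ n → g n i) L i

  diag-neg : ∀ f → diag (λ n → P.- f n) ≣ (λ L → P.- diag f L)
  diag-neg f L i = antidiagonal-neg (λ n → f n i) L i

  diag-const-⊛ : ∀ a f → diag (λ n → const a ⊛ f n) ≣ (λ L → const a ⊛ diag f L)
  diag-const-⊛ a f L i = begin
    antidiagonal (λ n → (const a ⊛ f n) i) L i  ≈⟨ antidiagonal-cong (λ n → const-⊛ a (f n) i) L i ⟩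
    antidiagonal (λ n → a * f n i) L i          ≈⟨ antidiagonal-* a (λ n → f n i) L i ⟩
    a * diag f L i                              ≈⟨ const-⊛ a (diag f L) i ⟨
    (const a ⊛ diag f L) i                      ∎

  diag-dil : ∀ a f → diag (λ n → dil a (f n)) ≣ (λ L → dil a (diag f L))
  diag-dil a f L i = antidiagonal-* (pow R a i) (λ n → f n i) L i

  diag-dil-pow : ∀ c f → diag (λ n → const (pow R c n) ⊛ dil c (f n)) ≣ (λ L → const (pow R c L) ⊛ diag f L)
  diag-dil-pow c f L i = begin
    antidiagonal (λ n → (const (pow R c n) ⊛ dil c (f n)) i) L i
      ≈⟨ antidiagonal-cong (λ n → trans (const-⊛ _ _ i) (x∙yz≈y∙xz _ _ _)) L i ⟩
    antidiagonal (λ n → pow R c i * (pow R c n * f n i)) L i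
      ≈⟨ antidiagonal-* _ _ L i ⟩
    pow R c i * antidiagonal (λ n → pow R c n * f n i) L i
      ≈⟨ antidiagonal-pow c _ L i ⟩
    pow R c L * diag f L i
      ≈⟨ const-⊛ _ _ i ⟨
    (const (pow R c L) ⊛ diag f L) i
      ∎

  diag-prev : ∀ f → diag (prev f) ≣ prev (diag f)
  diag-prev f zero zero = refl
  diag-prev f zero (suc i) = refl
  diag-prev f (suc L) i = go f L i i
    where
    -- The coefficient index j stays fixed while the recursion index i decreases together with L.
    go : ∀ f L i j → antidiagonal (λ n → prev f n j) (suc L) i ≈ antidiagonal (λ n → f n j) L i
    go f L zero j = refl
    go f zero (suc zero) j = refl
    go f zero (suc (suc i)) j = refl
    go f (suc L) (suc i) j = go f L i j

  -- X becomes Xy, and the factor y is `prev`.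
  diag-X-⊛ : ∀ f → diag (λ n → X ⊛ f n) ≣ (λ L → X ⊛ prev (diag f) L)
  diag-X-⊛ f L zero = trans (X-⊛-zero (f L)) (sym (X-⊛-zero (prev (diag f) L)))
  diag-X-⊛ f zero (suc i) = sym (X-⊛-suc 𝟘 i)
  diag-X-⊛ f (suc L) (suc i) = begin
    antidiagonal (λ n → (X ⊛ f n) (suc i)) L i  ≈⟨ antidiagonal-cong (λ n → X-⊛-suc (f n) i) L i ⟩
    diag f L i                                  ≈⟨ X-⊛-suc (diag f L) i ⟨
    (X ⊛ diag f L) (suc i)                      ∎

  open Exp P.semiring using (_^_) public

  const-pow : ∀ a n → const (pow R a n) ≋ const a ^ n
  const-pow a zero = P.refl
  const-pow a (suc n) = P.trans (const-* a _) (P.*-congˡ (const-pow a n))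

  const-^-⊛ : ∀ a k f n → (const a ^ k ⊛ f) n ≈ pow R a k * f n
  const-^-⊛ a k f n = trans (P.*-congʳ (P.sym (const-pow a k)) n) (const-⊛ _ f n)

  -- The ring identities speak of powers of the series `const a`, the operators commute with single
  -- constants; `const-pow` mediates.
  module Commutes-const-^ (Φ : Series → Series) (Φ-cong : ∀ {f g} → f ≋ g → Φ f ≋ Φ g)
    (Φ-const-⊛ : ∀ c f → Φ (const c ⊛ f) ≋ const c ⊛ Φ f) where

    commutes : ∀ a k f → Φ (const a ^ k ⊛ f) ≋ const a ^ k ⊛ Φ f
    commutes a k f = P.trans (Φ-cong (P.*-congʳ (P.sym (const-pow a k))))
      (P.trans (Φ-const-⊛ _ f) (P.*-congʳ (const-pow a k)))

  twist-^-⊛ : ∀ a b c k f → twist a b (const c ^ k ⊛ f) ≋ const c ^ k ⊛ twist a b f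
  twist-^-⊛ a b = Commutes-const-^.commutes (twist a b) (twist-cong a b) (twist-const-⊛ a b)

  dil-^-⊛ : ∀ a c k f → dil a (const c ^ k ⊛ f) ≋ const c ^ k ⊛ dil a f
  dil-^-⊛ a = Commutes-const-^.commutes (dil a) (dil-cong a) (dil-const-⊛ a)

  diag-^-⊛ : ∀ a k f → diag (λ n → const a ^ k ⊛ f n) ≣ (λ L → const a ^ k ⊛ diag f L)
  diag-^-⊛ a k f L = P.trans (diag-cong (λ n → P.*-congʳ (P.sym (const-pow a k))) L)
    (P.trans (diag-const-⊛ _ f L) (P.*-congʳ (const-pow a k)))

  prev-X-⊛ : ∀ g → prev (λ n → X ⊛ g n) ≣ (λ L → X ⊛ prev g L)
  prev-X-⊛ g zero = P.sym (P.zeroʳ X)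
  prev-X-⊛ g (suc L) = P.refl

  diag-XX-⊛ : ∀ f → diag (λ n → X ⊛ (X ⊛ f n)) ≣ (λ L → X ⊛ (X ⊛ prev (prev (diag f)) L))
  diag-XX-⊛ f L = P.trans (diag-X-⊛ (λ n → X ⊛ f n) L)
    (P.*-congˡ (P.trans (prev-cong (diag-X-⊛ f) L) (prev-X-⊛ _ L)))

  diag-XXX-⊛ : ∀ f → diag (λ n → X ⊛ (X ⊛ (X ⊛ f n))) ≣ (λ L → X ⊛ (X ⊛ (X ⊛ prev (prev (prev (diag f))) L)))
  diag-XXX-⊛ f L = P.trans (diag-XX-⊛ (λ n → X ⊛ f n) L) (P.*-congˡ (P.*-congˡ
    (P.trans (prev-cong (prev-cong (diag-X-⊛ f)) L) (P.trans (prev-cong (prev-X-⊛ _) L) (prev-X-⊛ _ L)))))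

  unit : Sequence
  unit zero = const 1#
  unit (suc n) = 𝟘

  diag-unit : diag unit ≣ unit
  diag-unit zero zero = refl
  diag-unit zero (suc i) = refl
  diag-unit (suc L) zero = refl
  diag-unit (suc L) (suc i) = trans
    (antidiagonal-cong {b = λ _ → 0#} (λ { zero → refl ; (suc n) → refl }) L i) (antidiagonal-0# L i)

-- Gaussian binomials as coefficients of the reciprocal q-product.

module GaussianSeries {c ℓ} (R : CommutativeRing c ℓ) (b : CommutativeRing.Carrier R) where
  open CommutativeRing R
  open PowerSeries R
  open Operators R
  open SetoidReasoning setoid
  private
    module P = CommutativeRing commutativeRing
    open module IP = Identities commutativeRing

  qbin-zeroʳ : ∀ n → qbin R b n 0 ≈ 1#
  qbin-zeroʳ zero = refl
  qbin-zeroʳ (suc n) = refl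

  qbin-> : ∀ n d → qbin R b n (suc (n ℕ.+ d)) ≈ 0#
  qbin-> zero d = refl
  qbin-> (suc n) d = begin
    qbin R b n (suc (n ℕ.+ d)) + pow R b (suc (suc (n ℕ.+ d))) * qbin R b n (suc (suc (n ℕ.+ d)))
      ≡⟨ ≡.cong (λ k → qbin R b n (suc (n ℕ.+ d)) + pow R b (suc (suc (n ℕ.+ d))) * qbin R b n (suc k)) (ℕ.+-suc n d) ⟨
    qbin R b n (suc (n ℕ.+ d)) + pow R b (suc (suc (n ℕ.+ d))) * qbin R b n (suc (n ℕ.+ suc d))
      ≈⟨ +-cong (qbin-> n d) (trans (*-congˡ (qbin-> n (suc d))) (zeroʳ _)) ⟩
    0# + 0#
      ≈⟨ +-identityˡ 0# ⟩
    0#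
      ∎

  -- gauss N = 1 / (X; b)_{N+1}
  gauss : ℕ → Series
  gauss N r = qbin R b (N ℕ.+ r) N

  gauss-zero : gauss 0 ≋ P.1# ⊕ X ⊛ gauss 0
  gauss-zero zero = sym (trans (+-congˡ (X-⊛-zero (gauss 0))) (+-identityʳ 1#))
  gauss-zero (suc r) = sym (trans (+-identityˡ _) (trans (X-⊛-suc (gauss 0) r) (qbin-zeroʳ r)))

  -- Pascal's rule; it removes the last factor 1 - b^(N+1)X of the q-product.
  gauss-suc : ∀ N → gauss (suc N) ≋ gauss N ⊕ const (pow R b (suc N)) ⊛ (X ⊛ gauss (suc N))
  gauss-suc N zero = +-congˡ (begin
    pow R b (suc N) * qbin R b (N ℕ.+ 0) (suc N)
      ≡⟨ ≡.cong (λ k → pow R b (suc N) * qbin R b k (suc N)) (ℕ.+-identityʳ N) ⟩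
    pow R b (suc N) * qbin R b N (suc N)
      ≡⟨ ≡.cong (λ k → pow R b (suc N) * qbin R b N (suc k)) (ℕ.+-identityʳ N) ⟨
    pow R b (suc N) * qbin R b N (suc (N ℕ.+ 0))
      ≈⟨ *-congˡ (trans (qbin-> N 0) (sym (X-⊛-zero (gauss (suc N))))) ⟩
    pow R b (suc N) * (X ⊛ gauss (suc N)) 0
      ∎)
  gauss-suc N (suc r) = +-congˡ (begin
    pow R b (suc N) * qbin R b (N ℕ.+ suc r) (suc N)
      ≡⟨ ≡.cong (λ k → pow R b (suc N) * qbin R b k (suc N)) (ℕ.+-suc N r) ⟩
    pow R b (suc N) * gauss (suc N) r
      ≈⟨ *-congˡ (X-⊛-suc (gauss (suc N)) r) ⟨
    pow R b (suc N) * (X ⊛ gauss (suc N)) (suc r)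
      ≈⟨ const-⊛ _ (X ⊛ gauss (suc N)) (suc r) ⟨
    (const (pow R b (suc N)) ⊛ (X ⊛ gauss (suc N))) (suc r)
      ∎)

  -- Removes the first factor 1 - X instead; the remaining ones form the shorter product at bX. By
  -- induction on N, (1 - X) times `gauss (suc N)` and `dil b (gauss N)` solve the same equation f =
  -- h + aXf.
  gauss-dil : ∀ N → gauss (suc N) ≋ dil b (gauss N) ⊕ X ⊛ gauss (suc N)
  gauss-dil N = P.trans (difference (gauss (suc N)) (X ⊛ gauss (suc N))) (P.+-congʳ (go N))
    where
    dil-step : ∀ N → dil b (gauss (suc N)) ≋
      dil b (gauss N) ⊕ const (pow R b (suc (suc N))) ⊛ (X ⊛ dil b (gauss (suc N)))
    dil-step N = P.trans (dil-cong b (gauss-suc N)) (P.trans (dil-⊕ b _ _) (P.+-congˡ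
      (P.trans (dil-const-⊛ b _ _) (P.trans (P.*-congˡ (dil-X-⊛ b _))
        (P.trans (P.sym (P.*-assoc _ _ _)) (P.*-congʳ (P.trans (P.*-comm _ _) (P.sym (const-* b _)))))))))

    go : ∀ N → gauss (suc N) P.- X ⊛ gauss (suc N) ≋ dil b (gauss N)
    go zero = geometric-unique (pow R b 1)
      (P.trans (difference-step (gauss-suc 0)) (P.+-congʳ (move gauss-zero)))
      (P.trans (dil-cong b gauss-zero) (P.trans (dil-⊕ b _ _) (P.+-cong (dil-const b 1#)
        (P.trans (dil-X-⊛ b _) (P.*-congʳ (const-cong (sym (*-identityʳ b))))))))
    go (suc N) = geometric-unique (pow R b (suc (suc N)))
      (P.trans (difference-step (gauss-suc (suc N))) (P.+-congʳ (go N)))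
      (dil-step N)

  -- Both sides satisfy the recurrence gauss-dil.
  gauss-sym : ∀ N r → gauss N r ≈ qbin R b (r ℕ.+ N) r
  gauss-sym N r = go N r
    where
    gauss′ : ℕ → Series
    gauss′ N r = qbin R b (r ℕ.+ N) r

    X′ : ∀ f → f ≋ const 1# ⊛ f
    X′ f = P.sym (P.*-identityˡ f)

    gauss′-suc : ∀ N → gauss′ (suc N) ≋ dil b (gauss′ N) ⊕ X ⊛ gauss′ (suc N)
    gauss′-suc N zero = sym (trans (+-cong (trans (*-identityˡ _) (qbin-zeroʳ N)) (X-⊛-zero (gauss′ (suc N)))) (+-identityʳ 1#))
    gauss′-suc N (suc r) = begin
      qbin R b (r ℕ.+ suc N) r + pow R b (suc r) * qbin R b (r ℕ.+ suc N) (suc r)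
        ≡⟨ ≡.cong (λ k → qbin R b (r ℕ.+ suc N) r + pow R b (suc r) * qbin R b k (suc r)) (ℕ.+-suc r N) ⟩
      gauss′ (suc N) r + dil b (gauss′ N) (suc r)
        ≈⟨ +-comm _ _ ⟩
      dil b (gauss′ N) (suc r) + gauss′ (suc N) r
        ≈⟨ +-congˡ (X-⊛-suc (gauss′ (suc N)) r) ⟨
      dil b (gauss′ N) (suc r) + (X ⊛ gauss′ (suc N)) (suc r)
        ∎

    gauss′-zero : ∀ r → gauss′ 0 r ≈ 1#
    gauss′-zero zero = refl
    gauss′-zero (suc r) = trans (+-cong (gauss′-zero r) (trans (*-congˡ (begin
      qbin R b (r ℕ.+ 0) (suc r)        ≡⟨ ≡.cong₂ (λ k l → qbin R b k (suc l)) (ℕ.+-identityʳ r) (≡.sym (ℕ.+-identityʳ r)) ⟩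
      qbin R b r (suc (r ℕ.+ 0))        ≈⟨ qbin-> r 0 ⟩
      0#                                ∎)) (zeroʳ _))) (+-identityʳ 1#)

    go : ∀ N → gauss N ≋ gauss′ N
    go zero r = trans (qbin-zeroʳ r) (sym (gauss′-zero r))
    go (suc N) = geometric-unique 1#
      (P.trans (gauss-dil N) (P.+-congˡ (X′ _)))
      (P.trans (gauss′-suc N) (P.+-cong (dil-cong b (P.sym (go N))) (X′ _)))

-- Left-hand side: the series f_l, the passage to L, and the recurrence in L.

module LeftHandSide {c ℓ} (R : CommutativeRing c ℓ) (q : CommutativeRing.Carrier R) where
  open CommutativeRing R
  open PowerSeries R
  open Operators R
  open import Algebra.Properties.CommutativeSemigroup *-commutativeSemigroup using (x∙yz≈y∙xz)
  private
    module P = CommutativeRing commutativeRing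
    open module IP = Identities commutativeRing

  Q : Carrier
  Q = pow R q 3

  open GaussianSeries R Q
  private module Gq = GaussianSeries R q

  q̂ : Series
  q̂ = const q

  const-Q : const Q ≋ q̂ ^ 3
  const-Q = const-pow q 3

  δ : Series → Series
  δ = dil Q

  δ-X-⊛ : ∀ f → δ (X ⊛ f) ≋ q̂ ^ 3 ⊛ (X ⊛ δ f)
  δ-X-⊛ f = P.trans (dil-X-⊛ Q f) (P.*-congʳ const-Q)

  -- euler N = (-Xq; q)_N
  euler : ℕ → Series
  euler N = twist q q (qbin R q N)

  euler-zero : euler 0 ≋ P.1#
  euler-zero zero = *-identityˡ 1#
  euler-zero (suc m) = zeroʳ _

  -- Pascal's rule once more, in the form that splits off the first factor 1 + qX.
  euler-suc : ∀ N → euler (suc N) ≋ (P.1# ⊕ q̂ ⊛ X) ⊛ dil q (euler N)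
  euler-suc N = P.trans coefficients (P.sym (P.trans (P.distribʳ _ _ _) (P.+-cong (P.*-identityˡ _) (P.*-assoc _ _ _))))
    where
    open IntegerCoefficientSolver R
    coefficients : euler (suc N) ≋ dil q (euler N) ⊕ q̂ ⊛ (X ⊛ dil q (euler N))
    coefficients zero = sym (trans
      (+-cong (trans (*-identityˡ _) (trans (*-identityˡ _) (Gq.qbin-zeroʳ N)))
              (trans (*-congˡ (X-⊛-zero (dil q (euler N)))) (zeroʳ q)))
      (trans (+-identityʳ 1#) (sym (*-identityˡ 1#))))
    coefficients (suc m) = trans
      (solve 5 (λ q p w a b → q :* (p :* w) :* (a :+ q :* p :* b)
        := q :* p :* (q :* (p :* w) :* b) :+ q :* (p :* (w :* a)))
        refl q (pow R q m) (weight q q m) (qbin R q N m) (qbin R q N (suc m)))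
      (+-congˡ (sym (trans (const-⊛ q (X ⊛ dil q (euler N)) (suc m)) (*-congˡ (X-⊛-suc (dil q (euler N)) m)))))

  dil-factor : ∀ a f → dil q ((P.1# ⊕ q̂ ⊛ a) ⊛ f) ≋ (P.1# ⊕ q̂ ⊛ dil q a) ⊛ dil q f
  dil-factor a f = P.trans (dil-⊛ q _ f) (P.*-congʳ
    (P.trans (dil-⊕ q _ _) (P.+-cong (dil-const q 1#) (dil-const-⊛ q q a))))

  euler-+3 : ∀ N → euler (3 ℕ.+ N) ≋
    (P.1# ⊕ q̂ ⊛ X) ⊛ ((P.1# ⊕ q̂ ^ 2 ⊛ X) ⊛ ((P.1# ⊕ q̂ ^ 3 ⊛ X) ⊛ δ (euler N)))
  euler-+3 N = begin
    euler (3 ℕ.+ N)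
      ≈⟨ euler-suc (2 ℕ.+ N) ⟩
    (P.1# ⊕ q̂ ⊛ X) ⊛ dil q (euler (2 ℕ.+ N))
      ≈⟨ P.*-congˡ (P.trans (dil-cong q (euler-suc (1 ℕ.+ N))) (dil-factor X _)) ⟩
    (P.1# ⊕ q̂ ⊛ X) ⊛ ((P.1# ⊕ q̂ ⊛ dil q X) ⊛ dil q (dil q (euler (1 ℕ.+ N))))
      ≈⟨ P.*-congˡ (P.*-congˡ (P.trans (dil-cong q (P.trans (dil-cong q (euler-suc N)) (dil-factor X _)))
           (dil-factor (dil q X) _))) ⟩
    (P.1# ⊕ q̂ ⊛ X) ⊛ ((P.1# ⊕ q̂ ⊛ dil q X) ⊛ ((P.1# ⊕ q̂ ⊛ dil q (dil q X)) ⊛ dil q (dil q (dil q (euler N)))))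
      ≈⟨ P.*-congˡ (P.*-cong (P.+-congˡ (P.*-congˡ (dil-X q))) (P.*-cong
           (P.+-congˡ (P.*-congˡ (P.trans (dil-cong q (dil-X q)) (P.trans (dil-const-⊛ q q X) (P.*-congˡ (dil-X q))))))
           (P.trans (dil-cong q (dil-dil q q (euler N))) (P.trans (dil-dil q (q * q) (euler N))
             (dil-base (*-congˡ (*-congˡ (sym (*-identityʳ q)))) (euler N)))))) ⟩
    (P.1# ⊕ q̂ ⊛ X) ⊛ ((P.1# ⊕ q̂ ⊛ (q̂ ⊛ X)) ⊛ ((P.1# ⊕ q̂ ⊛ (q̂ ⊛ (q̂ ⊛ X))) ⊛ δ (euler N)))
      ≈⟨ dilated-product q̂ X (δ (euler N)) ⟩
    (P.1# ⊕ q̂ ⊛ X) ⊛ ((P.1# ⊕ q̂ ^ 2 ⊛ X) ⊛ ((P.1# ⊕ q̂ ^ 3 ⊛ X) ⊛ δ (euler N)))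
      ∎
    where open SetoidReasoning P.setoid

  φ : Series → Series
  φ f = spread (dil q f)

  φ-cong : ∀ {f g} → f ≋ g → φ f ≋ φ g
  φ-cong f≋g = spread-cong (dil-cong q f≋g)

  φ-⊕ : ∀ f g → φ (f ⊕ g) ≋ φ f ⊕ φ g
  φ-⊕ f g = P.trans (spread-cong (dil-⊕ q f g)) (spread-⊕ _ _)

  φ-const-⊛ : ∀ a f → φ (const a ⊛ f) ≋ const a ⊛ φ f
  φ-const-⊛ a f = P.trans (spread-cong (dil-const-⊛ q a f))
    (P.trans (spread-⊛ _ _) (P.*-congʳ (spread-const a)))

  φ-X-⊛ : ∀ f → φ (X ⊛ f) ≋ q̂ ⊛ (X ⊛ (X ⊛ φ f))
  φ-X-⊛ f = P.trans (spread-cong (dil-X-⊛ q f)) (P.trans (spread-⊛ _ _) (P.*-cong (spread-const q)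
    (P.trans (spread-⊛ X _) (P.trans (P.*-congʳ spread-X) (P.*-assoc _ _ _)))))

  -- Two dilations inside become one outside, as f(Q²qX²) = f(q(QX)²).
  φ-δ : ∀ f → φ (δ (δ f)) ≋ δ (φ f)
  φ-δ f = P.trans (spread-cong swap) (spread-dil Q (dil q f))
    where
    swap : dil q (δ (δ f)) ≋ dil (Q * Q) (dil q f)
    swap n = trans (*-congˡ (dil-dil Q Q f n)) (x∙yz≈y∙xz _ _ _)

  -- denominator l = 1 / (X²q; Q)_{2l+1}
  denominator : ℕ → Series
  denominator l = φ (gauss (l ℕ.* 2))

  denominator-zero : denominator 0 ≋ P.1# ⊕ q̂ ⊛ (X ⊛ (X ⊛ denominator 0))
  denominator-zero = P.trans (φ-cong gauss-zero) (P.trans (φ-⊕ _ _)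
    (P.+-cong (P.trans (spread-cong (dil-const q 1#)) (spread-const 1#)) (φ-X-⊛ _)))

  -- 1 / (X²q⁴; Q)_{2l+2}, that is, `denominator (suc l)` without its first factor. Removing the
  -- next one, 1 - q⁴X², leaves `denominator l` at QX.
  intermediate : ℕ → Series
  intermediate l = φ (δ (gauss (suc (l ℕ.* 2))))

  denominator-suc : ∀ l → denominator (suc l) ≋ intermediate l ⊕ q̂ ⊛ (X ⊛ (X ⊛ denominator (suc l)))
  denominator-suc l = P.trans (φ-cong (gauss-dil (suc (l ℕ.* 2)))) (P.trans (φ-⊕ _ _) (P.+-congˡ (φ-X-⊛ _)))

  intermediate-rec : ∀ l → intermediate l ≋ δ (denominator l) ⊕ q̂ ^ 4 ⊛ (X ⊛ (X ⊛ intermediate l))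
  intermediate-rec l = P.trans
    (φ-cong (P.trans (dil-cong Q (gauss-dil (l ℕ.* 2))) (P.trans (dil-⊕ Q _ _) (P.+-congˡ (dil-X-⊛ Q _)))))
    (P.trans (φ-⊕ _ _) (P.+-cong (φ-δ _)
      (P.trans (φ-const-⊛ Q _) (P.trans (P.*-cong const-Q (φ-X-⊛ _)) (collect-4 q̂ _)))))

  -- The series f_l in the opening comment.
  seed : ℕ → Series
  seed l = euler (l ℕ.* 3) ⊛ denominator l

  seed-zero : seed 0 ≋ P.1# P.- q̂ ^ 2 ⊛ X ⊕
    (q̂ ^ 2 ⊛ (X ⊛ seed 0) ⊕ q̂ ⊛ (X ⊛ (X ⊛ seed 0)) P.- q̂ ^ 3 ⊛ (X ⊛ (X ⊛ (X ⊛ seed 0))))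
  seed-zero = product-initial q̂ X (euler 0) (denominator 0) euler-zero denominator-zero

  seed-suc : ∀ l → seed (suc l) ≋
    δ (seed l) ⊕ q̂ ⊛ (X ⊛ δ (seed l)) ⊕ q̂ ^ 3 ⊛ (X ⊛ δ (seed l)) ⊕ q̂ ^ 4 ⊛ (X ⊛ (X ⊛ δ (seed l))) ⊕
    (q̂ ^ 2 ⊛ (X ⊛ seed (suc l)) ⊕ q̂ ⊛ (X ⊛ (X ⊛ seed (suc l))) P.- q̂ ^ 3 ⊛ (X ⊛ (X ⊛ (X ⊛ seed (suc l)))))
  seed-suc l = P.trans
    (product-recurrence q̂ X (euler (suc l ℕ.* 3)) (δ (euler (l ℕ.* 3))) (denominator (suc l))
      (intermediate l) (δ (denominator l)) (euler-+3 (l ℕ.* 3)) (denominator-suc l) (intermediate-rec l))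
    (P.+-congʳ (P.+-cong (P.+-cong (P.+-cong F (P.*-congˡ (P.*-congˡ F))) (P.*-congˡ (P.*-congˡ F)))
      (P.*-congˡ (P.*-congˡ (P.*-congˡ F)))))
    where
    F : δ (euler (l ℕ.* 3)) ⊛ δ (denominator l) ≋ δ (seed l)
    F = P.sym (dil-⊛ Q _ _)

  -- Supplies q^((3i² - i)/2), the part of the exponent depending on i alone; q^(m(m+1)/2) sits in
  -- `euler` and q^((i-m)/2) in `denominator`.
  τ : Series → Series
  τ = twist q Q

  τ-⊕ : ∀ {f g f′ g′} → τ f ≋ f′ → τ g ≋ g′ → τ (f ⊕ g) ≋ f′ ⊕ g′
  τ-⊕ p r = P.trans (twist-⊕ q Q _ _) (P.+-cong p r)

  τ-neg : ∀ {f f′} → τ f ≋ f′ → τ (P.- f) ≋ P.- f′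
  τ-neg p = P.trans (twist-neg q Q _) (P.-‿cong p)

  τ-X : ∀ f → τ (X ⊛ f) ≋ q̂ ⊛ (X ⊛ δ (τ f))
  τ-X = twist-X-⊛ q Q

  τ-XX : ∀ f → τ (X ⊛ (X ⊛ f)) ≋ q̂ ^ 5 ⊛ (X ⊛ (X ⊛ δ (δ (τ f))))
  τ-XX f = P.trans (twist-XX-⊛ q Q f)
    (P.trans (P.*-congˡ (P.*-congˡ (P.*-congˡ (P.*-congʳ const-Q)))) (weights-X² q̂ X _))

  τ-XXX : ∀ f → τ (X ⊛ (X ⊛ (X ⊛ f))) ≋ q̂ ^ 12 ⊛ (X ⊛ (X ⊛ (X ⊛ δ (δ (δ (τ f))))))
  τ-XXX f = P.trans (τ-X (X ⊛ (X ⊛ f))) (P.trans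
    (P.*-congˡ (P.*-congˡ (P.trans (dil-cong Q (τ-XX f)) (P.trans (dil-^-⊛ Q q 5 _)
      (P.*-congˡ (P.trans (δ-X-⊛ _) (P.*-congˡ (P.*-congˡ (δ-X-⊛ _)))))))))
    (weights-X³ q̂ X _))

  ξ : ℕ → Series
  ξ l = τ (seed l)

  δ¹ δ² δ³ : Sequence → Sequence
  δ¹ g l = δ (g l)
  δ² g l = δ (δ (g l))
  δ³ g l = δ (δ (δ (g l)))

  -- The terms at index l itself, after `τ`; `inhomogeneous` has those at l - 1. The arguments are
  -- separate because they carry different numbers of dilations, and of shifts after `diag`.
  homogeneous : Series → Series → Series → Series
  homogeneous A B C = q̂ ^ 3 ⊛ (X ⊛ A) ⊕ q̂ ^ 6 ⊛ (X ⊛ (X ⊛ B)) P.- q̂ ^ 15 ⊛ (X ⊛ (X ⊛ (X ⊛ C)))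

  inhomogeneous : Series → Series → Series → Series
  inhomogeneous A B C = A ⊕ q̂ ^ 2 ⊛ (X ⊛ B) ⊕ q̂ ^ 4 ⊛ (X ⊛ B) ⊕ q̂ ^ 9 ⊛ (X ⊛ (X ⊛ C))

  τ-homogeneous : ∀ f →
    τ (q̂ ^ 2 ⊛ (X ⊛ f) ⊕ q̂ ⊛ (X ⊛ (X ⊛ f)) P.- q̂ ^ 3 ⊛ (X ⊛ (X ⊛ (X ⊛ f))))
    ≋ homogeneous (δ (τ f)) (δ (δ (τ f))) (δ (δ (δ (τ f))))
  τ-homogeneous f = τ-⊕ (τ-⊕
    (P.trans (twist-^-⊛ q Q q 2 _) (P.trans (P.*-congˡ (τ-X f)) (collect-2-1 q̂ X _)))
    (P.trans (twist-const-⊛ q Q q _) (P.trans (P.*-congˡ (τ-XX f)) (collect-1-5 q̂ _))))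
    (τ-neg (P.trans (twist-^-⊛ q Q q 3 _) (P.trans (P.*-congˡ (τ-XXX f)) (collect-3-12 q̂ _))))

  τ-inhomogeneous : ∀ f →
    τ (δ f ⊕ q̂ ⊛ (X ⊛ δ f) ⊕ q̂ ^ 3 ⊛ (X ⊛ δ f) ⊕ q̂ ^ 4 ⊛ (X ⊛ (X ⊛ δ f)))
    ≋ inhomogeneous (δ (τ f)) (δ (δ (τ f))) (δ (δ (δ (τ f))))
  τ-inhomogeneous f = τ-⊕ (τ-⊕ (τ-⊕ (twist-dil q Q Q f)
    (P.trans (twist-const-⊛ q Q q _) (P.trans (P.*-congˡ (P.trans (τ-X (δ f)) (P.*-congˡ (P.*-congˡ (dil-cong Q (twist-dil q Q Q f))))))
      (collect-1-1 q̂ X _))))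
    (P.trans (twist-^-⊛ q Q q 3 _) (P.trans (P.*-congˡ (P.trans (τ-X (δ f)) (P.*-congˡ (P.*-congˡ (dil-cong Q (twist-dil q Q Q f))))))
      (collect-3-1 q̂ X _))))
    (P.trans (twist-^-⊛ q Q q 4 _) (P.trans (P.*-congˡ (P.trans (τ-XX (δ f))
      (P.*-congˡ (P.*-congˡ (P.*-congˡ (dil-cong Q (dil-cong Q (twist-dil q Q Q f))))))))
      (collect-4-5 q̂ _)))

  -- Two arguments, because under `diag` the X gains a shift, which turns the second `unit` into
  -- `prev unit`.
  source : Series → Series → Series
  source u v = u P.- q̂ ^ 3 ⊛ (X ⊛ v)

  ξ-rec : ∀ l → ξ l ≋
    inhomogeneous (prev (δ¹ ξ) l) (prev (δ² ξ) l) (prev (δ³ ξ) l)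
    ⊕ source (unit l) (unit l)
    ⊕ homogeneous (δ¹ ξ l) (δ² ξ l) (δ³ ξ l)
  ξ-rec zero = P.trans (twist-cong q Q seed-zero) (τ-⊕
    (P.trans (τ-⊕ (twist-const q Q 1#) (τ-neg (P.trans (twist-^-⊛ q Q q 2 X) (P.trans
        (P.*-congˡ (P.trans (twist-cong q Q (P.sym (P.*-identityʳ X)))
          (P.trans (τ-X P.1#) (P.*-congˡ (P.*-congˡ (P.trans (dil-cong Q (twist-const q Q 1#)) (dil-const Q 1#)))))))
        (collect-2-1 q̂ X P.1#)))))
      (P.sym (P.trans (P.+-congʳ (vanishing-inhomogeneous q̂ X)) (P.+-identityˡ _))))
    (τ-homogeneous (seed 0)))
  ξ-rec (suc l) = P.trans (twist-cong q Q (seed-suc l)) (τ-⊕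
    (P.trans (τ-inhomogeneous (seed l))
      (P.sym (P.trans (P.+-congˡ (vanishing-source q̂ X)) (P.+-identityʳ _))))
    (τ-homogeneous (seed (suc l))))

  Ψ : Sequence
  Ψ = diag ξ

  diag-lift : ∀ {f g f′ g′} → diag f ≣ f′ → diag g ≣ g′ → diag (λ n → f n ⊕ g n) ≣ (λ L → f′ L ⊕ g′ L)
  diag-lift p r L = P.trans (diag-⊕ _ _ L) (P.+-cong (p L) (r L))

  diag-neg-lift : ∀ {f f′} → diag f ≣ f′ → diag (λ n → P.- f n) ≣ (λ L → P.- f′ L)
  diag-neg-lift p L = P.trans (diag-neg _ L) (P.-‿cong (p L))

  diag-scale-lift : ∀ k {f f′} → diag f ≣ f′ → diag (λ n → q̂ ^ k ⊛ f n) ≣ (λ L → q̂ ^ k ⊛ f′ L)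
  diag-scale-lift k p L = P.trans (diag-^-⊛ q k _ L) (P.*-congˡ (p L))

  diag-δ¹ : diag (δ¹ ξ) ≣ δ¹ Ψ
  diag-δ¹ = diag-dil Q ξ

  diag-δ² : diag (δ² ξ) ≣ δ² Ψ
  diag-δ² L = P.trans (diag-dil Q (δ¹ ξ) L) (dil-cong Q (diag-δ¹ L))

  diag-δ³ : diag (δ³ ξ) ≣ δ³ Ψ
  diag-δ³ L = P.trans (diag-dil Q (δ² ξ) L) (dil-cong Q (diag-δ² L))

  diag-prev-lift : ∀ {f f′} → diag f ≣ f′ → diag (prev f) ≣ prev f′
  diag-prev-lift p L = P.trans (diag-prev _ L) (prev-cong p L)

  diag-X-lift : ∀ {f f′} → diag f ≣ f′ → diag (λ n → X ⊛ f n) ≣ (λ L → X ⊛ prev f′ L)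
  diag-X-lift p L = P.trans (diag-X-⊛ _ L) (P.*-congˡ (prev-cong p L))

  diag-XX-lift : ∀ {f f′} → diag f ≣ f′ → diag (λ n → X ⊛ (X ⊛ f n)) ≣ (λ L → X ⊛ (X ⊛ prev (prev f′) L))
  diag-XX-lift p L = P.trans (diag-XX-⊛ _ L) (P.*-congˡ (P.*-congˡ (prev-cong (prev-cong p) L)))

  diag-XXX-lift : ∀ {f f′} → diag f ≣ f′ →
    diag (λ n → X ⊛ (X ⊛ (X ⊛ f n))) ≣ (λ L → X ⊛ (X ⊛ (X ⊛ prev (prev (prev f′)) L)))
  diag-XXX-lift p L = P.trans (diag-XXX-⊛ _ L)
    (P.*-congˡ (P.*-congˡ (P.*-congˡ (prev-cong (prev-cong (prev-cong p)) L))))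

  back¹ back² back³ : Sequence → Sequence
  back¹ g = prev (δ¹ g)
  back² g = prev (prev (δ² g))
  back³ g = prev (prev (prev (δ³ g)))

  -- Under `diag` each X brings a shift of L, so a term with k dilations ends up with exactly k
  -- shifts, coming from `prev` or from X. The distinction between l and l - 1 disappears.
  Ψ-rec : ∀ L → Ψ L ≋
    inhomogeneous (back¹ Ψ L) (back² Ψ L) (back³ Ψ L)
    ⊕ source (unit L) (prev unit L)
    ⊕ homogeneous (back¹ Ψ L) (back² Ψ L) (back³ Ψ L)
  Ψ-rec L = P.trans (diag-cong ξ-rec L) (diag-lift (diag-lift
    (diag-lift (diag-lift (diag-lift
      (diag-prev-lift diag-δ¹)
      (diag-scale-lift 2 (diag-X-lift (diag-prev-lift diag-δ²))))
      (diag-scale-lift 4 (diag-X-lift (diag-prev-lift diag-δ²))))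
      (diag-scale-lift 9 (diag-XX-lift (diag-prev-lift diag-δ³))))
    (diag-lift diag-unit (diag-neg-lift (diag-scale-lift 3 (diag-X-lift diag-unit)))))
    (diag-lift (diag-lift
      (diag-scale-lift 3 (diag-X-lift diag-δ¹))
      (diag-scale-lift 6 (diag-XX-lift diag-δ²)))
      (diag-neg-lift (diag-scale-lift 15 (diag-XXX-lift diag-δ³)))) L)

  -- Θ L is the generating function of the left-hand sides for all M; see LHS≈Θ.
  Θ : Sequence
  Θ L = gauss L ⊛ Ψ L

  -- Stripping the first k factors of 1 / (X; Q)_{L+1} gives the product for L - k, dilated k times:
  -- the same dilations and shifts as in the back sequences, so these pass from Ψ to Θ.
  factor₁ : ∀ N → (P.1# P.- X) ⊛ gauss (suc N) ≋ δ (gauss N)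
  factor₁ N = factor-move (gauss-dil N)

  factor₂ : ∀ N → (P.1# P.- q̂ ^ 3 ⊛ X) ⊛ δ (gauss (suc N)) ≋ δ (δ (gauss N))
  factor₂ N = factor-move (P.trans (dil-cong Q (gauss-dil N)) (P.trans (dil-⊕ Q _ _)
    (P.+-congˡ (P.trans (δ-X-⊛ _) (P.sym (P.*-assoc _ _ _))))))

  factor₃ : ∀ N → (P.1# P.- q̂ ^ 6 ⊛ X) ⊛ δ (δ (gauss (suc N))) ≋ δ (δ (δ (gauss N)))
  factor₃ N = factor-move (P.trans (dil-cong Q (dil-cong Q (gauss-dil N))) (P.trans (dil-cong Q (dil-⊕ Q _ _))
    (P.trans (dil-⊕ Q _ _) (P.+-congˡ (P.trans (dil-cong Q (δ-X-⊛ _)) (P.trans (dil-^-⊛ Q q 3 _)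
      (P.trans (P.*-congˡ (δ-X-⊛ _)) (collect-3-3 q̂ X _))))))))

  vanishes : ∀ a {f} → f ≋ 𝟘 → a ⊛ f ≋ 𝟘
  vanishes a f≋𝟘 = P.trans (P.*-congˡ f≋𝟘) (P.zeroʳ a)

  back¹-Θ : ∀ L → (P.1# P.- X) ⊛ (gauss L ⊛ back¹ Ψ L) ≋ back¹ Θ L
  back¹-Θ zero = vanishes _ (P.zeroʳ _)
  back¹-Θ (suc L) = telescope (factor₁ L) (P.sym (dil-⊛ Q _ _))

  back²-Θ : ∀ L → (P.1# P.- q̂ ^ 3 ⊛ X) ⊛ ((P.1# P.- X) ⊛ (gauss L ⊛ back² Ψ L)) ≋ back² Θ L
  back²-Θ zero = vanishes _ (vanishes _ (P.zeroʳ _))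
  back²-Θ (suc zero) = vanishes _ (vanishes _ (P.zeroʳ _))
  back²-Θ (suc (suc L)) = P.trans (P.*-congˡ (telescope (factor₁ (suc L)) P.refl))
    (telescope (factor₂ L) (P.sym (P.trans (dil-cong Q (dil-⊛ Q _ _)) (dil-⊛ Q _ _))))

  back³-Θ : ∀ L → (P.1# P.- q̂ ^ 6 ⊛ X) ⊛ ((P.1# P.- q̂ ^ 3 ⊛ X) ⊛ ((P.1# P.- X) ⊛ (gauss L ⊛ back³ Ψ L))) ≋ back³ Θ L
  back³-Θ zero = vanishes _ (vanishes _ (vanishes _ (P.zeroʳ _)))
  back³-Θ (suc zero) = vanishes _ (vanishes _ (vanishes _ (P.zeroʳ _)))
  back³-Θ (suc (suc zero)) = vanishes _ (vanishes _ (vanishes _ (P.zeroʳ _)))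
  back³-Θ (suc (suc (suc L))) = P.trans
    (P.*-congˡ (P.trans (P.*-congˡ (telescope (factor₁ (suc (suc L))) P.refl)) (telescope (factor₂ (suc L)) P.refl)))
    (telescope (factor₃ L) (P.sym (P.trans (dil-cong Q (P.trans (dil-cong Q (dil-⊛ Q _ _)) (dil-⊛ Q _ _))) (dil-⊛ Q _ _))))

  unit-Θ : ∀ L → (P.1# P.- X) ⊛ (gauss L ⊛ unit L) ≋ unit L
  unit-Θ zero = telescope (factor-move gauss-zero) (P.*-identityˡ _)
  unit-Θ (suc L) = vanishes _ (P.zeroʳ _)

  prev-unit-Θ : ∀ L → (P.1# P.- q̂ ^ 3 ⊛ X) ⊛ ((P.1# P.- X) ⊛ (gauss L ⊛ prev unit L)) ≋ prev unit L
  prev-unit-Θ zero = vanishes _ (vanishes _ (P.zeroʳ _))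
  prev-unit-Θ (suc zero) = P.trans (P.*-congˡ (telescope (factor₁ 0) P.refl))
    (telescope (factor-move (P.trans (dil-cong Q gauss-zero) (P.trans (dil-⊕ Q _ _)
      (P.+-cong (dil-const Q 1#) (P.trans (δ-X-⊛ _) (P.sym (P.*-assoc _ _ _))))))) (P.*-identityˡ _))
  prev-unit-Θ (suc (suc L)) = vanishes _ (vanishes _ (P.zeroʳ _))

  Θ-rec : ∀ L →
    Θ L ⊕ q̂ ^ 3 ⊛ (X ⊛ (X ⊛ Θ L)) ⊕ q̂ ^ 6 ⊛ (X ⊛ (X ⊛ back¹ Θ L))
    ≋ X ⊛ Θ L ⊕ q̂ ^ 3 ⊛ (X ⊛ Θ L) ⊕ back¹ Θ L
      ⊕ (q̂ ^ 2 ⊛ (X ⊛ back² Θ L) ⊕ q̂ ^ 4 ⊛ (X ⊛ back² Θ L) ⊕ q̂ ^ 6 ⊛ (X ⊛ (X ⊛ back² Θ L)))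
      ⊕ q̂ ^ 9 ⊛ (X ⊛ (X ⊛ back³ Θ L))
      ⊕ (unit L P.- q̂ ^ 3 ⊛ (X ⊛ unit L) P.- q̂ ^ 3 ⊛ (X ⊛ prev unit L))
  Θ-rec L = theta-recurrence q̂ X (gauss L) (Ψ L) (back¹ Ψ L) (back² Ψ L) (back³ Ψ L)
    (back¹ Θ L) (back² Θ L) (back³ Θ L) (unit L) (prev unit L)
    (Ψ-rec L) (back¹-Θ L) (back²-Θ L) (back³-Θ L) (unit-Θ L) (prev-unit-Θ L)

  -- Transposition: the recurrence in M for series in y.

  Q^ : ℕ → Series
  Q^ M = const (pow R Q M)

  Q^-suc : ∀ M → Q^ (suc M) ≋ q̂ ^ 3 ⊛ Q^ M
  Q^-suc M = P.trans (const-* Q _) (P.*-congʳ const-Q)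

  step-1 : Series → Series
  step-1 K₀ = K₀ ⊕ q̂ ^ 3 ⊛ K₀ ⊕ q̂ ^ 2 ⊛ (X ⊛ (X ⊛ K₀)) ⊕ q̂ ^ 4 ⊛ (X ⊛ (X ⊛ K₀))
    P.- q̂ ^ 3 ⊛ P.1# P.- q̂ ^ 3 ⊛ (X ⊛ P.1#)

  step-2 : Series → Series → Series → Series
  step-2 a K₀ K₁ = K₁ ⊕ q̂ ^ 3 ⊛ K₁
    ⊕ (q̂ ^ 2 ⊛ (X ⊛ (X ⊛ ((q̂ ^ 3 ⊛ a) ⊛ ((q̂ ^ 3 ⊛ a) ⊛ K₁))))
      ⊕ q̂ ^ 4 ⊛ (X ⊛ (X ⊛ ((q̂ ^ 3 ⊛ a) ⊛ ((q̂ ^ 3 ⊛ a) ⊛ K₁))))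
      ⊕ q̂ ^ 6 ⊛ (X ⊛ (X ⊛ (a ⊛ (a ⊛ K₀)))))
    ⊕ q̂ ^ 9 ⊛ (X ⊛ (X ⊛ (X ⊛ (a ⊛ (a ⊛ (a ⊛ K₀))))))
    P.- q̂ ^ 3 ⊛ K₀ P.- q̂ ^ 6 ⊛ (X ⊛ (a ⊛ K₀))

  -- X stands for y here. Every field has the form f = h + aXf with h built from earlier members, so
  -- it determines f; `at-0` and `at-1` fix the start.
  record Recurrence (K : Sequence) : Set ℓ where
    field
      at-0 : K 0 ≋ P.1# ⊕ Q^ 0 ⊛ (X ⊛ K 0)
      at-1 : K 1 ≋ step-1 (K 0) ⊕ Q^ 1 ⊛ (X ⊛ K 1)
      at-2 : ∀ M → K (2 ℕ.+ M) ≋ step-2 (Q^ M) (K M) (K (1 ℕ.+ M)) ⊕ Q^ (2 ℕ.+ M) ⊛ (X ⊛ K (2 ℕ.+ M))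

  step-1-cong : ∀ {f g} → f ≋ g → step-1 f ≋ step-1 g
  step-1-cong p = P.+-congʳ (P.+-congʳ (P.+-cong (P.+-cong (P.+-cong p (P.*-congˡ p))
    (P.*-congˡ (P.*-congˡ (P.*-congˡ p)))) (P.*-congˡ (P.*-congˡ (P.*-congˡ p)))))

  step-2-cong : ∀ a {f g f′ g′} → f ≋ g → f′ ≋ g′ → step-2 a f f′ ≋ step-2 a g g′
  step-2-cong a p r = P.+-cong (P.+-cong (P.+-cong (P.+-cong (P.+-cong r (P.*-congˡ r))
    (P.+-cong (P.+-cong
      (P.*-congˡ (P.*-congˡ (P.*-congˡ (P.*-congˡ (P.*-congˡ r)))))
      (P.*-congˡ (P.*-congˡ (P.*-congˡ (P.*-congˡ (P.*-congˡ r))))))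
      (P.*-congˡ (P.*-congˡ (P.*-congˡ (P.*-congˡ (P.*-congˡ p)))))))
    (P.*-congˡ (P.*-congˡ (P.*-congˡ (P.*-congˡ (P.*-congˡ (P.*-congˡ (P.*-congˡ p))))))))
    (P.-‿cong (P.*-congˡ p)))
    (P.-‿cong (P.*-congˡ (P.*-congˡ (P.*-congˡ p))))

  recurrence-unique : ∀ {K K′} → Recurrence K → Recurrence K′ → K ≣ K′
  recurrence-unique {K} {K′} r r′ M = proj₁ (go M)
    where
    module r = Recurrence r
    module r′ = Recurrence r′
    go : ∀ M → (K M ≋ K′ M) Product.× (K (suc M) ≋ K′ (suc M))
    go zero = K₀ , geometric-unique (pow R Q 1) r.at-1
      (P.trans r′.at-1 (P.+-congʳ (step-1-cong (P.sym K₀))))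
      where
      K₀ : K 0 ≋ K′ 0
      K₀ = geometric-unique (pow R Q 0) r.at-0 r′.at-0
    go (suc M) with go M
    ... | p , p′ = p′ , geometric-unique (pow R Q (2 ℕ.+ M)) (r.at-2 M)
      (P.trans (r′.at-2 M) (P.+-congʳ (step-2-cong (Q^ M) (P.sym p) (P.sym p′))))

  -- f is the series, in the index L, of the coefficients of X^M in g L. This is a record, and not just
  -- an equality, so that g and f can be inferred from it.
  record Row (g : Sequence) (M : ℕ) (f : Series) : Set ℓ where
    constructor row
    field row-≈ : ∀ L → g L M ≈ f L
  open Row

  row-unique : ∀ {g h M f f′} → g ≣ h → Row g M f → Row h M f′ → f ≋ f′
  row-unique {M = M} g≣h (row p) (row p′) L = trans (sym (p L)) (trans (g≣h L M) (p′ L))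

  row-≋ : ∀ {g M f f′} → f ≋ f′ → Row g M f → Row g M f′
  row-≋ f≋f′ (row p) = row (λ L → trans (p L) (f≋f′ L))

  infixl 6 _row-⊕_
  _row-⊕_ : ∀ {g h M f f′} → Row g M f → Row h M f′ → Row (λ L → g L ⊕ h L) M (f ⊕ f′)
  row p row-⊕ row p′ = row (λ L → +-cong (p L) (p′ L))

  row-neg : ∀ {g M f} → Row g M f → Row (λ L → P.- g L) M (P.- f)
  row-neg (row p) = row (λ L → -‿cong (p L))

  -- Reading rows exchanges the variables: a shift of L becomes multiplication by X, multiplication
  -- by X a shift of M (`row-X`), and a dilation the constant Q^M (`row-δ`).
  row-prev : ∀ {g M f} → Row g M f → Row (prev g) M (X ⊛ f)
  row-prev {f = f} (row p) = row λ
    { zero → sym (X-⊛-zero f)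
    ; (suc L) → trans (p L) (sym (X-⊛-suc f L)) }

  row-scale : ∀ k {g M f} → Row g M f → Row (λ L → q̂ ^ k ⊛ g L) M (q̂ ^ k ⊛ f)
  row-scale k {g} {M} {f} (row p) =
    row (λ L → trans (const-^-⊛ q k (g L) M) (trans (*-congˡ (p L)) (sym (const-^-⊛ q k f L))))

  row-X : ∀ {g M f} → Row g M f → Row (λ L → X ⊛ g L) (suc M) f
  row-X {g} {M} (row p) = row (λ L → trans (X-⊛-suc (g L) M) (p L))

  row-X-zero : ∀ {g : Sequence} → Row (λ L → X ⊛ g L) 0 𝟘
  row-X-zero {g} = row (λ L → X-⊛-zero (g L))

  row-scale-𝟘 : ∀ k {g M} → Row g M 𝟘 → Row (λ L → q̂ ^ k ⊛ g L) M 𝟘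
  row-scale-𝟘 k r = row-≋ (P.zeroʳ _) (row-scale k r)

  row-δ : ∀ {g M f} → Row g M f → Row (δ¹ g) M (Q^ M ⊛ f)
  row-δ {f = f} (row p) = row (λ L → trans (*-congˡ (p L)) (sym (const-⊛ _ f L)))

  row-unit-zero : Row unit 0 P.1#
  row-unit-zero = row λ { zero → refl ; (suc L) → refl }

  row-unit-suc : ∀ {M} → Row unit (suc M) 𝟘
  row-unit-suc = row λ { zero → refl ; (suc L) → refl }

  K : Sequence
  K M L = Θ L M

  row-Θ : ∀ {M} → Row Θ M (K M)
  row-Θ = row (λ L → refl)

  row-back¹ : ∀ {M} → Row (back¹ Θ) M (X ⊛ (Q^ M ⊛ K M))
  row-back¹ = row-prev (row-δ row-Θ)

  row-back² : ∀ {M} → Row (back² Θ) M (X ⊛ (X ⊛ (Q^ M ⊛ (Q^ M ⊛ K M))))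
  row-back² = row-prev (row-prev (row-δ (row-δ row-Θ)))

  row-back³ : ∀ {M} → Row (back³ Θ) M (X ⊛ (X ⊛ (X ⊛ (Q^ M ⊛ (Q^ M ⊛ (Q^ M ⊛ K M))))))
  row-back³ = row-prev (row-prev (row-prev (row-δ (row-δ (row-δ row-Θ)))))

  swap-X : ∀ a f → X ⊛ (a ⊛ f) ≋ a ⊛ (X ⊛ f)
  swap-X a f = P.trans (P.sym (P.*-assoc _ _ _)) (P.trans (P.*-congʳ (P.*-comm _ _)) (P.*-assoc _ _ _))

  -- Rows 0, 1 and M + 2 of `Θ-rec`. X occurs there up to its square, so rows 0 and 1 lack some
  -- terms, and they alone receive the `unit` terms.
  K-recurrence : Recurrence K
  K-recurrence = record { at-0 = at-0 ; at-1 = at-1 ; at-2 = at-2 }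
    where
    at-0 : K 0 ≋ P.1# ⊕ Q^ 0 ⊛ (X ⊛ K 0)
    at-0 = P.trans (row-0-rearrange (row-unique Θ-rec
      (row-Θ row-⊕ row-scale-𝟘 3 row-X-zero row-⊕ row-scale-𝟘 6 row-X-zero)
      (row-X-zero row-⊕ row-scale-𝟘 3 row-X-zero row-⊕ row-back¹
        row-⊕ (row-scale-𝟘 2 row-X-zero row-⊕ row-scale-𝟘 4 row-X-zero row-⊕ row-scale-𝟘 6 row-X-zero)
        row-⊕ row-scale-𝟘 9 row-X-zero
        row-⊕ (row-unit-zero row-⊕ row-neg (row-scale-𝟘 3 row-X-zero) row-⊕ row-neg (row-scale-𝟘 3 row-X-zero)))))
      (P.+-congˡ (swap-X _ _))

    at-1 : K 1 ≋ step-1 (K 0) ⊕ Q^ 1 ⊛ (X ⊛ K 1)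
    at-1 = P.trans (row-1-rearrange (row-unique Θ-rec
      (row-Θ row-⊕ row-scale-𝟘 3 (row-X row-X-zero) row-⊕ row-scale-𝟘 6 (row-X row-X-zero))
      (row-X row-Θ row-⊕ row-scale 3 (row-X row-Θ) row-⊕ row-back¹
        row-⊕ (row-scale 2 (row-X shifted) row-⊕ row-scale 4 (row-X shifted) row-⊕ row-scale-𝟘 6 (row-X row-X-zero))
        row-⊕ row-scale-𝟘 9 (row-X row-X-zero)
        row-⊕ (row-unit-suc row-⊕ row-neg (row-scale 3 (row-X row-unit-zero))
          row-⊕ row-neg (row-scale 3 (row-X (row-prev row-unit-zero)))))))
      (P.+-congˡ (swap-X _ _))
      where
      shifted : Row (back² Θ) 0 (X ⊛ (X ⊛ K 0))
      shifted = row-≋ (P.*-congˡ (P.*-congˡ (P.trans (P.*-identityˡ _) (P.*-identityˡ _)))) row-back²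

    at-2 : ∀ M → K (2 ℕ.+ M) ≋ step-2 (Q^ M) (K M) (K (1 ℕ.+ M)) ⊕ Q^ (2 ℕ.+ M) ⊛ (X ⊛ K (2 ℕ.+ M))
    at-2 M = P.trans (row-2-rearrange (row-unique Θ-rec
      (row-Θ row-⊕ row-scale 3 (row-X (row-X row-Θ)) row-⊕ row-scale 6 (row-X (row-X row-back¹)))
      (row-X row-Θ row-⊕ row-scale 3 (row-X row-Θ) row-⊕ row-back¹
        row-⊕ (row-scale 2 (row-X shifted) row-⊕ row-scale 4 (row-X shifted) row-⊕ row-scale 6 (row-X (row-X row-back²)))
        row-⊕ row-scale 9 (row-X (row-X row-back³))
        row-⊕ (row-unit-suc row-⊕ row-neg (row-scale-𝟘 3 (row-X row-unit-suc))
          row-⊕ row-neg (row-scale-𝟘 3 (row-X (row-≋ (P.zeroʳ X) (row-prev row-unit-suc))))))))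
      (P.+-congˡ (swap-X _ _))
      where
      shifted : Row (back² Θ) (suc M) (X ⊛ (X ⊛ ((q̂ ^ 3 ⊛ Q^ M) ⊛ ((q̂ ^ 3 ⊛ Q^ M) ⊛ K (suc M)))))
      shifted = row-≋ (P.*-congˡ (P.*-congˡ (P.*-cong (Q^-suc M) (P.*-congʳ (Q^-suc M))))) row-back²

-- Right-hand side: even coefficients of g_N and the same recurrence in M.

module RightHandSide {c ℓ} (R : CommutativeRing c ℓ) (q : CommutativeRing.Carrier R) where
  open CommutativeRing R
  open PowerSeries R
  open Operators R
  open LeftHandSide R q hiding (τ)
  open GaussianSeries R Q
  private
    module P = CommutativeRing commutativeRing
    open module IP = Identities commutativeRing

  evens : Series → Series
  evens f k = f (k ℕ.* 2)

  evens-XX-⊛ : ∀ f → evens (X ⊛ (X ⊛ f)) ≋ X ⊛ evens f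
  evens-XX-⊛ f zero = trans (X-⊛-zero (X ⊛ f)) (sym (X-⊛-zero (evens f)))
  evens-XX-⊛ f (suc k) = trans (X-⊛-suc (X ⊛ f) (suc (k ℕ.* 2)))
    (trans (X-⊛-suc f (k ℕ.* 2)) (sym (X-⊛-suc (evens f) k)))

  evens-const-⊛ : ∀ a f → evens (const a ⊛ f) ≋ const a ⊛ evens f
  evens-const-⊛ a f k = trans (const-⊛ a f (k ℕ.* 2)) (sym (const-⊛ a (evens f) k))

  evens-X : evens X ≋ 𝟘
  evens-X zero = refl
  evens-X (suc k) = refl

  evens-1 : evens P.1# ≋ P.1#
  evens-1 zero = refl
  evens-1 (suc k) = refl

  q² q⁶ : Carrier
  q² = pow R q 2
  q⁶ = pow R q 6

  W : ℕ → Series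
  W n = const (pow R q⁶ n)

  W-Q^ : ∀ n → W n ≋ Q^ n ⊛ Q^ n
  W-Q^ n = P.trans (const-cong (trans (pow-cong n q⁶≈Q*Q) (pow-* Q Q n))) (const-* _ _)
    where
    open IntegerCoefficientSolver R
    q⁶≈Q*Q : q⁶ ≈ Q * Q
    q⁶≈Q*Q = solve 1 (λ q → q :* (q :* (q :* (q :* (q :* (q :* con (ℤ.+ 1))))))
      := q :* (q :* (q :* con (ℤ.+ 1))) :* (q :* (q :* (q :* con (ℤ.+ 1))))) refl q

  δ⁶ : Series → Series
  δ⁶ = dil q⁶

  -- `weight q² q⁶ k` is q^(3k² - k).
  T : Series → Series
  T f = twist q² q⁶ (evens f)

  -- A record for the same reason as Row.
  infix 4 _⟼_
  record _⟼_ (f f′ : Series) : Set ℓ where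
    constructor transform
    field T-≋ : T f ≋ f′
  open _⟼_

  ⟼-refl : ∀ {f} → f ⟼ T f
  ⟼-refl = transform P.refl

  ⟼-cong : ∀ {f g f′ g′} → f ≋ g → g ⟼ g′ → g′ ≋ f′ → f ⟼ f′
  ⟼-cong f≋g (transform p) g′≋f′ =
    transform (P.trans (twist-cong q² q⁶ (λ k → f≋g (k ℕ.* 2))) (P.trans p g′≋f′))

  infixl 6 _⟼-⊕_
  _⟼-⊕_ : ∀ {f g f′ g′} → f ⟼ f′ → g ⟼ g′ → f ⊕ g ⟼ f′ ⊕ g′
  transform p ⟼-⊕ transform r = transform (P.trans (twist-⊕ q² q⁶ _ _) (P.+-cong p r))

  ⟼-neg : ∀ {f f′} → f ⟼ f′ → P.- f ⟼ P.- f′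
  ⟼-neg (transform p) = transform (P.trans (twist-neg q² q⁶ _) (P.-‿cong p))

  ⟼-const-⊛ : ∀ a {f f′} → f ⟼ f′ → const a ⊛ f ⟼ const a ⊛ f′
  ⟼-const-⊛ a (transform p) = transform
    (P.trans (twist-cong q² q⁶ (evens-const-⊛ a _)) (P.trans (twist-const-⊛ q² q⁶ a _) (P.*-congˡ p)))

  ⟼-^-⊛ : ∀ k {f f′} → f ⟼ f′ → q̂ ^ k ⊛ f ⟼ q̂ ^ k ⊛ f′
  ⟼-^-⊛ k p = ⟼-cong (P.*-congʳ (P.sym (const-pow q k))) (⟼-const-⊛ _ p) (P.*-congʳ (const-pow q k))

  ⟼-XX : ∀ {f f′} → f ⟼ f′ → X ⊛ (X ⊛ f) ⟼ q̂ ^ 2 ⊛ (X ⊛ δ⁶ f′)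
  ⟼-XX (transform p) = transform (P.trans (twist-cong q² q⁶ (evens-XX-⊛ _)) (P.trans (twist-X-⊛ q² q⁶ _)
    (P.*-cong (const-pow q 2) (P.*-congˡ (dil-cong q⁶ p)))))

  ⟼-1 : P.1# ⟼ P.1#
  ⟼-1 = transform (P.trans (twist-cong q² q⁶ evens-1) (twist-const q² q⁶ 1#))

  ⟼-X : X ⟼ 𝟘
  ⟼-X = transform (P.trans (twist-cong q² q⁶ evens-X) (λ k → zeroʳ _))

  -- The two factors contribute q^(6n) and q^(6k), which on the diagonal n + k = M combine to the
  -- constant `W M`.
  ϑ : Sequence → Sequence
  ϑ g n = W n ⊛ δ⁶ (g n)

  -- The series g_N in the opening comment.
  product : ℕ → Series
  product n = gauss n ⊛ dil q (gauss n)

  β : Sequence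
  β n = T (product n)

  gauss-step : ∀ n → gauss (suc n) ≋ gauss n ⊕ (q̂ ^ 3 ⊛ Q^ n) ⊛ (X ⊛ gauss (suc n))
  gauss-step n = P.trans (gauss-suc n) (P.+-congˡ (P.*-congʳ (Q^-suc n)))

  gauss-step′ : ∀ n → dil q (gauss (suc n)) ≋
    dil q (gauss n) ⊕ (q̂ ^ 3 ⊛ Q^ n) ⊛ (q̂ ⊛ (X ⊛ dil q (gauss (suc n))))
  gauss-step′ n = P.trans (dil-cong q (gauss-suc n)) (P.trans (dil-⊕ q _ _) (P.+-congˡ
    (P.trans (dil-const-⊛ q _ _) (P.*-cong (Q^-suc n) (dil-X-⊛ q _)))))

  unit-factor : ∀ f → f ≋ const 1# ⊛ f
  unit-factor f = P.sym (P.*-identityˡ f)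

  product-zero : P.1# ≋ (P.1# P.- Q^ 0 ⊛ X) ⊛ (P.1# P.- q̂ ⊛ (Q^ 0 ⊛ X)) ⊛ product 0
  product-zero = P.trans (P.sym (P.*-identityˡ P.1#)) (product-step
    (P.trans gauss-zero (P.+-congˡ (unit-factor _)))
    (P.trans (dil-cong q gauss-zero) (P.trans (dil-⊕ q _ _) (P.+-cong (dil-const q 1#)
      (P.trans (dil-X-⊛ q _) (unit-factor _))))))

  product-suc : ∀ n → product n ≋
    (P.1# P.- (q̂ ^ 3 ⊛ Q^ n) ⊛ X) ⊛ (P.1# P.- q̂ ⊛ ((q̂ ^ 3 ⊛ Q^ n) ⊛ X)) ⊛ product (suc n)
  product-suc n = product-step (gauss-step n) (gauss-step′ n)

  W-suc′ : ∀ n → (q̂ ^ 3 ⊛ Q^ n) ⊛ (q̂ ^ 3 ⊛ Q^ n) ≋ W (suc n)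
  W-suc′ n = P.sym (P.trans (W-Q^ (suc n)) (P.*-cong (Q^-suc n) (Q^-suc n)))

  ⟼-W-XX : ∀ n {f f′} → f ⟼ f′ → W n ⊛ (X ⊛ (X ⊛ f)) ⟼ q̂ ^ 2 ⊛ (X ⊛ (W n ⊛ δ⁶ f′))
  ⟼-W-XX n p = ⟼-cong P.refl (⟼-const-⊛ _ (⟼-XX p)) (move-inside (q̂ ^ 2) X (W n) _)

  own₁ : ∀ n → W n ⊛ (X ⊛ (X ⊛ product n)) ⟼ q̂ ^ 2 ⊛ (X ⊛ ϑ β n)
  own₁ n = ⟼-W-XX n ⟼-refl

  own₂ : ∀ n → q̂ ^ 2 ⊛ (W n ⊛ (X ⊛ (X ⊛ product n))) ⟼ q̂ ^ 4 ⊛ (X ⊛ ϑ β n)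
  own₂ n = ⟼-cong P.refl (⟼-^-⊛ 2 (own₁ n)) (collect-2-2 q̂ _)

  -- The nesting matters: after `diag` the inner weight refers to a smaller M than the outer one.
  own₃ : ∀ n → q̂ ^ 2 ⊛ (W n ⊛ (W n ⊛ (X ⊛ (X ⊛ (X ⊛ (X ⊛ product n)))))) ⟼
    q̂ ^ 6 ⊛ (X ⊛ ϑ (λ m → X ⊛ ϑ β m) n)
  own₃ n = ⟼-cong (P.*-congˡ (P.*-congˡ (move-inside X X (W n) _)))
    (⟼-^-⊛ 2 (⟼-W-XX n (own₁ n)))
    (P.trans (P.*-congˡ (P.*-congˡ (P.*-congˡ (P.*-congˡ (dil-^-⊛ q⁶ q 2 _))))) (collect-2-2-2 q̂ X (W n) _))

  next : ∀ k n → q̂ ^ k ⊛ (W n ⊛ (X ⊛ (X ⊛ product n))) ⟼ q̂ ^ k ⊛ (q̂ ^ 2 ⊛ (X ⊛ ϑ β n))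
  next k n = ⟼-^-⊛ k (own₁ n)

  next₄ : ∀ n → q̂ ^ 4 ⊛ (W n ⊛ (X ⊛ (X ⊛ product n))) ⟼ q̂ ^ 6 ⊛ (X ⊛ ϑ β n)
  next₄ n = ⟼-cong P.refl (next 4 n) (collect-4-2 q̂ _)

  next₇ : ∀ n → q̂ ^ 7 ⊛ (W n ⊛ (X ⊛ (X ⊛ product n))) ⟼ q̂ ^ 9 ⊛ (X ⊛ ϑ β n)
  next₇ n = ⟼-cong P.refl (next 7 n) (collect-7-2 q̂ _)

  -- `g₀` is the product preceding `product n`, which for n = 0 is the empty product 1; `W′` is Q^n
  -- in the form in which the factorisation of `g₀` provides it.
  even-recurrence-at : ∀ {g₀} n {W′} → g₀ ≋ (P.1# P.- W′ ⊛ X) ⊛ (P.1# P.- q̂ ⊛ (W′ ⊛ X)) ⊛ product n →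
    W′ ⊛ W′ ≋ W n → q̂ ^ 3 ⊛ W′ ≋ q̂ ^ 3 ⊛ Q^ n →
    product (suc n) ≋ product n ⊕ q̂ ^ 3 ⊛ product n P.- q̂ ^ 3 ⊛ g₀
      ⊕ W (suc n) ⊛ (X ⊛ (X ⊛ product (suc n))) ⊕ q̂ ^ 2 ⊛ (W (suc n) ⊛ (X ⊛ (X ⊛ product (suc n))))
      P.- q̂ ^ 2 ⊛ (W (suc n) ⊛ (W (suc n) ⊛ (X ⊛ (X ⊛ (X ⊛ (X ⊛ product (suc n)))))))
      ⊕ q̂ ^ 4 ⊛ (W n ⊛ (X ⊛ (X ⊛ product n))) ⊕ q̂ ^ 7 ⊛ (W n ⊛ (X ⊛ (X ⊛ product n)))
  even-recurrence-at {g₀} n {W′} h₀ w w′ = P.trans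
    (even-recurrence {q̂} {X} {W′} h₀ (P.trans (product-suc n)
      (P.*-congʳ (P.*-cong (P.+-congˡ (P.-‿cong (P.*-congʳ (P.sym w′))))
        (P.+-congˡ (P.-‿cong (P.*-congˡ (P.*-congʳ (P.sym w′)))))))))
    (P.+-cong (P.+-cong (P.+-cong (P.+-cong (P.+-cong P.refl (P.*-congʳ v)) (P.*-congˡ (P.*-congʳ v)))
      (P.-‿cong (P.*-congˡ (P.*-cong v (P.*-congʳ v)))))
      (P.*-congˡ (P.*-congʳ w))) (P.*-congˡ (P.*-congʳ w)))
    where
    v : (q̂ ^ 3 ⊛ W′) ⊛ (q̂ ^ 3 ⊛ W′) ≋ W (suc n)
    v = P.trans (P.*-cong w′ w′) (W-suc′ n)

  -- The `unit` terms are boundary values: 1 + q³X is the image of (1 + u)(1 + qu) at index 0, and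
  -- -q³ at index 1 stems from the empty product preceding `product 0`.
  β-rec : ∀ n → β n ≋ prev β n ⊕ q̂ ^ 3 ⊛ prev β n P.- q̂ ^ 3 ⊛ prev (prev β) n
    ⊕ q̂ ^ 2 ⊛ (X ⊛ ϑ β n) ⊕ q̂ ^ 4 ⊛ (X ⊛ ϑ β n) P.- q̂ ^ 6 ⊛ (X ⊛ ϑ (λ m → X ⊛ ϑ β m) n)
    ⊕ q̂ ^ 6 ⊛ (X ⊛ prev (ϑ β) n) ⊕ q̂ ^ 9 ⊛ (X ⊛ prev (ϑ β) n)
    ⊕ (unit n ⊕ q̂ ^ 3 ⊛ (X ⊛ unit n) P.- q̂ ^ 3 ⊛ prev unit n)
  β-rec zero = pad-0 {q̂} {X} (T-≋ (⟼-cong (even-initial product-zero)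
    (⟼-1 ⟼-⊕ ⟼-X ⟼-⊕ ⟼-const-⊛ q ⟼-X ⟼-⊕ ⟼-const-⊛ q (⟼-XX ⟼-1)
      ⟼-⊕ (own₁ 0 ⟼-⊕ own₂ 0 ⟼-⊕ ⟼-neg (own₃ 0)))
    (P.+-congʳ (P.+-congˡ (P.trans (P.*-congˡ (P.*-congˡ (P.*-congˡ (dil-const q⁶ 1#)))) (collect-1-2 q̂ _))))))
  β-rec (suc zero) = pad-1 {q̂} {X} (T-≋ (⟼-cong (even-recurrence-at 0 product-zero (P.*-identityˡ _) P.refl)
    (⟼-refl ⟼-⊕ ⟼-^-⊛ 3 ⟼-refl ⟼-⊕ ⟼-neg (⟼-^-⊛ 3 ⟼-1)
      ⟼-⊕ own₁ 1 ⟼-⊕ own₂ 1 ⟼-⊕ ⟼-neg (own₃ 1) ⟼-⊕ next₄ 0 ⟼-⊕ next₇ 0)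
    P.refl))
  β-rec (suc (suc n)) = pad-2 {q̂} {X} (T-≋ (⟼-cong
    (even-recurrence-at (suc n) (product-suc n) (W-suc′ n) (P.*-congˡ (P.sym (Q^-suc n))))
    (⟼-refl ⟼-⊕ ⟼-^-⊛ 3 ⟼-refl ⟼-⊕ ⟼-neg (⟼-^-⊛ 3 ⟼-refl)
      ⟼-⊕ own₁ (2 ℕ.+ n) ⟼-⊕ own₂ (2 ℕ.+ n) ⟼-⊕ ⟼-neg (own₃ (2 ℕ.+ n)) ⟼-⊕ next₄ (suc n) ⟼-⊕ next₇ (suc n))
    P.refl))

  ε : Sequence
  ε = diag β

  weighted : Sequence → Sequence
  weighted g M = W M ⊛ g M

  diag-ϑ-lift : ∀ {f f′} → diag f ≣ f′ → diag (ϑ f) ≣ weighted f′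
  diag-ϑ-lift p M = P.trans (diag-dil-pow q⁶ _ M) (P.*-congˡ (p M))

  diag-refl : ∀ {f} → diag f ≣ diag f
  diag-refl M = P.refl

  -- Since each X carries a shift, the terms of `β-rec` at index n itself now refer to smaller M: an
  -- implicit relation becomes an explicit recursion.
  ε-rec : ∀ M → ε M ≋ prev ε M ⊕ q̂ ^ 3 ⊛ prev ε M P.- q̂ ^ 3 ⊛ prev (prev ε) M
    ⊕ q̂ ^ 2 ⊛ (X ⊛ prev (weighted ε) M) ⊕ q̂ ^ 4 ⊛ (X ⊛ prev (weighted ε) M)
    P.- q̂ ^ 6 ⊛ (X ⊛ prev (weighted (λ m → X ⊛ prev (weighted ε) m)) M)
    ⊕ q̂ ^ 6 ⊛ (X ⊛ prev (prev (weighted ε)) M) ⊕ q̂ ^ 9 ⊛ (X ⊛ prev (prev (weighted ε)) M)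
    ⊕ (unit M ⊕ q̂ ^ 3 ⊛ (X ⊛ prev unit M) P.- q̂ ^ 3 ⊛ prev unit M)
  ε-rec M = P.trans (diag-cong β-rec M) (diag-lift (diag-lift (diag-lift (diag-lift (diag-lift (diag-lift
    (diag-lift (diag-lift
      (diag-prev-lift (diag-refl {β}))
      (diag-scale-lift 3 (diag-prev-lift (diag-refl {β}))))
      (diag-neg-lift (diag-scale-lift 3 (diag-prev-lift (diag-prev-lift (diag-refl {β}))))))
      (diag-scale-lift 2 (diag-X-lift ϑβ)))
      (diag-scale-lift 4 (diag-X-lift ϑβ)))
      (diag-neg-lift (diag-scale-lift 6 (diag-X-lift (diag-ϑ-lift (diag-X-lift ϑβ))))))
      (diag-scale-lift 6 (diag-X-lift (diag-prev-lift ϑβ))))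
      (diag-scale-lift 9 (diag-X-lift (diag-prev-lift ϑβ))))
    (diag-lift (diag-lift diag-unit (diag-scale-lift 3 (diag-X-lift diag-unit)))
      (diag-neg-lift (diag-scale-lift 3 (diag-prev-lift diag-unit)))) M)
    where
    ϑβ : diag (ϑ β) ≣ weighted ε
    ϑβ = diag-ϑ-lift (diag-refl {β})

  ε-zero : ε 0 ≋ P.1#
  ε-zero = unpad-0 {q̂} {X} (ε-rec 0)

  ε-one : ε 1 ≋ ε 0 ⊕ q̂ ^ 3 ⊛ ε 0 ⊕ q̂ ^ 2 ⊛ (X ⊛ (W 0 ⊛ ε 0)) ⊕ q̂ ^ 4 ⊛ (X ⊛ (W 0 ⊛ ε 0))
    ⊕ q̂ ^ 3 ⊛ (X ⊛ P.1#) P.- q̂ ^ 3 ⊛ P.1#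
  ε-one = unpad-1 {q̂} {X} (ε-rec 1)

  ε-suc-suc : ∀ M → ε (2 ℕ.+ M) ≋ ε (1 ℕ.+ M) ⊕ q̂ ^ 3 ⊛ ε (1 ℕ.+ M) P.- q̂ ^ 3 ⊛ ε M
    ⊕ q̂ ^ 2 ⊛ (X ⊛ (W (1 ℕ.+ M) ⊛ ε (1 ℕ.+ M))) ⊕ q̂ ^ 4 ⊛ (X ⊛ (W (1 ℕ.+ M) ⊛ ε (1 ℕ.+ M)))
    P.- q̂ ^ 6 ⊛ (X ⊛ (W (1 ℕ.+ M) ⊛ (X ⊛ (W M ⊛ ε M))))
    ⊕ q̂ ^ 6 ⊛ (X ⊛ (W M ⊛ ε M)) ⊕ q̂ ^ 9 ⊛ (X ⊛ (W M ⊛ ε M))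
  ε-suc-suc M = unpad-2 {q̂} {X} (ε-rec (2 ℕ.+ M))

  E : Sequence
  E M = spread (ε M)

  spread-const-⊛ : ∀ a f → spread (const a ⊛ f) ≋ const a ⊛ spread f
  spread-const-⊛ a f = P.trans (spread-⊛ (const a) f) (P.*-congʳ (spread-const a))

  infixl 6 _spread-lift-⊕_
  _spread-lift-⊕_ : ∀ {f g f′ g′} → spread f ≋ f′ → spread g ≋ g′ → spread (f ⊕ g) ≋ f′ ⊕ g′
  p spread-lift-⊕ r = P.trans (spread-⊕ _ _) (P.+-cong p r)

  spread-lift-neg : ∀ {f f′} → spread f ≋ f′ → spread (P.- f) ≋ P.- f′
  spread-lift-neg p = P.trans (spread-neg _) (P.-‿cong p)

  spread-lift-^ : ∀ k {f f′} → spread f ≋ f′ → spread (q̂ ^ k ⊛ f) ≋ q̂ ^ k ⊛ f′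
  spread-lift-^ k p = P.trans (Commutes-const-^.commutes spread spread-cong spread-const-⊛ q k _) (P.*-congˡ p)

  spread-lift-X : ∀ {f f′} → spread f ≋ f′ → spread (X ⊛ f) ≋ X ⊛ (X ⊛ f′)
  spread-lift-X p = P.trans (spread-⊛ X _) (P.trans (P.*-cong spread-X p) (P.*-assoc _ _ _))

  spread-lift-W : ∀ n {f f′} → spread f ≋ f′ → spread (W n ⊛ f) ≋ W n ⊛ f′
  spread-lift-W n p = P.trans (spread-const-⊛ _ _) (P.*-congˡ p)

  E-zero : E 0 ≋ P.1#
  E-zero = P.trans (spread-cong ε-zero) (spread-const 1#)

  E-one : E 1 ≋ E 0 ⊕ q̂ ^ 3 ⊛ E 0 ⊕ q̂ ^ 2 ⊛ (X ⊛ (X ⊛ E 0)) ⊕ q̂ ^ 4 ⊛ (X ⊛ (X ⊛ E 0))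
    ⊕ q̂ ^ 3 ⊛ (X ⊛ (X ⊛ P.1#)) P.- q̂ ^ 3 ⊛ P.1#
  E-one = P.trans (spread-cong ε-one)
    (P.refl spread-lift-⊕ spread-lift-^ 3 P.refl
      spread-lift-⊕ spread-lift-^ 2 (spread-lift-X W₀)
      spread-lift-⊕ spread-lift-^ 4 (spread-lift-X W₀)
      spread-lift-⊕ spread-lift-^ 3 (spread-lift-X (spread-const 1#))
      spread-lift-⊕ spread-lift-neg (spread-lift-^ 3 (spread-const 1#)))
    where
    W₀ : spread (W 0 ⊛ ε 0) ≋ E 0
    W₀ = spread-cong (P.*-identityˡ (ε 0))

  E-suc-suc : ∀ M → E (2 ℕ.+ M) ≋ E (1 ℕ.+ M) ⊕ q̂ ^ 3 ⊛ E (1 ℕ.+ M) P.- q̂ ^ 3 ⊛ E M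
    ⊕ q̂ ^ 2 ⊛ (X ⊛ (X ⊛ (W (1 ℕ.+ M) ⊛ E (1 ℕ.+ M)))) ⊕ q̂ ^ 4 ⊛ (X ⊛ (X ⊛ (W (1 ℕ.+ M) ⊛ E (1 ℕ.+ M))))
    P.- q̂ ^ 6 ⊛ (X ⊛ (X ⊛ (W (1 ℕ.+ M) ⊛ (X ⊛ (X ⊛ (W M ⊛ E M))))))
    ⊕ q̂ ^ 6 ⊛ (X ⊛ (X ⊛ (W M ⊛ E M))) ⊕ q̂ ^ 9 ⊛ (X ⊛ (X ⊛ (W M ⊛ E M)))
  E-suc-suc M = P.trans (spread-cong (ε-suc-suc M))
    (P.refl spread-lift-⊕ spread-lift-^ 3 P.refl
      spread-lift-⊕ spread-lift-neg (spread-lift-^ 3 P.refl)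
      spread-lift-⊕ spread-lift-^ 2 (spread-lift-X (spread-lift-W (1 ℕ.+ M) P.refl))
      spread-lift-⊕ spread-lift-^ 4 (spread-lift-X (spread-lift-W (1 ℕ.+ M) P.refl))
      spread-lift-⊕ spread-lift-neg (spread-lift-^ 6 (spread-lift-X (spread-lift-W (1 ℕ.+ M) (spread-lift-X (spread-lift-W M P.refl)))))
      spread-lift-⊕ spread-lift-^ 6 (spread-lift-X (spread-lift-W M P.refl))
      spread-lift-⊕ spread-lift-^ 9 (spread-lift-X (spread-lift-W M P.refl)))

  K′ : Sequence
  K′ M = gauss M ⊛ E M

  K′-recurrence : Recurrence K′
  K′-recurrence = record
    { at-0 = P.trans (P.*-congˡ E-zero) (P.trans (P.*-identityʳ _) (P.trans gauss-zero (P.+-congˡ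
        (P.trans (P.*-congˡ (P.sym (P.trans (P.*-congˡ E-zero) (P.*-identityʳ _)))) (unit-factor _)))))
    ; at-1 = convolved-recurrence-1 gauss-zero (gauss-suc 0) E-one
    ; at-2 = λ M → P.trans (convolved-recurrence-2 (gauss-step M)
        (P.trans (gauss-step (suc M)) (P.+-congˡ (P.*-congʳ (P.*-congˡ (Q^-suc M)))))
        (P.trans (E-suc-suc M) (W→Q^ M)))
        (P.+-congˡ (P.*-congʳ (P.trans (P.*-congˡ (P.sym (Q^-suc M))) (P.sym (Q^-suc (suc M))))))
    }
    where
    W₁ : ∀ M → W (1 ℕ.+ M) ≋ (q̂ ^ 3 ⊛ Q^ M) ⊛ (q̂ ^ 3 ⊛ Q^ M)
    W₁ M = P.sym (W-suc′ M)
    W→Q^ : ∀ M → E (1 ℕ.+ M) ⊕ q̂ ^ 3 ⊛ E (1 ℕ.+ M) P.- q̂ ^ 3 ⊛ E M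
      ⊕ q̂ ^ 2 ⊛ (X ⊛ (X ⊛ (W (1 ℕ.+ M) ⊛ E (1 ℕ.+ M)))) ⊕ q̂ ^ 4 ⊛ (X ⊛ (X ⊛ (W (1 ℕ.+ M) ⊛ E (1 ℕ.+ M))))
      P.- q̂ ^ 6 ⊛ (X ⊛ (X ⊛ (W (1 ℕ.+ M) ⊛ (X ⊛ (X ⊛ (W M ⊛ E M))))))
      ⊕ q̂ ^ 6 ⊛ (X ⊛ (X ⊛ (W M ⊛ E M))) ⊕ q̂ ^ 9 ⊛ (X ⊛ (X ⊛ (W M ⊛ E M))) ≋ _
    W→Q^ M = P.+-cong (P.+-cong (P.+-cong (P.+-cong (P.+-cong P.refl
      (P.*-congˡ (P.*-congˡ (P.*-congˡ (P.*-congʳ (W₁ M))))))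
      (P.*-congˡ (P.*-congˡ (P.*-congˡ (P.*-congʳ (W₁ M))))))
      (P.-‿cong (P.*-congˡ (P.*-congˡ (P.*-congˡ (P.*-cong (W₁ M) (P.*-congˡ (P.*-congˡ (P.*-congʳ (W-Q^ M))))))))))
      (P.*-congˡ (P.*-congˡ (P.*-congˡ (P.*-congʳ (W-Q^ M))))))
      (P.*-congˡ (P.*-congˡ (P.*-congˡ (P.*-congʳ (W-Q^ M)))))

  Θ-convolved : ∀ L M → Θ L M ≈ (gauss M ⊛ E M) L
  Θ-convolved L M = recurrence-unique K-recurrence K′-recurrence M L

-- Finite sums and q-binomials with integer entries.

parity : ∀ d → (∃ λ r → d ≡ r ℕ.* 2) ⊎ (∃ λ r → d ≡ suc (r ℕ.* 2))
parity zero = inj₁ (0 , ≡.refl)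
parity (suc d) with parity d
... | inj₁ (r , d≡) = inj₂ (r , ≡.cong suc d≡)
... | inj₂ (r , d≡) = inj₁ (suc r , ≡.cong suc d≡)

≤-split : ∀ m n → (∃ λ d → n ≡ m ℕ.+ d) ⊎ (∃ λ d → m ≡ suc (n ℕ.+ d))
≤-split m n with ℕ.≤-<-connex m n
... | inj₁ m≤n = inj₁ (n ∸ m , ≡.sym (ℕ.m+[n∸m]≡n m≤n))
... | inj₂ n<m = inj₂ (m ∸ suc n , ≡.sym (ℕ.m+[n∸m]≡n n<m))

module Sums {c ℓ} (R : CommutativeRing c ℓ) where
  open CommutativeRing R
  open PowerSeries R
  open SetoidReasoning setoid
  open import Algebra.Properties.CommutativeSemigroup +-commutativeSemigroup using (interchange)

  ∑ : ℕ → (ℕ → Carrier) → Carrier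
  ∑ = ∑< R

  ∑-cong< : ∀ N {f g : ℕ → Carrier} → (∀ i → i ℕ.< N → f i ≈ g i) → ∑ N f ≈ ∑ N g
  ∑-cong< zero f≈g = refl
  ∑-cong< (suc N) f≈g = +-cong (∑-cong< N (λ i i<N → f≈g i (ℕ.m<n⇒m<1+n i<N))) (f≈g N (ℕ.n<1+n N))

  ∑-cong : ∀ N {f g : ℕ → Carrier} → (∀ i → f i ≈ g i) → ∑ N f ≈ ∑ N g
  ∑-cong N f≈g = ∑-cong< N (λ i _ → f≈g i)

  ∑-0# : ∀ N → ∑ N (λ _ → 0#) ≈ 0#
  ∑-0# zero = refl
  ∑-0# (suc N) = trans (+-identityʳ _) (∑-0# N)

  ∑-vanish : ∀ N {f : ℕ → Carrier} → (∀ i → i ℕ.< N → f i ≈ 0#) → ∑ N f ≈ 0#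
  ∑-vanish N f≈0 = trans (∑-cong< N f≈0) (∑-0# N)

  ∑-+ : ∀ N f g → ∑ N (λ i → f i + g i) ≈ ∑ N f + ∑ N g
  ∑-+ zero f g = sym (+-identityˡ 0#)
  ∑-+ (suc N) f g = trans (+-congʳ (∑-+ N f g)) (interchange _ _ _ _)

  ∑-*ˡ : ∀ a N f → ∑ N (λ i → a * f i) ≈ a * ∑ N f
  ∑-*ˡ a zero f = sym (zeroʳ a)
  ∑-*ˡ a (suc N) f = trans (+-congʳ (∑-*ˡ a N f)) (sym (distribˡ _ _ _))

  ∑-swap : ∀ M N (f : ℕ → ℕ → Carrier) → ∑ M (λ i → ∑ N (f i)) ≈ ∑ N (λ j → ∑ M (λ i → f i j))
  ∑-swap zero N f = sym (∑-0# N)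
  ∑-swap (suc M) N f = trans (+-congʳ (∑-swap M N f)) (sym (∑-+ N _ _))

  ∑-split : ∀ m n f → ∑ (m ℕ.+ n) f ≈ ∑ m f + ∑ n (λ i → f (m ℕ.+ i))
  ∑-split m zero f = trans (reflexive (≡.cong (λ k → ∑ k f) (ℕ.+-identityʳ m))) (sym (+-identityʳ _))
  ∑-split m (suc n) f = begin
    ∑ (m ℕ.+ suc n) f                                        ≡⟨ ≡.cong (λ k → ∑ k f) (ℕ.+-suc m n) ⟩
    ∑ (m ℕ.+ n) f + f (m ℕ.+ n)                              ≈⟨ +-congʳ (∑-split m n f) ⟩
    ∑ m f + ∑ n (λ i → f (m ℕ.+ i)) + f (m ℕ.+ n)            ≈⟨ +-assoc _ _ _ ⟩
    ∑ m f + (∑ n (λ i → f (m ℕ.+ i)) + f (m ℕ.+ n))          ∎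

  ∑-dropʳ : ∀ m n {f : ℕ → Carrier} → (∀ i → f (m ℕ.+ i) ≈ 0#) → ∑ (m ℕ.+ n) f ≈ ∑ m f
  ∑-dropʳ m n f≈0 = trans (∑-split m n _) (trans (+-congˡ (∑-vanish n (λ i _ → f≈0 i))) (+-identityʳ _))

  ∑-dropˡ : ∀ m n {f : ℕ → Carrier} → (∀ i → i ℕ.< m → f i ≈ 0#) → ∑ (m ℕ.+ n) f ≈ ∑ n (λ i → f (m ℕ.+ i))
  ∑-dropˡ m n f≈0 = trans (∑-split m n _) (trans (+-congʳ (∑-vanish m f≈0)) (+-identityˡ _))

  ⊛-∑ : ∀ f g n → (f ⊛ g) n ≈ ∑ (suc n) (λ i → f i * g (n ∸ i))
  ⊛-∑ f g zero = sym (+-identityˡ _)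
  ⊛-∑ f g (suc n) = begin
    f 0 * g (suc n) + (tail f ⊛ g) n
      ≈⟨ +-cong (sym (+-identityˡ _)) (⊛-∑ (tail f) g n) ⟩
    (0# + f 0 * g (suc n)) + ∑ (suc n) (λ i → f (suc i) * g (n ∸ i))
      ≈⟨ ∑-split 1 (suc n) (λ i → f i * g (suc n ∸ i)) ⟨
    ∑ (suc (suc n)) (λ i → f i * g (suc n ∸ i))
      ∎

module IntegerGaussian {c ℓ} (R : CommutativeRing c ℓ) (b : CommutativeRing.Carrier R) where
  open CommutativeRing R
  open GaussianSeries R b
  open ℤ-Solver.+-*-Solver

  -- `qbinZ` branches on `B` and `A - B`; taking both values as equations lets the integer solver
  -- supply them for symbolic entries.
  qbinZ-pos : ∀ A B k d → B ≡ + k → A ℤ.- B ≡ + d → qbinZ R b A B ≈ qbin R b (k ℕ.+ d) k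
  qbinZ-pos A .(+ k) k d ≡.refl eq with A ℤ.- + k | eq
  ... | .(+ d) | ≡.refl = refl

  qbinZ-above : ∀ A B d → A ℤ.- B ≡ -[1+ d ] → qbinZ R b A B ≈ 0#
  qbinZ-above A (+ k) d eq with A ℤ.- + k | eq
  ... | .(-[1+ d ]) | ≡.refl = refl
  qbinZ-above A -[1+ k ] d eq = refl

  qbinZ-below : ∀ A B k → B ≡ -[1+ k ] → qbinZ R b A B ≈ 0#
  qbinZ-below A .(-[1+ k ]) k ≡.refl = refl

  qbinZ-ℕ : ∀ n k → qbinZ R b (+ n) (+ k) ≈ qbin R b n k
  qbinZ-ℕ n k with ≤-split k n
  ... | inj₁ (d , ≡.refl) = qbinZ-pos (+ (k ℕ.+ d)) (+ k) k d ≡.refl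
    (solve 2 (λ k d → k :+ d :- k := d) ≡.refl (+ k) (+ d))
  ... | inj₂ (d , ≡.refl) = trans (qbinZ-above (+ n) (+ suc (n ℕ.+ d)) d
    (solve 2 (λ n d → n :- (con (+ 1) :+ (n :+ d)) := :- (con (+ 1) :+ d)) ≡.refl (+ n) (+ d)))
    (sym (qbin-> n d))

-- The left-hand sum as a coefficient of Θ.

module LeftSum {c ℓ} (R : CommutativeRing c ℓ) (q : CommutativeRing.Carrier R) where
  open CommutativeRing R
  open PowerSeries R
  open Operators R
  open LeftHandSide R q
  open GaussianSeries R Q
  open Sums R
  private
    module Gq = IntegerGaussian R q
    module GQ = IntegerGaussian R Q
  open SetoidReasoning setoid

  if-0# : ∀ b {x} → x ≈ 0# → (if b then x else 0#) ≈ 0#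
  if-0# true x≈0 = x≈0
  if-0# false x≈0 = refl

  module _ (L M : ℕ) where
    factor₁ᴸ factor₂ᴸ factor₃ᴸ : ℕ → ℕ → Carrier
    factor₁ᴸ i m = qbinZ R Q (+ L ℤ.+ + M ℤ.- + i) (+ L)
    factor₂ᴸ i m = qbinZ R q (+ 3 ℤ.* (+ L ℤ.- + i)) (+ m)
    factor₃ᴸ i m = qbinZ R Q (+ 2 ℤ.* (+ L ℤ.- + i) ℤ.+ (+ ((i ℕ.+ m) / 2) ℤ.- + m)) (+ 2 ℤ.* (+ L ℤ.- + i))

    summand : ℕ → ℕ → Carrier
    summand i m = pow R q ((m ℕ.* m ℕ.+ 3 ℕ.* (i ℕ.* i)) / 2) * factor₁ᴸ i m * factor₂ᴸ i m * factor₃ᴸ i m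

    guarded : ℕ → ℕ → Carrier
    guarded i m = if ⌊ (i ℕ.+ m) % 2 ℕ.≟ 0 ⌋ then summand i m else 0#

    zero-factor₁ : ∀ {a b x y} → b ≈ 0# → a * b * x * y ≈ 0#
    zero-factor₁ b≈0 = trans (*-congʳ (trans (*-congʳ (trans (*-congˡ b≈0) (zeroʳ _))) (zeroˡ _))) (zeroˡ _)

    zero-factor₂ : ∀ {a b x y} → x ≈ 0# → a * b * x * y ≈ 0#
    zero-factor₂ x≈0 = trans (*-congʳ (trans (*-congˡ x≈0) (zeroʳ _))) (zeroˡ _)

    zero-factor₃ : ∀ {a b x y} → y ≈ 0# → a * b * x * y ≈ 0#
    zero-factor₃ y≈0 = trans (*-congˡ y≈0) (zeroʳ _)

    open ℤ-Solver.+-*-Solver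

    beyond-M : ∀ d m → guarded (suc M ℕ.+ d) m ≈ 0#
    beyond-M d m = if-0# ⌊ (suc M ℕ.+ d ℕ.+ m) % 2 ℕ.≟ 0 ⌋ (zero-factor₁ (GQ.qbinZ-above (+ L ℤ.+ + M ℤ.- + (suc M ℕ.+ d)) (+ L) d
      (solve 3 (λ L M d → L :+ M :- (con (+ 1) :+ M :+ d) :- L := :- (con (+ 1) :+ d)) ≡.refl (+ L) (+ M) (+ d))))

    beyond-L : ∀ d m → guarded (suc (L ℕ.+ d)) m ≈ 0#
    beyond-L d m = if-0# ⌊ (suc (L ℕ.+ d) ℕ.+ m) % 2 ℕ.≟ 0 ⌋ (zero-factor₂ (Gq.qbinZ-above (+ 3 ℤ.* (+ L ℤ.- + suc (L ℕ.+ d))) (+ m) (2 ℕ.+ (d ℕ.+ d ℕ.+ d ℕ.+ m))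
      (solve 3 (λ L d m → con (+ 3) :* (L :- (con (+ 1) :+ (L :+ d))) :- m := :- (con (+ 3) :+ (d :+ d :+ d :+ m)))
        ≡.refl (+ L) (+ d) (+ m))))

    -- For m > i the integer part of (i + m)/2 lies below m, whatever the parity, so the last
    -- q-binomial has its upper entry below its lower one.
    beyond-i : ∀ i d → guarded i (suc i ℕ.+ d) ≈ 0#
    beyond-i i d with ≤-split (suc i ℕ.+ d) ((i ℕ.+ (suc i ℕ.+ d)) / 2)
    ... | inj₂ (e , eq) = if-0# ⌊ (i ℕ.+ (suc i ℕ.+ d)) % 2 ℕ.≟ 0 ⌋ (zero-factor₃ (GQ.qbinZ-above (+ 2 ℤ.* (+ L ℤ.- + i) ℤ.+ (+ h ℤ.- + (suc i ℕ.+ d))) (+ 2 ℤ.* (+ L ℤ.- + i)) e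
      (≡.trans (≡.cong (λ m → + 2 ℤ.* (+ L ℤ.- + i) ℤ.+ (+ h ℤ.- + m) ℤ.- + 2 ℤ.* (+ L ℤ.- + i)) eq)
        (solve 3 (λ a h e → con (+ 2) :* a :+ (h :- (con (+ 1) :+ (h :+ e))) :- con (+ 2) :* a := :- (con (+ 1) :+ e))
          ≡.refl (+ L ℤ.- + i) (+ h) (+ e)))))
      where
      h : ℕ
      h = (i ℕ.+ (suc i ℕ.+ d)) / 2
    ... | inj₁ (e , eq) = ⊥-elim (ℕ.<-irrefl ≡.refl (ℕ.<-≤-trans
        (ℕ.m<n*o⇒m/o<n {i ℕ.+ (suc i ℕ.+ d)} {suc i ℕ.+ d} {2} small)
        (ℕ.≤-trans (ℕ.m≤m+n _ e) (ℕ.≤-reflexive (≡.sym eq)))))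
      where
      small : i ℕ.+ (suc i ℕ.+ d) ℕ.< (suc i ℕ.+ d) ℕ.* 2
      small = ℕ.≤-trans (ℕ.m≤m+n _ d) (ℕ.≤-reflexive (S.solve 2 (λ i d →
        (S.con 1 S.:+ (i S.:+ (S.con 1 S.:+ (i S.:+ d)))) S.:+ d S.:= (S.con 1 S.:+ (i S.:+ d)) S.:* S.con 2) ≡.refl i d))
        where module S = ℕ-Solver.+-*-Solver

    module _ (i l u : ℕ) (L≡ : L ≡ i ℕ.+ l) (M≡ : M ≡ i ℕ.+ u) where
      L-i : + L ℤ.- + i ≡ + l
      L-i = ≡.trans (≡.cong (λ k → + k ℤ.- + i) L≡) (solve 2 (λ i l → i :+ l :- i := l) ≡.refl (+ i) (+ l))

      factor₁-within : ∀ m → factor₁ᴸ i m ≈ gauss L u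
      factor₁-within m = GQ.qbinZ-pos (+ L ℤ.+ + M ℤ.- + i) (+ L) L u ≡.refl
        (≡.trans (≡.cong (λ k → + L ℤ.+ + k ℤ.- + i ℤ.- + L) M≡)
          (solve 3 (λ L i u → L :+ (i :+ u) :- i :- L := u) ≡.refl (+ L) (+ i) (+ u)))

      factor₂-within : ∀ m → factor₂ᴸ i m ≈ qbin R q (l ℕ.* 3) m
      factor₂-within m = trans
        (reflexive (≡.cong (λ z → qbinZ R q z (+ m)) (≡.trans (≡.cong (+ 3 ℤ.*_) L-i)
          (≡.trans (≡.sym (ℤ.pos-* 3 l)) (≡.cong +_ (ℕ.*-comm 3 l))))))
        (Gq.qbinZ-ℕ (l ℕ.* 3) m)

      factor₃-within : ∀ m r → (i ℕ.+ m) / 2 ≡ m ℕ.+ r → factor₃ᴸ i m ≈ gauss (l ℕ.* 2) r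
      factor₃-within m r half = GQ.qbinZ-pos (+ 2 ℤ.* (+ L ℤ.- + i) ℤ.+ (+ ((i ℕ.+ m) / 2) ℤ.- + m))
        (+ 2 ℤ.* (+ L ℤ.- + i)) (l ℕ.* 2) r
        (≡.trans (≡.cong (+ 2 ℤ.*_) L-i) (≡.trans (≡.sym (ℤ.pos-* 2 l)) (≡.cong +_ (ℕ.*-comm 2 l))))
        (≡.trans (≡.cong (λ h → + 2 ℤ.* (+ L ℤ.- + i) ℤ.+ (+ h ℤ.- + m) ℤ.- + 2 ℤ.* (+ L ℤ.- + i)) half)
          (solve 3 (λ a m r → con (+ 2) :* a :+ (m :+ r :- m) :- con (+ 2) :* a := r) ≡.refl (+ L ℤ.- + i) (+ m) (+ r)))

      -- For i = m + 2r, (m² + 3i²)/2 = (3i² - i)/2 + m(m + 1)/2 + r.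
      exponent : ∀ m r → i ≡ m ℕ.+ r ℕ.* 2 →
        pow R q ((m ℕ.* m ℕ.+ 3 ℕ.* (i ℕ.* i)) / 2) ≈ weight q Q i * (weight q q m * pow R q r)
      exponent m r i≡ = begin
        pow R q ((m ℕ.* m ℕ.+ 3 ℕ.* (i ℕ.* i)) / 2)
          ≡⟨ ≡.cong (pow R q) (≡.trans (≡.cong (_/ 2) doubled) (ℕ.m*n/n≡m (e₁ ℕ.+ (e₂ ℕ.+ r)) 2)) ⟩
        pow R q (e₁ ℕ.+ (e₂ ℕ.+ r))
          ≈⟨ trans (pow-+ q e₁ _) (*-congˡ (pow-+ q e₂ r)) ⟩
        pow R q e₁ * (pow R q e₂ * pow R q r)
          ≈⟨ *-cong (weight-pow q 1 3 (sym (*-identityʳ q)) refl i)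
               (*-congʳ (weight-pow q 1 1 (sym (*-identityʳ q)) (sym (*-identityʳ q)) m)) ⟨
        weight q Q i * (weight q q m * pow R q r)
          ∎
        where
        e₁ e₂ : ℕ
        e₁ = 1 ℕ.* i ℕ.+ 3 ℕ.* tri i
        e₂ = 1 ℕ.* m ℕ.+ 1 ℕ.* tri m
        module S = ℕ-Solver.+-*-Solver
        doubled : m ℕ.* m ℕ.+ 3 ℕ.* (i ℕ.* i) ≡ (e₁ ℕ.+ (e₂ ℕ.+ r)) ℕ.* 2
        doubled = ≡.trans (≡.cong₂ (λ a b → a ℕ.+ 3 ℕ.* b) (tri-square m) (tri-square i))
          (≡.trans (S.solve 4 (λ i m s t → t S.:* S.con 2 S.:+ m S.:+ S.con 3 S.:* (s S.:* S.con 2 S.:+ i)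
              S.:= i S.:+ (S.con 2 S.:* i S.:+ S.con 6 S.:* s S.:+ S.con 2 S.:* t S.:+ m)) ≡.refl i m (tri i) (tri m))
          -- Only one i is expanded: together with m it makes the even number 2(m + r).
          (≡.trans (≡.cong (ℕ._+ (2 ℕ.* i ℕ.+ 6 ℕ.* tri i ℕ.+ 2 ℕ.* tri m ℕ.+ m)) i≡)
            (S.solve 5 (λ i m r s t → m S.:+ r S.:* S.con 2 S.:+ (S.con 2 S.:* i S.:+ S.con 6 S.:* s S.:+ S.con 2 S.:* t S.:+ m)
              S.:= (S.con 1 S.:* i S.:+ S.con 3 S.:* s S.:+ (S.con 1 S.:* m S.:+ S.con 1 S.:* t S.:+ r)) S.:* S.con 2)
              ≡.refl i m r (tri i) (tri m))))

      module RS = IntegerCoefficientSolver R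

      guarded-even : ∀ m r → i ≡ m ℕ.+ r ℕ.* 2 →
        guarded i m ≈ weight q Q i * gauss L u * (euler (l ℕ.* 3) m * denominator l (i ∸ m))
      guarded-even m r i≡ = begin
        guarded i m
          ≡⟨ ≡.cong (λ k → if ⌊ k ℕ.≟ 0 ⌋ then summand i m else 0#)
               (≡.trans (≡.cong (_% 2) sum≡) (ℕ.m*n%n≡0 (m ℕ.+ r) 2)) ⟩
        pow R q ((m ℕ.* m ℕ.+ 3 ℕ.* (i ℕ.* i)) / 2) * factor₁ᴸ i m * factor₂ᴸ i m * factor₃ᴸ i m
          ≈⟨ *-cong (*-cong (*-cong (exponent m r i≡) (factor₁-within m)) (factor₂-within m))
               (factor₃-within m r (≡.trans (≡.cong (_/ 2) sum≡) (ℕ.m*n/n≡m (m ℕ.+ r) 2))) ⟩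
        weight q Q i * (weight q q m * pow R q r) * gauss L u * qbin R q (l ℕ.* 3) m * gauss (l ℕ.* 2) r
          ≈⟨ RS.solve 6 (λ w v p g b d → w RS.:* (v RS.:* p) RS.:* g RS.:* b RS.:* d
               RS.:= w RS.:* g RS.:* (v RS.:* b RS.:* (p RS.:* d))) refl
               (weight q Q i) (weight q q m) (pow R q r) (gauss L u) (qbin R q (l ℕ.* 3) m) (gauss (l ℕ.* 2) r) ⟩
        weight q Q i * gauss L u * (euler (l ℕ.* 3) m * (pow R q r * gauss (l ℕ.* 2) r))
          ≈⟨ *-congˡ (*-congˡ (spread-even (dil q (gauss (l ℕ.* 2))) r)) ⟨
        weight q Q i * gauss L u * (euler (l ℕ.* 3) m * denominator l (r ℕ.* 2))
          ≡⟨ ≡.cong (λ k → weight q Q i * gauss L u * (euler (l ℕ.* 3) m * denominator l k))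
               (≡.trans (≡.cong (_∸ m) i≡) (ℕ.m+n∸m≡n m (r ℕ.* 2))) ⟨
        weight q Q i * gauss L u * (euler (l ℕ.* 3) m * denominator l (i ∸ m))
          ∎
        where
        sum≡ : i ℕ.+ m ≡ (m ℕ.+ r) ℕ.* 2
        sum≡ = ≡.trans (≡.cong (ℕ._+ m) i≡) (S.solve 2 (λ m r → m S.:+ r S.:* S.con 2 S.:+ m S.:= (m S.:+ r) S.:* S.con 2) ≡.refl m r)
          where module S = ℕ-Solver.+-*-Solver

      -- Both sides are zero: the guard fails, and `denominator` is a series in X², without odd
      -- coefficients.
      guarded-odd : ∀ m r → i ≡ m ℕ.+ suc (r ℕ.* 2) →
        guarded i m ≈ weight q Q i * gauss L u * (euler (l ℕ.* 3) m * denominator l (i ∸ m))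
      guarded-odd m r i≡ = begin
        guarded i m
          ≡⟨ ≡.cong (λ k → if ⌊ k ℕ.≟ 0 ⌋ then summand i m else 0#)
               (≡.trans (≡.cong (_% 2) sum≡) (ℕ.[m+kn]%n≡m%n 1 (m ℕ.+ r) 2)) ⟩
        0#
          ≈⟨ trans (*-congˡ (trans (*-congˡ (spread-odd (dil q (gauss (l ℕ.* 2))) r)) (zeroʳ _))) (zeroʳ _) ⟨
        weight q Q i * gauss L u * (euler (l ℕ.* 3) m * denominator l (suc (r ℕ.* 2)))
          ≡⟨ ≡.cong (λ k → weight q Q i * gauss L u * (euler (l ℕ.* 3) m * denominator l k))
               (≡.trans (≡.cong (_∸ m) i≡) (ℕ.m+n∸m≡n m (suc (r ℕ.* 2)))) ⟨
        weight q Q i * gauss L u * (euler (l ℕ.* 3) m * denominator l (i ∸ m))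
          ∎
        where
        sum≡ : i ℕ.+ m ≡ 1 ℕ.+ (m ℕ.+ r) ℕ.* 2
        sum≡ = ≡.trans (≡.cong (ℕ._+ m) i≡)
          (S.solve 2 (λ m r → m S.:+ (S.con 1 S.:+ r S.:* S.con 2) S.:+ m S.:= S.con 1 S.:+ (m S.:+ r) S.:* S.con 2) ≡.refl m r)
          where module S = ℕ-Solver.+-*-Solver

      guarded-within : ∀ m → m ℕ.< suc i →
        guarded i m ≈ weight q Q i * gauss L u * (euler (l ℕ.* 3) m * denominator l (i ∸ m))
      guarded-within m m<1+i with parity (i ∸ m)
      ... | inj₁ (r , d≡) = guarded-even m r (≡.trans (≡.sym (ℕ.m+[n∸m]≡n (ℕ.s≤s⁻¹ m<1+i))) (≡.cong (m ℕ.+_) d≡))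
      ... | inj₂ (r , d≡) = guarded-odd m r (≡.trans (≡.sym (ℕ.m+[n∸m]≡n (ℕ.s≤s⁻¹ m<1+i))) (≡.cong (m ℕ.+_) d≡))

      ∑-within : ∑ (suc (L ℕ.+ M)) (guarded i) ≈ Ψ L i * gauss L (M ∸ i)
      ∑-within = begin
        ∑ (suc (L ℕ.+ M)) (guarded i)
          ≡⟨ ≡.cong (λ k → ∑ (suc k) (guarded i)) (≡.trans (≡.cong (ℕ._+ M) L≡) (ℕ.+-assoc i l M)) ⟩
        ∑ (suc i ℕ.+ (l ℕ.+ M)) (guarded i)
          ≈⟨ ∑-dropʳ (suc i) (l ℕ.+ M) (beyond-i i) ⟩
        ∑ (suc i) (guarded i)
          ≈⟨ ∑-cong< (suc i) guarded-within ⟩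
        ∑ (suc i) (λ m → weight q Q i * gauss L u * (euler (l ℕ.* 3) m * denominator l (i ∸ m)))
          ≈⟨ ∑-*ˡ _ (suc i) _ ⟩
        weight q Q i * gauss L u * ∑ (suc i) (λ m → euler (l ℕ.* 3) m * denominator l (i ∸ m))
          ≈⟨ *-congˡ (⊛-∑ (euler (l ℕ.* 3)) (denominator l) i) ⟨
        weight q Q i * gauss L u * seed l i
          ≈⟨ RS.solve 3 (λ w g s → w RS.:* g RS.:* s RS.:= w RS.:* s RS.:* g) refl (weight q Q i) (gauss L u) (seed l i) ⟩
        ξ l i * gauss L u
          ≈⟨ *-cong (antidiagonal-within (λ n → ξ n i) i l)
               (reflexive (≡.cong (gauss L) (≡.trans (≡.cong (_∸ i) M≡) (ℕ.m+n∸m≡n i u)))) ⟨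
        antidiagonal (λ n → ξ n i) (i ℕ.+ l) i * gauss L (M ∸ i)
          ≡⟨ ≡.cong (λ k → antidiagonal (λ n → ξ n i) k i * gauss L (M ∸ i)) L≡ ⟨
        Ψ L i * gauss L (M ∸ i)
          ∎

    ∑-guarded : ∀ i → i ℕ.< suc M → ∑ (suc (L ℕ.+ M)) (guarded i) ≈ Ψ L i * gauss L (M ∸ i)
    ∑-guarded i i<1+M with ≤-split i L
    ... | inj₁ (l , L≡) = ∑-within i l (M ∸ i) L≡ (≡.sym (ℕ.m+[n∸m]≡n (ℕ.s≤s⁻¹ i<1+M)))
    ... | inj₂ (d , ≡.refl) = trans (∑-vanish (suc (L ℕ.+ M)) (λ m _ → beyond-L d m))
      (sym (trans (*-congʳ (antidiagonal-beyond (λ n → ξ n (suc (L ℕ.+ d))) L d)) (zeroˡ _)))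

    LHS≈Θ : LHS R q L M ≈ Θ L M
    LHS≈Θ = begin
      ∑ (suc (L ℕ.+ M)) (λ i → ∑ (suc (L ℕ.+ M)) (guarded i))
        ≡⟨ ≡.cong (λ k → ∑ (suc k) (λ i → ∑ (suc (L ℕ.+ M)) (guarded i))) (ℕ.+-comm L M) ⟩
      ∑ (suc M ℕ.+ L) (λ i → ∑ (suc (L ℕ.+ M)) (guarded i))
        ≈⟨ ∑-dropʳ (suc M) L (λ d → ∑-vanish (suc (L ℕ.+ M)) (λ m _ → beyond-M d m)) ⟩
      ∑ (suc M) (λ i → ∑ (suc (L ℕ.+ M)) (guarded i))
        ≈⟨ ∑-cong< (suc M) ∑-guarded ⟩
      ∑ (suc M) (λ i → Ψ L i * gauss L (M ∸ i))
        ≈⟨ ⊛-∑ (Ψ L) (gauss L) M ⟨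
      (Ψ L ⊛ gauss L) M
        ≈⟨ ⊛-comm (Ψ L) (gauss L) M ⟩
      Θ L M
        ∎

-- The right-hand sum as a convolution.

3j²+j-nonneg : ∀ j → + ∣ + 3 ℤ.* j ℤ.* j ℤ.+ j ∣ ≡ + 3 ℤ.* j ℤ.* j ℤ.+ j
3j²+j-nonneg j = nonneg (natural j)
  where
  open ℤ-Solver.+-*-Solver
  nonneg : ∀ {z} → (∃ λ n → z ≡ + n) → + ∣ z ∣ ≡ z
  nonneg (n , ≡.refl) = ≡.refl
  natural : ∀ j → ∃ λ n → + 3 ℤ.* j ℤ.* j ℤ.+ j ≡ + n
  natural (+ a) = 3 ℕ.* (a ℕ.* a) ℕ.+ a , ≡.sym (≡.trans
    (≡.cong (ℤ._+ + a) (≡.trans (ℤ.pos-* 3 (a ℕ.* a)) (≡.cong (+ 3 ℤ.*_) (ℤ.pos-* a a))))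
    (solve 1 (λ a → con (+ 3) :* (a :* a) :+ a := con (+ 3) :* a :* a :+ a) ≡.refl (+ a)))
  -- For j = -(1 + a), 3j² + j = 3a² + 5a + 2.
  natural -[1+ a ] = 3 ℕ.* (a ℕ.* a) ℕ.+ (a ℕ.+ a ℕ.+ a ℕ.+ a ℕ.+ a ℕ.+ 2) , ≡.sym (≡.trans
    (≡.cong (ℤ._+ + (a ℕ.+ a ℕ.+ a ℕ.+ a ℕ.+ a ℕ.+ 2)) (≡.trans (ℤ.pos-* 3 (a ℕ.* a)) (≡.cong (+ 3 ℤ.*_) (ℤ.pos-* a a))))
    (solve 1 (λ a → con (+ 3) :* (a :* a) :+ (a :+ a :+ a :+ a :+ a :+ con (+ 2))
      := con (+ 3) :* (:- (con (+ 1) :+ a)) :* (:- (con (+ 1) :+ a)) :+ :- (con (+ 1) :+ a)) ≡.refl (+ a)))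

module RightSum {c ℓ} (R : CommutativeRing c ℓ) (q : CommutativeRing.Carrier R) where
  open CommutativeRing R
  open PowerSeries R
  open Operators R
  open LeftHandSide R q hiding (τ)
  open RightHandSide R q
  open GaussianSeries R Q
  open Sums R
  private module GQ = IntegerGaussian R Q
  open SetoidReasoning setoid

  -- lag g n k = g (n - 2k), read as 0 when 2k > n.
  lag : Series → ℕ → ℕ → Carrier
  lag g n zero = g n
  lag g zero (suc k) = 0#
  lag g (suc zero) (suc k) = 0#
  lag g (suc (suc n)) (suc k) = lag g n k

  lag-within : ∀ g k e → lag g (k ℕ.* 2 ℕ.+ e) k ≈ g e
  lag-within g zero e = refl
  lag-within g (suc k) e = lag-within g k e

  lag-beyond : ∀ g L k e → k ℕ.* 2 ≡ suc (L ℕ.+ e) → lag g L k ≈ 0#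
  lag-beyond g zero (suc k) e eq = refl
  lag-beyond g (suc zero) (suc k) e eq = refl
  lag-beyond g (suc (suc L)) (suc k) e eq = lag-beyond g L k e (ℕ.suc-injective (ℕ.suc-injective eq))

  -- Two steps down in degree pass one coefficient of f and one zero of its spread, so the induction
  -- on N continues with the tail of f.
  spread-⊛-∑ : ∀ f g n N → (∀ k → f (N ℕ.+ k) ≈ 0#) → (spread f ⊛ g) n ≈ ∑ N (λ k → f k * lag g n k)
  spread-⊛-∑ f g n zero f≈0 = trans
    (⊛-cong {g = g} (λ i → trans (spread-cong f≈0 i) (spread-𝟘 i)) (λ i → refl) n) (⊛-zeroˡ g n)
  spread-⊛-∑ f g n (suc N) f≈0 = trans (go n) (sym (trans (∑-split 1 N (λ k → f k * lag g n k)) (+-congʳ (+-identityˡ _))))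
    where
    go : ∀ n → (spread f ⊛ g) n ≈ f 0 * g n + ∑ N (λ k → f (suc k) * lag g n (suc k))
    go zero = sym (trans (+-congˡ (∑-vanish N (λ k _ → zeroʳ _))) (+-identityʳ _))
    go (suc zero) = +-congˡ (trans (zeroˡ _) (sym (∑-vanish N (λ k _ → zeroʳ _))))
    go (suc (suc n)) = +-congˡ (trans (trans (+-congʳ (zeroˡ _)) (+-identityˡ _))
      (spread-⊛-∑ (tail f) g n N f≈0))

  module _ (L M : ℕ) where
    open ℤ-Solver.+-*-Solver

    -- The summand of the right-hand side in terms of κ = n + j.
    term : ℤ → ℤ → Carrier
    term κ j = pow R q ∣ + 3 ℤ.* j ℤ.* j ℤ.+ j ∣
      * (pow R Q ∣ (κ ℤ.- j) ℤ.* (κ ℤ.+ j) ∣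
        * qbinZ R Q (+ M ℤ.+ + L ℤ.- + 2 ℤ.* κ) (+ M)
        * qbinZ R Q (+ M ℤ.- j) (κ ℤ.- j)
        * qbinZ R Q (+ M ℤ.+ j) (κ ℤ.+ j))

    S-term : ∀ j n →
      pow R Q ∣ + n ℤ.* (+ n ℤ.+ + 2 ℤ.* j) ∣
      * qbinZ R Q (+ M ℤ.+ + L ℤ.- + 2 ℤ.* j ℤ.- + 2 ℤ.* + n) (+ M)
      * qbinZ R Q (+ M ℤ.- + 2 ℤ.* j ℤ.+ j) (+ n)
      * qbinZ R Q (+ M ℤ.+ + 2 ℤ.* j ℤ.- j) (+ n ℤ.+ + 2 ℤ.* j)
      ≡ pow R Q ∣ (j ℤ.+ + n ℤ.- j) ℤ.* (j ℤ.+ + n ℤ.+ j) ∣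
        * qbinZ R Q (+ M ℤ.+ + L ℤ.- + 2 ℤ.* (j ℤ.+ + n)) (+ M)
        * qbinZ R Q (+ M ℤ.- j) (j ℤ.+ + n ℤ.- j)
        * qbinZ R Q (+ M ℤ.+ j) (j ℤ.+ + n ℤ.+ j)
    S-term j n = ≡.cong₂ _*_ (≡.cong₂ _*_ (≡.cong₂ _*_
      (≡.cong (λ z → pow R Q ∣ z ∣) (solve 2 (λ j n → n :* (n :+ con (+ 2) :* j) := (j :+ n :- j) :* (j :+ n :+ j)) ≡.refl j (+ n)))
      (≡.cong (λ z → qbinZ R Q z (+ M)) (solve 4 (λ j n M L → M :+ L :- con (+ 2) :* j :- con (+ 2) :* n
        := M :+ L :- con (+ 2) :* (j :+ n)) ≡.refl j (+ n) (+ M) (+ L))))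
      (≡.cong₂ (qbinZ R Q) (solve 2 (λ j M → M :- con (+ 2) :* j :+ j := M :- j) ≡.refl j (+ M))
        (solve 2 (λ j n → n := j :+ n :- j) ≡.refl j (+ n))))
      (≡.cong₂ (qbinZ R Q) (solve 2 (λ j M → M :+ con (+ 2) :* j :- j := M :+ j) ≡.refl j (+ M))
        (solve 2 (λ j n → n :+ con (+ 2) :* j := j :+ n :+ j) ≡.refl j (+ n)))

    zero₂ : ∀ {a b x y z} → y ≈ 0# → a * (b * x * y * z) ≈ 0#
    zero₂ y≈0 = trans (*-congˡ (trans (*-congʳ (trans (*-congˡ y≈0) (zeroʳ _))) (zeroˡ _))) (zeroʳ _)

    zero₃ : ∀ {a b x y z} → z ≈ 0# → a * (b * x * y * z) ≈ 0#
    zero₃ z≈0 = trans (*-congˡ (trans (*-congˡ z≈0) (zeroʳ _))) (zeroʳ _)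

    term-κ>M : ∀ d j → term (+ (suc M ℕ.+ d)) j ≈ 0#
    term-κ>M d j = zero₂ (GQ.qbinZ-above (+ M ℤ.- j) (+ (suc M ℕ.+ d) ℤ.- j) d
      (solve 3 (λ M d j → M :- j :- (con (+ 1) :+ M :+ d :- j) := :- (con (+ 1) :+ d)) ≡.refl (+ M) (+ d) j))

    term-κ<j : ∀ d κ j → κ ℤ.- j ≡ -[1+ d ] → term κ j ≈ 0#
    term-κ<j d κ j eq = zero₂ (GQ.qbinZ-below (+ M ℤ.- j) (κ ℤ.- j) d eq)

    term-κ<-j : ∀ d κ j → κ ℤ.+ j ≡ -[1+ d ] → term κ j ≈ 0#
    term-κ<-j d κ j eq = zero₃ (GQ.qbinZ-below (+ M ℤ.+ j) (κ ℤ.+ j) d eq)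

    ∑-trim : ∀ e j → ∑ (suc (M ℕ.+ e)) (λ k → term (+ k) j) ≈ ∑ (suc M) (λ k → term (+ k) j)
    ∑-trim e j = ∑-dropʳ (suc M) e (λ d → term-κ>M d j)

    -- A range for κ independent of j allows the sums to be exchanged. For j ≥ 0 the terms with κ <
    -- j are added, for j < 0 those with κ < 0 are dropped, and in both cases those with κ > M; all
    -- of them vanish.
    ∑-κ : ∀ j → ∑ (suc (M ℕ.+ L ℕ.+ ∣ + 2 ℤ.* j ∣ ℕ.+ ∣ j ∣)) (λ n → term (j ℤ.+ + n) j) ≈ ∑ (suc M) (λ k → term (+ k) j)
    ∑-κ (+ a) = begin
      ∑ N (λ n → term (+ (a ℕ.+ n)) (+ a))
        ≈⟨ ∑-dropˡ a N below ⟨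
      ∑ (a ℕ.+ N) (λ k → term (+ k) (+ a))
        ≡⟨ ≡.cong (λ k → ∑ k (λ k → term (+ k) (+ a))) (S.solve 4 (λ a M L b →
             a S.:+ (S.con 1 S.:+ (M S.:+ L S.:+ b S.:+ a)) S.:= S.con 1 S.:+ (M S.:+ (L S.:+ b S.:+ a S.:+ a)))
             ≡.refl a M L ∣ + 2 ℤ.* + a ∣) ⟩
      ∑ (suc (M ℕ.+ (L ℕ.+ ∣ + 2 ℤ.* + a ∣ ℕ.+ a ℕ.+ a))) (λ k → term (+ k) (+ a))
        ≈⟨ ∑-trim (L ℕ.+ ∣ + 2 ℤ.* + a ∣ ℕ.+ a ℕ.+ a) (+ a) ⟩
      ∑ (suc M) (λ k → term (+ k) (+ a))
        ∎
      where
      module S = ℕ-Solver.+-*-Solver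
      N : ℕ
      N = suc (M ℕ.+ L ℕ.+ ∣ + 2 ℤ.* + a ∣ ℕ.+ a)
      below : ∀ k → k ℕ.< a → term (+ k) (+ a) ≈ 0#
      below k k<a = term-κ<j (a ∸ suc k) (+ k) (+ a)
        (≡.trans (≡.cong (λ z → + k ℤ.- + z) (≡.sym (ℕ.m+[n∸m]≡n k<a)))
          (solve 2 (λ k d → k :- (con (+ 1) :+ k :+ d) := :- (con (+ 1) :+ d)) ≡.refl (+ k) (+ (a ∸ suc k))))
    ∑-κ -[1+ a ] = begin
      ∑ (suc (M ℕ.+ L ℕ.+ ∣ + 2 ℤ.* -[1+ a ] ∣ ℕ.+ suc a)) (λ n → term (-[1+ a ] ℤ.+ + n) -[1+ a ])
        ≡⟨ ≡.cong (λ k → ∑ k (λ n → term (-[1+ a ] ℤ.+ + n) -[1+ a ])) (S.solve 4 (λ a M L b →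
             S.con 1 S.:+ (M S.:+ L S.:+ b S.:+ (S.con 1 S.:+ a)) S.:= S.con 1 S.:+ a S.:+ (S.con 1 S.:+ (M S.:+ (L S.:+ b))))
             ≡.refl a M L ∣ + 2 ℤ.* -[1+ a ] ∣) ⟩
      ∑ (suc a ℕ.+ suc rest) (λ n → term (-[1+ a ] ℤ.+ + n) -[1+ a ])
        ≈⟨ ∑-dropˡ (suc a) (suc rest) below ⟩
      ∑ (suc rest) (λ k → term (-[1+ a ] ℤ.+ + (suc a ℕ.+ k)) -[1+ a ])
        ≈⟨ ∑-cong (suc rest) (λ k → reflexive (≡.cong (λ z → term z -[1+ a ])
             (solve 2 (λ a k → :- (con (+ 1) :+ a) :+ (con (+ 1) :+ a :+ k) := k) ≡.refl (+ a) (+ k)))) ⟩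
      ∑ (suc rest) (λ k → term (+ k) -[1+ a ])
        ≈⟨ ∑-trim (L ℕ.+ ∣ + 2 ℤ.* -[1+ a ] ∣) -[1+ a ] ⟩
      ∑ (suc M) (λ k → term (+ k) -[1+ a ])
        ∎
      where
      module S = ℕ-Solver.+-*-Solver
      rest : ℕ
      rest = M ℕ.+ (L ℕ.+ ∣ + 2 ℤ.* -[1+ a ] ∣)
      below : ∀ n → n ℕ.< suc a → term (-[1+ a ] ℤ.+ + n) -[1+ a ] ≈ 0#
      below n n<1+a = term-κ<-j (suc (d ℕ.+ a)) (-[1+ a ] ℤ.+ + n) -[1+ a ]
        (≡.trans (≡.cong (λ k → -[1+ k ] ℤ.+ + n ℤ.+ -[1+ a ]) (≡.sym (ℕ.m+[n∸m]≡n (ℕ.s≤s⁻¹ n<1+a))))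
          (solve 3 (λ n d a → :- (con (+ 1) :+ (n :+ d)) :+ n :+ :- (con (+ 1) :+ a) := :- (con (+ 2) :+ (d :+ a)))
            ≡.refl (+ n) (+ d) (+ a)))
        where
        d : ℕ
        d = a ∸ n

    RHS≈∑∑ : RHS R q L M ≈ ∑ (suc M) (λ k → ∑ℤ R (L ℕ.+ M) (term (+ k)))
    RHS≈∑∑ = begin
      RHS R q L M
        ≈⟨ ∑-cong (suc ((L ℕ.+ M) ℕ.+ (L ℕ.+ M))) (λ t → inner (+ t ℤ.- + (L ℕ.+ M))) ⟩
      ∑ℤ R (L ℕ.+ M) (λ j → ∑ (suc M) (λ k → term (+ k) j))
        ≈⟨ ∑-swap (suc ((L ℕ.+ M) ℕ.+ (L ℕ.+ M))) (suc M) (λ t k → term (+ k) (+ t ℤ.- + (L ℕ.+ M))) ⟩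
      ∑ (suc M) (λ k → ∑ℤ R (L ℕ.+ M) (term (+ k)))
        ∎
      where
      inner : ∀ j → pow R q ∣ + 3 ℤ.* j ℤ.* j ℤ.+ j ∣ * S R Q L M (+ 2 ℤ.* j) j ≈ ∑ (suc M) (λ k → term (+ k) j)
      inner j = trans (sym (∑-*ˡ _ N _)) (trans (∑-cong N (λ n → *-congˡ (reflexive (S-term j n)))) (∑-κ j))
        where
        N : ℕ
        N = suc (M ℕ.+ L ℕ.+ ∣ + 2 ℤ.* j ∣ ℕ.+ ∣ j ∣)

    module _ (k N : ℕ) (M≡ : M ≡ k ℕ.+ N) where

      -- With j = c - k and d = 2k - c, 3j² + j + 3dc = 3k² - k + c.
      weight-exponent : ∀ c d → c ℕ.+ d ≡ k ℕ.+ k →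
        pow R q ∣ + 3 ℤ.* (+ c ℤ.- + k) ℤ.* (+ c ℤ.- + k) ℤ.+ (+ c ℤ.- + k) ∣ * pow R Q (d ℕ.* c)
        ≈ weight q² q⁶ k * pow R q c
      weight-exponent c d c+d≡ = begin
        pow R q ∣ p ∣ * pow R Q (d ℕ.* c)
          ≈⟨ *-congˡ (pow-pow q 3 (d ℕ.* c)) ⟩
        pow R q ∣ p ∣ * pow R q (3 ℕ.* (d ℕ.* c))
          ≈⟨ pow-+ q ∣ p ∣ _ ⟨
        pow R q (∣ p ∣ ℕ.+ 3 ℕ.* (d ℕ.* c))
          ≡⟨ ≡.cong (pow R q) (ℤ.+-injective exponents) ⟩
        pow R q (2 ℕ.* k ℕ.+ 6 ℕ.* tri k ℕ.+ c)
          ≈⟨ pow-+ q (2 ℕ.* k ℕ.+ 6 ℕ.* tri k) c ⟩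
        pow R q (2 ℕ.* k ℕ.+ 6 ℕ.* tri k) * pow R q c
          ≈⟨ *-congʳ (weight-pow q 2 6 refl refl k) ⟨
        weight q² q⁶ k * pow R q c
          ∎
        where
        p : ℤ
        p = + 3 ℤ.* (+ c ℤ.- + k) ℤ.* (+ c ℤ.- + k) ℤ.+ (+ c ℤ.- + k)
        d≡ : + d ≡ + k ℤ.+ + k ℤ.- + c
        d≡ = ≡.trans (solve 2 (λ c d → d := c :+ d :- c) ≡.refl (+ c) (+ d)) (≡.cong (λ z → + z ℤ.- + c) c+d≡)
        square : + k ℤ.* + k ≡ + tri k ℤ.* + 2 ℤ.+ + k
        square = ≡.trans (≡.sym (ℤ.pos-* k k)) (≡.trans (≡.cong +_ (tri-square k)) (≡.cong (ℤ._+ + k) (ℤ.pos-* (tri k) 2)))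
        exponents : + (∣ p ∣ ℕ.+ 3 ℕ.* (d ℕ.* c)) ≡ + (2 ℕ.* k ℕ.+ 6 ℕ.* tri k ℕ.+ c)
        exponents = ≡.trans
          (≡.cong₂ ℤ._+_ (3j²+j-nonneg (+ c ℤ.- + k)) (≡.trans (ℤ.pos-* 3 (d ℕ.* c)) (≡.cong (+ 3 ℤ.*_) (≡.trans (ℤ.pos-* d c) (≡.cong (ℤ._* + c) d≡)))))
          (≡.trans (solve 2 (λ c k → con (+ 3) :* (c :- k) :* (c :- k) :+ (c :- k) :+ con (+ 3) :* ((k :+ k :- c) :* c)
              := con (+ 3) :* (k :* k) :- k :+ c) ≡.refl (+ c) (+ k))
          (≡.trans (≡.cong (λ z → + 3 ℤ.* z ℤ.- + k ℤ.+ + c) square)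
          (≡.trans (solve 3 (λ t k c → con (+ 3) :* (t :* con (+ 2) :+ k) :- k :+ c := con (+ 2) :* k :+ con (+ 6) :* t :+ c) ≡.refl (+ tri k) (+ k) (+ c))
            (≡.cong (ℤ._+ + c) (≡.sym (≡.cong₂ ℤ._+_ (ℤ.pos-* 2 k) (ℤ.pos-* 6 (tri k))))))))

      outer-factor : qbinZ R Q (+ M ℤ.+ + L ℤ.- + 2 ℤ.* + k) (+ M) ≈ lag (gauss M) L k
      outer-factor with ≤-split (k ℕ.* 2) L
      ... | inj₁ (e , ≡.refl) = trans (GQ.qbinZ-pos (+ M ℤ.+ + (k ℕ.* 2 ℕ.+ e) ℤ.- + 2 ℤ.* + k) (+ M) M e ≡.refl
          (≡.trans (≡.cong (λ z → + M ℤ.+ (z ℤ.+ + e) ℤ.- + 2 ℤ.* + k ℤ.- + M) (ℤ.pos-* k 2))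
            (solve 3 (λ M k e → M :+ (k :* con (+ 2) :+ e) :- con (+ 2) :* k :- M := e) ≡.refl (+ M) (+ k) (+ e))))
        (sym (lag-within (gauss M) k e))
      ... | inj₂ (e , eq) = trans (GQ.qbinZ-above (+ M ℤ.+ + L ℤ.- + 2 ℤ.* + k) (+ M) e
          (≡.trans (≡.trans (solve 3 (λ M L k → M :+ L :- con (+ 2) :* k :- M := L :- k :* con (+ 2)) ≡.refl (+ M) (+ L) (+ k))
              (≡.cong (ℤ._-_ (+ L)) (≡.trans (≡.sym (ℤ.pos-* k 2)) (≡.cong +_ eq))))
            (solve 2 (λ L e → L :- (con (+ 1) :+ (L :+ e)) := :- (con (+ 1) :+ e)) ≡.refl (+ L) (+ e))))
        (sym (lag-beyond (gauss M) L k e eq))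

      module RS = IntegerCoefficientSolver R

      -- Here c = k + j and d = k - j. As M = k + N, the inner q-binomials have entries N + d over d
      -- and N + c over c, so they are coefficients of `gauss N`, and q^c dilates one of them.
      term-within : ∀ c d → c ℕ.+ d ≡ k ℕ.+ k →
        term (+ k) (+ c ℤ.- + k) ≈ weight q² q⁶ k * lag (gauss M) L k * (dil q (gauss N) c * gauss N d)
      term-within c d c+d≡ = begin
        term (+ k) (+ c ℤ.- + k)
          ≈⟨ *-congˡ (*-cong (*-cong (*-cong (reflexive (≡.cong (pow R Q) product≡)) outer-factor)
               (trans (GQ.qbinZ-pos (+ M ℤ.- (+ c ℤ.- + k)) (+ k ℤ.- (+ c ℤ.- + k)) d N k-j
                 (≡.trans (≡.cong (λ z → + z ℤ.- (+ c ℤ.- + k) ℤ.- (+ k ℤ.- (+ c ℤ.- + k))) M≡)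
                   (solve 3 (λ c k N → k :+ N :- (c :- k) :- (k :- (c :- k)) := N) ≡.refl (+ c) (+ k) (+ N)))) (sym (gauss-sym N d))))
               (trans (GQ.qbinZ-pos (+ M ℤ.+ (+ c ℤ.- + k)) (+ k ℤ.+ (+ c ℤ.- + k)) c N k+j
                 (≡.trans (≡.cong (λ z → + z ℤ.+ (+ c ℤ.- + k) ℤ.- (+ k ℤ.+ (+ c ℤ.- + k))) M≡)
                   (solve 3 (λ c k N → k :+ N :+ (c :- k) :- (k :+ (c :- k)) := N) ≡.refl (+ c) (+ k) (+ N)))) (sym (gauss-sym N c)))) ⟩
        pow R q ∣ + 3 ℤ.* (+ c ℤ.- + k) ℤ.* (+ c ℤ.- + k) ℤ.+ (+ c ℤ.- + k) ∣
          * (pow R Q (d ℕ.* c) * lag (gauss M) L k * gauss N d * gauss N c)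
          ≈⟨ RS.solve 5 (λ a b l x y → a RS.:* (b RS.:* l RS.:* x RS.:* y) RS.:= a RS.:* b RS.:* (l RS.:* x RS.:* y)) refl _ _ _ _ _ ⟩
        pow R q ∣ + 3 ℤ.* (+ c ℤ.- + k) ℤ.* (+ c ℤ.- + k) ℤ.+ (+ c ℤ.- + k) ∣ * pow R Q (d ℕ.* c)
          * (lag (gauss M) L k * gauss N d * gauss N c)
          ≈⟨ *-congʳ (weight-exponent c d c+d≡) ⟩
        weight q² q⁶ k * pow R q c * (lag (gauss M) L k * gauss N d * gauss N c)
          ≈⟨ RS.solve 5 (λ w p l x y → w RS.:* p RS.:* (l RS.:* x RS.:* y) RS.:= w RS.:* l RS.:* (p RS.:* y RS.:* x)) refl
               (weight q² q⁶ k) (pow R q c) (lag (gauss M) L k) (gauss N d) (gauss N c) ⟩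
        weight q² q⁶ k * lag (gauss M) L k * (dil q (gauss N) c * gauss N d)
          ∎
        where
        k-j : + k ℤ.- (+ c ℤ.- + k) ≡ + d
        k-j = ≡.trans (solve 2 (λ c k → k :- (c :- k) := k :+ k :- c) ≡.refl (+ c) (+ k))
          (≡.trans (≡.cong (λ z → + z ℤ.- + c) (≡.sym c+d≡)) (solve 2 (λ c d → c :+ d :- c := d) ≡.refl (+ c) (+ d)))
        k+j : + k ℤ.+ (+ c ℤ.- + k) ≡ + c
        k+j = solve 2 (λ c k → k :+ (c :- k) := c) ≡.refl (+ c) (+ k)
        product≡ : ∣ (+ k ℤ.- (+ c ℤ.- + k)) ℤ.* (+ k ℤ.+ (+ c ℤ.- + k)) ∣ ≡ d ℕ.* c
        product≡ = ≡.trans (≡.cong₂ (λ x y → ∣ x ℤ.* y ∣) k-j k+j) (ℤ.abs-* (+ d) (+ c))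

      term-left : ∀ p t → t ℕ.< p → term (+ k) (+ t ℤ.- + (p ℕ.+ k)) ≈ 0#
      term-left p t t<p = term-κ<-j (p ∸ suc t) (+ k) (+ t ℤ.- + (p ℕ.+ k))
        (≡.trans (≡.cong (λ z → + k ℤ.+ (+ t ℤ.- + (z ℕ.+ k))) (≡.sym (ℕ.m+[n∸m]≡n t<p)))
          (solve 3 (λ k t d → k :+ (t :- (con (+ 1) :+ t :+ d :+ k)) := :- (con (+ 1) :+ d)) ≡.refl (+ k) (+ t) (+ (p ∸ suc t))))

      term-right : ∀ d → term (+ k) (+ (suc (k ℕ.+ k) ℕ.+ d) ℤ.- + k) ≈ 0#
      term-right d = term-κ<j d (+ k) (+ (suc (k ℕ.+ k) ℕ.+ d) ℤ.- + k)
        (solve 2 (λ k d → k :- (con (+ 1) :+ (k :+ k) :+ d :- k) := :- (con (+ 1) :+ d)) ≡.refl (+ k) (+ d))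

      -- Only |j| ≤ k contributes. Since L + M = p + k with p = L + N, p vanishing terms are cut off
      -- at either end, and the rest is a Cauchy product at degree 2k.
      ∑ℤ-term : ∑ℤ R (L ℕ.+ M) (term (+ k)) ≈ ε M k * lag (gauss M) L k
      ∑ℤ-term = begin
        ∑ℤ R (L ℕ.+ M) (term (+ k))
          ≡⟨ ≡.cong (λ z → ∑ℤ R z (term (+ k))) (≡.trans (≡.cong (L ℕ.+_) (≡.trans M≡ (ℕ.+-comm k N))) (≡.sym (ℕ.+-assoc L N k))) ⟩
        ∑ℤ R (p ℕ.+ k) (term (+ k))
          ≡⟨ ≡.cong (λ z → ∑ z (λ t → term (+ k) (+ t ℤ.- + (p ℕ.+ k)))) (S.solve 2 (λ p k →
               S.con 1 S.:+ (p S.:+ k S.:+ (p S.:+ k)) S.:= p S.:+ (S.con 1 S.:+ (k S.:+ k) S.:+ p)) ≡.refl p k) ⟩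
        ∑ (p ℕ.+ (suc (k ℕ.+ k) ℕ.+ p)) (λ t → term (+ k) (+ t ℤ.- + (p ℕ.+ k)))
          ≈⟨ ∑-dropˡ p _ (term-left p) ⟩
        ∑ (suc (k ℕ.+ k) ℕ.+ p) (λ c → term (+ k) (+ (p ℕ.+ c) ℤ.- + (p ℕ.+ k)))
          ≈⟨ ∑-cong (suc (k ℕ.+ k) ℕ.+ p) (λ c → reflexive (≡.cong (term (+ k))
               (solve 3 (λ p c k → p :+ c :- (p :+ k) := c :- k) ≡.refl (+ p) (+ c) (+ k)))) ⟩
        ∑ (suc (k ℕ.+ k) ℕ.+ p) (λ c → term (+ k) (+ c ℤ.- + k))
          ≈⟨ ∑-dropʳ (suc (k ℕ.+ k)) p term-right ⟩
        ∑ (suc (k ℕ.+ k)) (λ c → term (+ k) (+ c ℤ.- + k))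
          ≈⟨ ∑-cong< (suc (k ℕ.+ k)) (λ c c<1+2k → term-within c (k ℕ.+ k ∸ c) (ℕ.m+[n∸m]≡n (ℕ.s≤s⁻¹ c<1+2k))) ⟩
        ∑ (suc (k ℕ.+ k)) (λ c → weight q² q⁶ k * lag (gauss M) L k * (dil q (gauss N) c * gauss N (k ℕ.+ k ∸ c)))
          ≈⟨ ∑-*ˡ _ (suc (k ℕ.+ k)) _ ⟩
        weight q² q⁶ k * lag (gauss M) L k * ∑ (suc (k ℕ.+ k)) (λ c → dil q (gauss N) c * gauss N (k ℕ.+ k ∸ c))
          ≈⟨ *-congˡ (⊛-∑ (dil q (gauss N)) (gauss N) (k ℕ.+ k)) ⟨
        weight q² q⁶ k * lag (gauss M) L k * (dil q (gauss N) ⊛ gauss N) (k ℕ.+ k)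
          ≈⟨ *-congˡ (trans (⊛-comm (dil q (gauss N)) (gauss N) (k ℕ.+ k))
               (reflexive (≡.cong (product N) (S.solve 1 (λ k → k S.:+ k S.:= k S.:* S.con 2) ≡.refl k)))) ⟩
        weight q² q⁶ k * lag (gauss M) L k * product N (k ℕ.* 2)
          ≈⟨ RS.solve 3 (λ w l g → w RS.:* l RS.:* g RS.:= w RS.:* g RS.:* l) refl (weight q² q⁶ k) (lag (gauss M) L k) (product N (k ℕ.* 2)) ⟩
        β N k * lag (gauss M) L k
          ≈⟨ *-congʳ (antidiagonal-within (λ n → β n k) k N) ⟨
        antidiagonal (λ n → β n k) (k ℕ.+ N) k * lag (gauss M) L k
          ≡⟨ ≡.cong (λ z → antidiagonal (λ n → β n k) z k * lag (gauss M) L k) M≡ ⟨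
        ε M k * lag (gauss M) L k
          ∎
        where
        module S = ℕ-Solver.+-*-Solver
        p : ℕ
        p = L ℕ.+ N

    RHS≈convolution : RHS R q L M ≈ (gauss M ⊛ E M) L
    RHS≈convolution = begin
      RHS R q L M
        ≈⟨ RHS≈∑∑ ⟩
      ∑ (suc M) (λ k → ∑ℤ R (L ℕ.+ M) (term (+ k)))
        ≈⟨ ∑-cong< (suc M) (λ k k<1+M → ∑ℤ-term k (M ∸ k) (≡.sym (ℕ.m+[n∸m]≡n (ℕ.s≤s⁻¹ k<1+M)))) ⟩
      ∑ (suc M) (λ k → ε M k * lag (gauss M) L k)
        ≈⟨ spread-⊛-∑ (ε M) (gauss M) L (suc M) (λ d → antidiagonal-beyond (λ n → β n (suc M ℕ.+ d)) M d) ⟨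
      (E M ⊛ gauss M) L
        ≈⟨ ⊛-comm (E M) (gauss M) L ⟩
      (gauss M ⊛ E M) L
        ∎

theorem6p1 : ∀ {c ℓ} (R : CommutativeRing c ℓ) (q : CommutativeRing.Carrier R) (L M : ℕ) →
    CommutativeRing._≈_ R (LHS R q L M) (RHS R q L M)
theorem6p1 R q L M = trans (LHS≈Θ L M) (trans (Θ-convolved L M) (sym (RHS≈convolution L M)))
  where
  open CommutativeRing R using (trans; sym)
  open LeftSum R q using (LHS≈Θ)
  open RightHandSide R q using (Θ-convolved)
  open RightSum R q using (RHS≈convolution)
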